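{- For $k\ge 1$ let $\delta_k=(k-1,k-2,\ldots,2,1)$ be the staircase partition, let $\upsilon_k=\delta_{2k}/\delta_k$, let $n=|\upsilon_k|=k(3k-1)/2$, and let $f^{\upsilon_k}$ be the number of standard Young tableaux of skew shape $\upsilon_k$. Then, as $k\to\infty$, $$\frac16-\frac32\log 2+\frac12\log 3+o(1)\ \le\ \frac1n\left(\log f^{\upsilon_k}-\frac12\,n\log n\right)\ \le\ \frac16-\frac72\log 2+2\log 3+o(1).$$
   Context: $\log$ denotes the natural logarithm. $|\lambda/\mu|$ is the number of cells of the skew shape $\lambda/\mu$. A standard Young tableau of skew shape $\lambda/\mu$ with $n$ cells is a bijective filling of the cells with $1,\ldots,n$, increasing along rows (left to right) and down columns. -}

module Defs where

open import Data.Fin.Base as Fin using (Fin; finToFun)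
import Data.Fin.Properties as Fin
open import Data.Integer.Base as ℤ using (+_; -[1+_])
import Data.Integer.Properties as ℤ
import Data.Integer.Tactic.RingSolver as ℤ-Solver
open import Data.List.Base as List
  using (List; []; _∷_; length; map; upTo; applyUpTo; applyDownFrom; concatMap; allFin; filter)
import Data.List.Properties as List
open import Data.List.Relation.Unary.All as All using (All)
import Data.List.Relation.Unary.All.Properties as All
open import Data.List.Relation.Unary.Linked as Linked using (Linked; []; [-]; _∷_)
open import Data.Nat.Base as ℕ using (ℕ; zero; suc; _∸_; NonZero)
import Data.Nat.DivMod as ℕ
import Data.Nat.Properties as ℕ
open import Data.Nat.ListAction using (sum)
open import Data.Nat.Tactic.RingSolver using (solve-∀)
open import Data.Product.Base using (_×_; _,_; proj₁; proj₂; ∃-syntax)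
open import Data.Rational.Base as ℚ using (ℚ; mkℚ; _/_; 0ℚ; 1ℚ; ½)
import Data.Rational.Properties as ℚ
import Data.Rational.Solver as ℚ-Solver
import Data.Rational.Unnormalised.Base as ℚᵘ
import Data.Rational.Unnormalised.Properties as ℚᵘ
open import Data.Sum.Base using (inj₁; inj₂)
open import Function.Base using (_∘_)
open import Function.Definitions using (Injective; Surjective; Bijective)
open import Relation.Binary.PropositionalEquality
open import Relation.Nullary.Decidable using (Dec; map′; _×-dec_; _→-dec_)

------------------------------------------------------------------------
-- Partitions, skew shapes and standard Young tableaux

-- The i-th entry (counting from 0), with infinitely many zeros appended.
entry : List ℕ → ℕ → ℕ
entry []       _       = 0
entry (x ∷ _)  zero    = x
entry (_ ∷ xs) (suc i) = entry xs i

record Partition : Set where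
  field
    parts      : List ℕ
    decreasing : Linked ℕ._≥_ parts
    positive   : All (ℕ._> 0) parts

  part : ℕ → ℕ
  part = entry parts

open Partition public

record SkewShape : Set where
  field
    outer inner : Partition
    contained   : ∀ i → part inner i ℕ.≤ part outer i

open SkewShape public

-- Cells are pairs (row , column), both counted from 0, listed row by row
-- from top to bottom and from left to right inside each row.
Cell : Set
Cell = ℕ × ℕ

rowCells : SkewShape → ℕ → List Cell
rowCells s i = map (λ j → i , part (inner s) i ℕ.+ j) (upTo (part (outer s) i ∸ part (inner s) i))

cells : SkewShape → List Cell
cells s = concatMap (rowCells s) (upTo (length (parts (outer s))))

size : SkewShape → ℕ
size s = length (cells s)

-- A filling T gives the cell at position c of the list cells s the number
-- toℕ (T c) + 1, so that the entries 1, …, n are represented by Fin n.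
Filling : SkewShape → Set
Filling s = Fin (size s) → Fin (size s)

module _ (s : SkewShape) where

  row col : Fin (size s) → ℕ
  row c = proj₁ (List.lookup (cells s) c)
  col c = proj₂ (List.lookup (cells s) c)

  record IsSYT (T : Filling s) : Set where
    field
      bijective       : Bijective _≡_ _≡_ T
      rowsIncrease    : ∀ c d → row c ≡ row d → col c ℕ.< col d → T c Fin.< T d
      columnsIncrease : ∀ c d → col c ≡ col d → row c ℕ.< row d → T c Fin.< T d

  private
    injective? : (T : Filling s) → Dec (Injective _≡_ _≡_ T)
    injective? T = map′ (λ h {x} {y} → h x y) (λ h x y → h)
      (Fin.all? λ x → Fin.all? λ y → (T x Fin.≟ T y) →-dec (x Fin.≟ y))

    surjective? : (T : Filling s) → Dec (Surjective _≡_ _≡_ T)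
    surjective? T = map′
      (λ h y → proj₁ (h y) , λ z≡x → trans (cong T z≡x) (proj₂ (h y)))
      (λ h y → proj₁ (h y) , proj₂ (h y) refl)
      (Fin.all? λ y → Fin.any? λ x → T x Fin.≟ y)

  isSYT? : (T : Filling s) → Dec (IsSYT T)
  isSYT? T = map′
    (λ (b , r , c) → record { bijective = b ; rowsIncrease = r ; columnsIncrease = c })
    (λ t → let open IsSYT t in bijective , rowsIncrease , columnsIncrease)
    ((injective? T ×-dec surjective? T)
      ×-dec (Fin.all? λ c → Fin.all? λ d →
        (row c ℕ.≟ row d) →-dec (col c ℕ.<? col d) →-dec (T c Fin.<? T d))
      ×-dec (Fin.all? λ c → Fin.all? λ d →
        (col c ℕ.≟ col d) →-dec (row c ℕ.<? row d) →-dec (T c Fin.<? T d)))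

  -- finToFun enumerates all functions Fin n → Fin n by Fin (n ^ n), each
  -- exactly once (up to pointwise equality).
  #SYT : ℕ
  #SYT = length (filter isSYT? (map finToFun (allFin (size s ℕ.^ size s))))

------------------------------------------------------------------------
-- Staircases

private
  linkedStaircase : ∀ m → Linked ℕ._≥_ (applyDownFrom suc m)
  linkedStaircase zero          = []
  linkedStaircase (suc zero)    = [-]
  linkedStaircase (suc (suc m)) = ℕ.n≤1+n _ ∷ linkedStaircase (suc m)

-- applyDownFrom suc m is the list m, m - 1, …, 1.
δ : ℕ → Partition
δ k = record
  { parts      = applyDownFrom suc (k ∸ 1)
  ; decreasing = linkedStaircase (k ∸ 1)
  ; positive   = All.applyDownFrom⁺₂ suc (k ∸ 1) (λ _ → ℕ.s≤s ℕ.z≤n)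
  }

private
  entry-staircase : ∀ m i → entry (applyDownFrom suc m) i ≡ m ∸ i
  entry-staircase zero    zero    = refl
  entry-staircase zero    (suc i) = refl
  entry-staircase (suc m) zero    = refl
  entry-staircase (suc m) (suc i) = entry-staircase m i

part-δ : ∀ k i → part (δ k) i ≡ k ∸ suc i
part-δ k i = trans (entry-staircase (k ∸ 1) i) (ℕ.∸-+-assoc k 1 i)

υ : ℕ → SkewShape
υ k = record
  { outer     = δ (2 ℕ.* k)
  ; inner     = δ k
  ; contained = λ i → subst₂ ℕ._≤_ (sym (part-δ k i)) (sym (part-δ (2 ℕ.* k) i))
                        (ℕ.∸-monoˡ-≤ (suc i) (ℕ.m≤m+n k _))
  }

private
  length-rowCells : ∀ s i → length (rowCells s i) ≡ part (outer s) i ∸ part (inner s) i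
  length-rowCells s i = trans
    (List.length-map (λ j → i , part (inner s) i ℕ.+ j) (upTo (part (outer s) i ∸ part (inner s) i)))
    (List.length-upTo (part (outer s) i ∸ part (inner s) i))

  length-concatMap : ∀ {A B : Set} (f : A → List B) xs →
                     length (concatMap f xs) ≡ sum (map (length ∘ f) xs)
  length-concatMap f []       = refl
  length-concatMap f (x ∷ xs) = trans (List.length-++ (f x)) (cong (length (f x) ℕ.+_) (length-concatMap f xs))

  sumTri : ℕ → ℕ
  sumTri b = sum (applyUpTo (λ i → suc b ∸ suc i) b)

  double-sumTri : ∀ b → 2 ℕ.* sumTri b ≡ b ℕ.* suc b
  double-sumTri zero    = refl
  double-sumTri (suc b) = trans (ℕ.*-distribˡ-+ 2 (suc b) (sumTri b))
    (trans (cong (2 ℕ.* suc b ℕ.+_) (double-sumTri b)) (lem b))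
    where
    lem : ∀ b → 2 ℕ.* suc b ℕ.+ b ℕ.* suc b ≡ suc b ℕ.* suc (suc b)
    lem = solve-∀

  sumRows : ∀ a b → sum (applyUpTo (λ i → (a ℕ.+ suc b ∸ suc i) ∸ (a ∸ suc i)) (a ℕ.+ b))
            ≡ a ℕ.* suc b ℕ.+ sumTri b
  sumRows zero    b = refl
  sumRows (suc a) b = begin
    (a ℕ.+ suc b ∸ a) ℕ.+ _                    ≡⟨ cong₂ ℕ._+_ (ℕ.m+n∸m≡n a (suc b)) (sumRows a b) ⟩
    suc b ℕ.+ (a ℕ.* suc b ℕ.+ sumTri b)       ≡⟨ sym (ℕ.+-assoc (suc b) (a ℕ.* suc b) (sumTri b)) ⟩
    suc a ℕ.* suc b ℕ.+ sumTri b               ∎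
    where open ≡-Reasoning

  double-size-υ : ∀ b → 2 ℕ.* size (υ (suc b)) ≡ suc b ℕ.* (3 ℕ.* suc b ∸ 1)
  double-size-υ b = begin
    2 ℕ.* size (υ k)
      ≡⟨ cong (2 ℕ.*_) (length-concatMap (rowCells (υ k)) (upTo L)) ⟩
    2 ℕ.* sum (map (length ∘ rowCells (υ k)) (upTo L))
      ≡⟨ cong (λ xs → 2 ℕ.* sum xs) (List.map-cong rowLength (upTo L)) ⟩
    2 ℕ.* sum (map g (upTo L))
      ≡⟨ cong (λ xs → 2 ℕ.* sum xs) (List.map-upTo g L) ⟩
    2 ℕ.* sum (applyUpTo g L)
      ≡⟨ cong (λ m → 2 ℕ.* sum (applyUpTo g m)) L≡ ⟩
    2 ℕ.* sum (applyUpTo g (suc b ℕ.+ b))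
      ≡⟨ cong (2 ℕ.*_) (sumRows (suc b) b) ⟩
    2 ℕ.* (suc b ℕ.* suc b ℕ.+ sumTri b)
      ≡⟨ ℕ.*-distribˡ-+ 2 (suc b ℕ.* suc b) (sumTri b) ⟩
    2 ℕ.* (suc b ℕ.* suc b) ℕ.+ 2 ℕ.* sumTri b
      ≡⟨ cong (2 ℕ.* (suc b ℕ.* suc b) ℕ.+_) (double-sumTri b) ⟩
    2 ℕ.* (suc b ℕ.* suc b) ℕ.+ b ℕ.* suc b
      ≡⟨ lem b ⟩
    suc b ℕ.* (b ℕ.+ (suc b ℕ.+ (suc b ℕ.+ 0))) ∎
    where
    open ≡-Reasoning
    k = suc b
    L = length (parts (δ (2 ℕ.* k)))
    g : ℕ → ℕ
    g i = (suc b ℕ.+ suc b ∸ suc i) ∸ (suc b ∸ suc i)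
    rowLength : ∀ i → length (rowCells (υ k) i) ≡ g i
    rowLength i = trans (length-rowCells (υ k) i)
      (cong₂ _∸_ (trans (part-δ (2 ℕ.* k) i) (cong (λ m → suc b ℕ.+ suc m ∸ suc i) (ℕ.+-identityʳ b)))
                 (part-δ k i))
    L≡ : L ≡ suc b ℕ.+ b
    L≡ = trans (List.length-applyDownFrom suc (2 ℕ.* k ∸ 1))
           (trans (cong (λ m → b ℕ.+ suc m) (ℕ.+-identityʳ b)) (ℕ.+-suc b b))
    lem : ∀ b → 2 ℕ.* (suc b ℕ.* suc b) ℕ.+ b ℕ.* suc b ≡ suc b ℕ.* (b ℕ.+ (suc b ℕ.+ (suc b ℕ.+ 0)))
    lem = solve-∀

size-υ : ∀ k → size (υ k) ≡ k ℕ.* (3 ℕ.* k ∸ 1) ℕ./ 2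
size-υ zero    = refl
size-υ (suc b) = sym (trans
  (cong (ℕ._/ 2) (trans (sym (double-size-υ b)) (ℕ.*-comm 2 (size (υ (suc b))))))
  (ℕ.m*n/n≡m (size (υ (suc b))) 2))

size-υ-nonZero : ∀ k → .{{NonZero k}} → NonZero (size (υ k))
size-υ-nonZero (suc b) = ℕ.≢-nonZero λ n≡0 →
  ℕ.1+n≢0 (trans (lem b) (trans (sym (double-size-υ b)) (cong (2 ℕ.*_) n≡0)))
  where
  lem : ∀ b → suc (b ℕ.* (3 ℕ.* b ℕ.+ 5) ℕ.+ 1) ≡ suc b ℕ.* (b ℕ.+ (suc b ℕ.+ (suc b ℕ.+ 0)))
  lem = solve-∀

------------------------------------------------------------------------
-- Real numbers as Cauchy sequences of rationals

record ℝ : Set where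
  field
    approx : ℕ → ℚ
    cauchy : ∀ ε → 0ℚ ℚ.< ε →
             ∃[ N ] (∀ m n → N ℕ.≤ m → N ℕ.≤ n → ℚ.∣ approx m ℚ.- approx n ∣ ℚ.≤ ε)

open ℝ public

infix  4 _≤ᴿ_
infixl 6 _+ᴿ_ _-ᴿ_
infixr 7 _·_
infix  8 -ᴿ_

_≤ᴿ_ : ℝ → ℝ → Set
x ≤ᴿ y = ∀ ε → 0ℚ ℚ.< ε → ∃[ N ] (∀ n → N ℕ.≤ n → approx x n ℚ.≤ approx y n ℚ.+ ε)

fromℚ : ℚ → ℝ
fromℚ q = record
  { approx = λ _ → q
  ; cauchy = λ ε 0<ε → 0 , λ _ _ _ _ →
      subst (λ p → ℚ.∣ p ∣ ℚ.≤ ε) (sym (ℚ.+-inverseʳ q)) (ℚ.<⇒≤ 0<ε)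
  }

_+ᴿ_ : ℝ → ℝ → ℝ
x +ᴿ y = record
  { approx = λ n → approx x n ℚ.+ approx y n
  ; cauchy = λ ε 0<ε →
      let instance ε⁺ = ℚ.positive 0<ε
          0<δ : 0ℚ ℚ.< ½ ℚ.* ε
          0<δ = ℚ.positive⁻¹ (½ ℚ.* ε) {{ℚ.pos*pos⇒pos ½ ε}}
          N₁ , h₁ = cauchy x (½ ℚ.* ε) 0<δ
          N₂ , h₂ = cauchy y (½ ℚ.* ε) 0<δ
      in N₁ ℕ.⊔ N₂ , λ m n N≤m N≤n → begin
        ℚ.∣ (approx x m ℚ.+ approx y m) ℚ.- (approx x n ℚ.+ approx y n) ∣
          ≡⟨ cong ℚ.∣_∣ (swap (approx x m) (approx y m) (approx x n) (approx y n)) ⟩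
        ℚ.∣ (approx x m ℚ.- approx x n) ℚ.+ (approx y m ℚ.- approx y n) ∣
          ≤⟨ ℚ.∣p+q∣≤∣p∣+∣q∣ (approx x m ℚ.- approx x n) (approx y m ℚ.- approx y n) ⟩
        ℚ.∣ approx x m ℚ.- approx x n ∣ ℚ.+ ℚ.∣ approx y m ℚ.- approx y n ∣
          ≤⟨ ℚ.+-mono-≤ (h₁ m n (ℕ.m⊔n≤o⇒m≤o N₁ N₂ N≤m) (ℕ.m⊔n≤o⇒m≤o N₁ N₂ N≤n))
                        (h₂ m n (ℕ.m⊔n≤o⇒n≤o N₁ N₂ N≤m) (ℕ.m⊔n≤o⇒n≤o N₁ N₂ N≤n)) ⟩
        ½ ℚ.* ε ℚ.+ ½ ℚ.* ε
          ≡⟨ sym (ℚ.*-distribʳ-+ ε ½ ½) ⟩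
        1ℚ ℚ.* ε
          ≡⟨ ℚ.*-identityˡ ε ⟩
        ε ∎
  }
  where
  open ℚ.≤-Reasoning
  swap : ∀ a b c d → (a ℚ.+ b) ℚ.- (c ℚ.+ d) ≡ (a ℚ.- c) ℚ.+ (b ℚ.- d)
  swap = solve 4 (λ a b c d → (a :+ b) :- (c :+ d) := (a :- c) :+ (b :- d)) refl
    where open ℚ-Solver.+-*-Solver

_·_ : ℚ → ℝ → ℝ
q · x = record
  { approx = λ n → q ℚ.* approx x n
  ; cauchy = λ ε 0<ε →
      let instance ε⁺ = ℚ.positive 0<ε
          N , h = cauchy x (1/K ℚ.* ε) (ℚ.positive⁻¹ (1/K ℚ.* ε) {{ℚ.pos*pos⇒pos 1/K ε}})
      in N , λ m n N≤m N≤n →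
        let e = ℚ.∣ approx x m ℚ.- approx x n ∣ in begin
        ℚ.∣ q ℚ.* approx x m ℚ.- q ℚ.* approx x n ∣
          ≡⟨ cong ℚ.∣_∣ (factor q (approx x m) (approx x n)) ⟩
        ℚ.∣ q ℚ.* (approx x m ℚ.- approx x n) ∣
          ≡⟨ ℚ.∣p*q∣≡∣p∣*∣q∣ q (approx x m ℚ.- approx x n) ⟩
        ℚ.∣ q ∣ ℚ.* e
          ≤⟨ ℚ.*-monoʳ-≤-nonNeg e {{ℚ.∣-∣-nonNeg (approx x m ℚ.- approx x n)}} ∣q∣≤K ⟩
        K ℚ.* e
          ≤⟨ ℚ.*-monoˡ-≤-nonNeg K {{ℚ.pos⇒nonNeg K}} (h m n N≤m N≤n) ⟩
        K ℚ.* (1/K ℚ.* ε)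
          ≡⟨ sym (ℚ.*-assoc K 1/K ε) ⟩
        (K ℚ.* 1/K) ℚ.* ε
          ≡⟨ cong (ℚ._* ε) (ℚ.*-inverseʳ K) ⟩
        1ℚ ℚ.* ε
          ≡⟨ ℚ.*-identityˡ ε ⟩
        ε ∎
  }
  where
  open ℚ.≤-Reasoning
  K = ℚ.∣ q ∣ ℚ.+ 1ℚ
  instance
    K⁺ : ℚ.Positive K
    K⁺ = ℚ.nonNeg+pos⇒pos ℚ.∣ q ∣ {{ℚ.∣-∣-nonNeg q}} 1ℚ
    K≢0 : ℚ.NonZero K
    K≢0 = ℚ.pos⇒nonZero K
  1/K = ℚ.1/ K
  instance
    1/K⁺ : ℚ.Positive 1/K
    1/K⁺ = ℚ.1/pos⇒pos K
  ∣q∣≤K : ℚ.∣ q ∣ ℚ.≤ K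
  ∣q∣≤K = subst (ℚ._≤ K) (ℚ.+-identityʳ ℚ.∣ q ∣) (ℚ.+-monoʳ-≤ ℚ.∣ q ∣ (ℚ.nonNegative⁻¹ 1ℚ))
  factor : ∀ q a b → q ℚ.* a ℚ.- q ℚ.* b ≡ q ℚ.* (a ℚ.- b)
  factor = solve 3 (λ q a b → q :* a :- q :* b := q :* (a :- b)) refl
    where open ℚ-Solver.+-*-Solver

-ᴿ_ : ℝ → ℝ
-ᴿ x = (ℚ.- 1ℚ) · x

_-ᴿ_ : ℝ → ℝ → ℝ
x -ᴿ y = x +ᴿ (-ᴿ y)

TendsToZero : (ℕ → ℝ) → Set
TendsToZero o = ∀ ε → 0ℚ ℚ.< ε →
  ∃[ K ] (∀ k → K ℕ.≤ k → (fromℚ (ℚ.- ε) ≤ᴿ o k) × (o k ≤ᴿ fromℚ ε))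

------------------------------------------------------------------------
-- The natural logarithm of a positive integer

private
  recip : ℕ → ℚ
  recip x = + 1 / suc x

-- recipSum a L = 1/(a+1) + 1/(a+2) + … + 1/(a+L)
recipSum : ℕ → ℕ → ℚ
recipSum a zero    = 0ℚ
recipSum a (suc L) = recipSum a L ℚ.+ + 1 / suc (a ℕ.+ L)

private
  recip-antimono : ∀ {x y} → x ℕ.≤ y → recip y ℚ.≤ recip x
  recip-antimono {x} {y} x≤y = ℚ.toℚᵘ-cancel-≤
    (ℚᵘ.≤-respˡ-≃ (ℚᵘ.≃-sym (ℚ.toℚᵘ-fromℚᵘ (ℚᵘ.mkℚᵘ (+ 1) y)))
      (ℚᵘ.≤-respʳ-≃ (ℚᵘ.≃-sym (ℚ.toℚᵘ-fromℚᵘ (ℚᵘ.mkℚᵘ (+ 1) x)))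
        (ℚᵘ.*≤* (ℤ.*-monoˡ-≤-nonNeg (+ 1) (ℤ.+≤+ (ℕ.s≤s x≤y))))))

  0≤recip : ∀ x → 0ℚ ℚ.≤ recip x
  0≤recip x = ℚ.nonNegative⁻¹ (recip x) {{ℚ.normalize-nonNeg 1 (suc x)}}

  times : ℕ → ℚ → ℚ
  times zero    c = 0ℚ
  times (suc k) c = times k c ℚ.+ c

  times-recip : ∀ k d → times k (recip d) ≡ + k / suc d
  times-recip zero    d = sym (ℚ.0/n≡0 (suc d))
  times-recip (suc k) d = trans (cong (ℚ._+ recip d) (times-recip k d)) (ℚ.toℚᵘ-injective (begin
    ℚ.toℚᵘ (+ k / suc d ℚ.+ recip d)                        ≈⟨ ℚ.toℚᵘ-homo-+ (+ k / suc d) (recip d) ⟩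
    ℚ.toℚᵘ (+ k / suc d) ℚᵘ.+ ℚ.toℚᵘ (recip d)              ≈⟨ ℚᵘ.+-cong (ℚ.toℚᵘ-fromℚᵘ (ℚᵘ.mkℚᵘ (+ k) d)) (ℚ.toℚᵘ-fromℚᵘ (ℚᵘ.mkℚᵘ (+ 1) d)) ⟩
    ℚᵘ.mkℚᵘ (+ k) d ℚᵘ.+ ℚᵘ.mkℚᵘ (+ 1) d                   ≈⟨ ℚᵘ.*≡* (lem (+ k) (+ suc d)) ⟩
    ℚᵘ.mkℚᵘ (+ suc k) d                                     ≈⟨ ℚᵘ.≃-sym (ℚ.toℚᵘ-fromℚᵘ (ℚᵘ.mkℚᵘ (+ suc k) d)) ⟩
    ℚ.toℚᵘ (+ suc k / suc d)                                ∎))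
    where
    open ℚᵘ.≃-Reasoning
    lem : ∀ k d → (k ℤ.* d ℤ.+ + 1 ℤ.* d) ℤ.* d ≡ (+ 1 ℤ.+ k) ℤ.* (d ℤ.* d)
    lem = ℤ-Solver.solve-∀

  -- M copies of 1/(M(x+1)), with M = M′ + 1, add up to 1/(x+1).
  times-block : ∀ M′ x → times (suc M′) (recip (x ℕ.+ M′ ℕ.* suc x)) ≡ recip x
  times-block M′ x = trans (times-recip (suc M′) (x ℕ.+ M′ ℕ.* suc x))
    (ℚ.fromℚᵘ-cong {ℚᵘ.mkℚᵘ (+ suc M′) (x ℕ.+ M′ ℕ.* suc x)} {ℚᵘ.mkℚᵘ (+ 1) x}
      (ℚᵘ.*≡* (cong +_ (sym (ℕ.+-identityʳ _)))))

  recipSum-≤ : ∀ a L c → (∀ j → j ℕ.< L → recip (a ℕ.+ j) ℚ.≤ c) → recipSum a L ℚ.≤ times L c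
  recipSum-≤ a zero    c h = ℚ.≤-refl
  recipSum-≤ a (suc L) c h =
    ℚ.+-mono-≤ (recipSum-≤ a L c λ j j<L → h j (ℕ.m<n⇒m<1+n j<L)) (h L ℕ.≤-refl)

  recipSum-≥ : ∀ a L c → (∀ j → j ℕ.< L → c ℚ.≤ recip (a ℕ.+ j)) → times L c ℚ.≤ recipSum a L
  recipSum-≥ a zero    c h = ℚ.≤-refl
  recipSum-≥ a (suc L) c h =
    ℚ.+-mono-≤ (recipSum-≥ a L c λ j j<L → h j (ℕ.m<n⇒m<1+n j<L)) (h L ℕ.≤-refl)

  recipSum-+ : ∀ a L L′ → recipSum a (L ℕ.+ L′) ≡ recipSum a L ℚ.+ recipSum (a ℕ.+ L) L′
  recipSum-+ a L zero = trans (cong (recipSum a) (ℕ.+-identityʳ L)) (sym (ℚ.+-identityʳ _))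
  recipSum-+ a L (suc L′) = begin
    recipSum a (L ℕ.+ suc L′)
      ≡⟨ cong (recipSum a) (ℕ.+-suc L L′) ⟩
    recipSum a (L ℕ.+ L′) ℚ.+ recip (a ℕ.+ (L ℕ.+ L′))
      ≡⟨ cong₂ ℚ._+_ (recipSum-+ a L L′) (cong recip (sym (ℕ.+-assoc a L L′))) ⟩
    recipSum a L ℚ.+ recipSum (a ℕ.+ L) L′ ℚ.+ recip (a ℕ.+ L ℕ.+ L′)
      ≡⟨ ℚ.+-assoc (recipSum a L) _ _ ⟩
    recipSum a L ℚ.+ recipSum (a ℕ.+ L) (suc L′) ∎
    where open ≡-Reasoning

  module _ (M′ : ℕ) where
    private M = suc M′

    block-≤ : ∀ x → recipSum (M ℕ.* suc x) M ℚ.≤ recip x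
    block-≤ x = subst (recipSum (M ℕ.* suc x) M ℚ.≤_) (times-block M′ x)
      (recipSum-≤ (M ℕ.* suc x) M _ λ j _ → recip-antimono {x ℕ.+ M′ ℕ.* suc x}
        (ℕ.m≤n⇒m≤1+n (ℕ.m≤m+n _ j)))

    block-≥ : ∀ x → recip (suc x) ℚ.≤ recipSum (M ℕ.* suc x) M
    block-≥ x = subst (ℚ._≤ recipSum (M ℕ.* suc x) M) (times-block M′ (suc x))
      (recipSum-≥ (M ℕ.* suc x) M _ λ j j<M → recip-antimono (ℕ.≤-pred (begin
        suc (M ℕ.* suc x ℕ.+ j)   ≡⟨ sym (ℕ.+-suc (M ℕ.* suc x) j) ⟩
        M ℕ.* suc x ℕ.+ suc j     ≤⟨ ℕ.+-monoʳ-≤ (M ℕ.* suc x) j<M ⟩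
        M ℕ.* suc x ℕ.+ M         ≡⟨ ℕ.+-comm (M ℕ.* suc x) M ⟩
        M ℕ.+ M ℕ.* suc x         ≡⟨ sym (ℕ.*-suc M (suc x)) ⟩
        M ℕ.* suc (suc x)         ∎)))
      where open ℕ.≤-Reasoning

    split : ∀ x L → recipSum (M ℕ.* suc x) (M ℕ.* suc L)
                    ≡ recipSum (M ℕ.* suc x) (M ℕ.* L) ℚ.+ recipSum (M ℕ.* suc (x ℕ.+ L)) M
    split x L = begin
      recipSum (M ℕ.* suc x) (M ℕ.* suc L)
        ≡⟨ cong (recipSum (M ℕ.* suc x)) (trans (ℕ.*-suc M L) (ℕ.+-comm M (M ℕ.* L))) ⟩
      recipSum (M ℕ.* suc x) (M ℕ.* L ℕ.+ M)
        ≡⟨ recipSum-+ (M ℕ.* suc x) (M ℕ.* L) M ⟩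
      recipSum (M ℕ.* suc x) (M ℕ.* L) ℚ.+ recipSum (M ℕ.* suc x ℕ.+ M ℕ.* L) M
        ≡⟨ cong (λ a → recipSum (M ℕ.* suc x) (M ℕ.* L) ℚ.+ recipSum a M) (sym (ℕ.*-distribˡ-+ M (suc x) L)) ⟩
      recipSum (M ℕ.* suc x) (M ℕ.* L) ℚ.+ recipSum (M ℕ.* suc (x ℕ.+ L)) M ∎
      where open ≡-Reasoning

    refine-≥ : ∀ x L → recipSum (suc x) L ℚ.≤ recipSum (M ℕ.* suc x) (M ℕ.* L)
    refine-≥ x zero = ℚ.≤-reflexive (cong (recipSum (M ℕ.* suc x)) (sym (ℕ.*-zeroʳ M)))
    refine-≥ x (suc L) = subst (recipSum (suc x) (suc L) ℚ.≤_) (sym (split x L))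
      (ℚ.+-mono-≤ (refine-≥ x L) (block-≥ (x ℕ.+ L)))

    refine-≤ : ∀ x L → recipSum (M ℕ.* suc x) (M ℕ.* L) ℚ.+ recip (x ℕ.+ L)
                       ℚ.≤ recipSum (suc x) L ℚ.+ recip x
    refine-≤ x zero = ℚ.≤-reflexive (cong₂ (λ u v → recipSum (M ℕ.* suc x) u ℚ.+ recip v)
                                      (ℕ.*-zeroʳ M) (ℕ.+-identityʳ x))
    refine-≤ x (suc L) = begin
      recipSum (M ℕ.* suc x) (M ℕ.* suc L) ℚ.+ recip (x ℕ.+ suc L)
        ≡⟨ cong₂ (λ u v → u ℚ.+ recip v) (split x L) (ℕ.+-suc x L) ⟩
      (X ℚ.+ recipSum (M ℕ.* suc (x ℕ.+ L)) M) ℚ.+ t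
        ≤⟨ ℚ.+-monoˡ-≤ t (ℚ.+-monoʳ-≤ X (block-≤ (x ℕ.+ L))) ⟩
      (X ℚ.+ recip (x ℕ.+ L)) ℚ.+ t
        ≤⟨ ℚ.+-monoˡ-≤ t (refine-≤ x L) ⟩
      (recipSum (suc x) L ℚ.+ recip x) ℚ.+ t
        ≡⟨ swap (recipSum (suc x) L) (recip x) t ⟩
      (recipSum (suc x) L ℚ.+ t) ℚ.+ recip x ∎
      where
      open ℚ.≤-Reasoning
      X = recipSum (M ℕ.* suc x) (M ℕ.* L)
      t = recip (suc (x ℕ.+ L))
      swap : ∀ a b c → (a ℚ.+ b) ℚ.+ c ≡ (a ℚ.+ c) ℚ.+ b
      swap = solve 3 (λ a b c → (a :+ b) :+ c := (a :+ c) :+ b) refl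
        where open ℚ-Solver.+-*-Solver

-- log m is the integral of dt/t over [1, m]: subdividing this interval into
-- (m - 1) N pieces of length 1/N, the right Riemann sum is
--   ∑ (1/N) · 1/(1 + i/N) = ∑ 1/(N + i),   1 ≤ i ≤ (m - 1) N,
-- and these sums form a Cauchy sequence in N = n + 1. Only m ≥ 1 is
-- meaningful; log 0 is 0.
logApprox : ℕ → ℕ → ℚ
logApprox m n = recipSum (suc n) ((m ∸ 1) ℕ.* suc n)

private
  log-gap : ∀ m i j → logApprox m i ℚ.- logApprox m j ℚ.≤ recip j
  log-gap m i j = begin
    logApprox m i ℚ.- A                ≤⟨ ℚ.+-monoˡ-≤ (ℚ.- A) (ℚ.≤-trans (refine-≥ j i L) common) ⟩
    (A ℚ.+ recip j) ℚ.- A              ≡⟨ cancel A (recip j) ⟩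
    recip j                            ∎
    where
    open ℚ.≤-Reasoning
    A = logApprox m j
    d = m ∸ 1
    L = d ℕ.* suc i
    exchange : ∀ a b c → a ℕ.* (b ℕ.* c) ≡ c ℕ.* (b ℕ.* a)
    exchange = solve-∀
    drop : ∀ p q → 0ℚ ℚ.≤ q → p ℚ.≤ p ℚ.+ q
    drop p q 0≤q = subst (ℚ._≤ p ℚ.+ q) (ℚ.+-identityʳ p) (ℚ.+-monoʳ-≤ p 0≤q)
    common : recipSum (suc j ℕ.* suc i) (suc j ℕ.* L) ℚ.≤ A ℚ.+ recip j
    common = begin
      recipSum (suc j ℕ.* suc i) (suc j ℕ.* L)
        ≡⟨ cong₂ recipSum (ℕ.*-comm (suc j) (suc i)) (exchange (suc j) d (suc i)) ⟩
      recipSum (suc i ℕ.* suc j) (suc i ℕ.* (d ℕ.* suc j))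
        ≤⟨ drop _ (recip (j ℕ.+ d ℕ.* suc j)) (0≤recip (j ℕ.+ d ℕ.* suc j)) ⟩
      recipSum (suc i ℕ.* suc j) (suc i ℕ.* (d ℕ.* suc j)) ℚ.+ recip (j ℕ.+ d ℕ.* suc j)
        ≤⟨ refine-≤ i j (d ℕ.* suc j) ⟩
      A ℚ.+ recip j ∎
    cancel : ∀ a b → (a ℚ.+ b) ℚ.- a ≡ b
    cancel = solve 2 (λ a b → (a :+ b) :- a := b) refl
      where open ℚ-Solver.+-*-Solver

  abs-≤ : ∀ p q {ε} → p ℚ.- q ℚ.≤ ε → q ℚ.- p ℚ.≤ ε → ℚ.∣ p ℚ.- q ∣ ℚ.≤ ε
  abs-≤ p q {ε} h h′ with ℚ.∣p∣≡p∨∣p∣≡-p (p ℚ.- q)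
  ... | inj₁ eq = subst (ℚ._≤ ε) (sym eq) h
  ... | inj₂ eq = subst (ℚ._≤ ε) (trans (flip p q) (sym eq)) h′
    where
    flip : ∀ p q → q ℚ.- p ≡ ℚ.- (p ℚ.- q)
    flip = solve 2 (λ p q → q :- p := :- (p :- q)) refl
      where open ℚ-Solver.+-*-Solver

  archimedean : ∀ ε → 0ℚ ℚ.< ε → ∃[ N ] recip N ℚ.≤ ε
  archimedean (mkℚ (+ zero)  q _) (ℚ.*<* (ℤ.+<+ ()))
  archimedean (mkℚ -[1+ _ ]  q _) (ℚ.*<* ())
  archimedean (mkℚ (+ suc p) q _) _ = q , ℚ.toℚᵘ-cancel-≤
    (ℚᵘ.≤-respˡ-≃ (ℚᵘ.≃-sym (ℚ.toℚᵘ-fromℚᵘ (ℚᵘ.mkℚᵘ (+ 1) q)))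
      (ℚᵘ.*≤* (ℤ.*-monoʳ-≤-nonNeg (+ suc q) (ℤ.+≤+ (ℕ.s≤s (ℕ.z≤n {p}))))))

log : ℕ → ℝ
log m = record
  { approx = logApprox m
  ; cauchy = λ ε 0<ε →
      let N , h = archimedean ε 0<ε in
      N , λ i j N≤i N≤j → abs-≤ (logApprox m i) (logApprox m j)
        (ℚ.≤-trans (log-gap m i j) (ℚ.≤-trans (recip-antimono N≤j) h))
        (ℚ.≤-trans (log-gap m j i) (ℚ.≤-trans (recip-antimono N≤i) h))
  }

{-# OPTIONS --safe #-}
module Submission where

-- For a partition μ inside λ with n = |λ/μ|, Naruse's formula reads
--   f^{λ/μ} = n! G(μ) / ∏_{u ∈ λ} h(u),   G(μ) = ∑_E ∏_{u ∈ E} h(u),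
-- where E runs over the excited diagrams of μ in λ. Since f^{λ/μ} is the sum of f^{λ/ν} over the
-- partitions ν that have one box more than μ, it amounts to the recurrence n G(μ) = ∑_ν G(ν). Now G(μ)
-- is the coefficient of μ in a product of factors 1 + h(u) u_{c(u)} applied to the empty partition,
-- where u_c adds a box of content c, and each factor intertwines the operator "sum over one more box,
-- plus a weight on the boundary of μ" with the same operator for a weight with two exchanged values.
--
-- Lower bound: keep only E = μ. Upper bound: f^μ f^{λ/μ} ≤ f^λ, where the two staircases are counted
-- by the hook length formula (μ = ∅); for υ_k this constant is smaller than the one claimed, by virtue
-- of 2 log 3 ≥ 3 log 2 + 1/9 and log 2 ≥ 1/2.
--
-- The logarithms of the factorials and of the products of odd hook lengths are summed by parts. This
-- only needs 1/(m + 1) ≤ log (m + 1) - log m ≤ 1/m, which holds exactly for each Riemann sum, and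
-- leaves an error of at most 8k (1 + log k).

open import Defs
import Algebra.Properties.Semiring.Sum
open import Data.Fin.Base as Fin using (Fin; zero; suc; toℕ; fromℕ<; finToFun; funToFin)
import Data.Fin.Properties as Fin
import Data.Integer.Base as ℤ
import Data.Integer.Properties as ℤ
import Data.Integer.Tactic.RingSolver as ℤ-Solver
open import Data.List.Base as List using (List; []; _∷_; length; map; concat; upTo)
import Data.List.Properties as List
open import Data.List.Membership.Propositional using (_∈_)
open import Data.List.Membership.Propositional.Properties
open import Data.List.Relation.Unary.All as All using ([]; _∷_)
import Data.List.Relation.Unary.All.Properties as All
open import Data.List.Relation.Unary.AllPairs as AllPairs using (AllPairs; []; _∷_)
import Data.List.Relation.Unary.AllPairs.Properties as AllPairs
open import Data.List.Relation.Unary.Any as Any using (here; there)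
open import Data.List.Relation.Unary.Any.Properties using (lookup-index)
open import Data.List.Relation.Unary.Unique.Propositional using (Unique)
import Data.List.Relation.Unary.Unique.Propositional.Properties as Unique
open import Data.Maybe.Base using (Maybe; just; nothing)
open import Data.Nat.Base as ℕ using (ℕ; zero; suc; z≤n; s≤s; s≤s⁻¹; NonZero)
import Data.Nat.DivMod as ℕ
import Data.Nat.Properties as ℕ
open import Data.Nat.Tactic.RingSolver using (solve-∀)
open import Data.Product.Base using (_×_; _,_; proj₁; proj₂; ∃-syntax)
open import Data.Rational.Base as ℚ using (ℚ; mkℚ; 0ℚ; 1ℚ; ½; _/_)
import Data.Rational.Properties as ℚ
import Data.Rational.Unnormalised.Base as ℚᵘ
import Data.Rational.Unnormalised.Properties as ℚᵘ
open import Data.Sum.Base using (_⊎_; inj₁; inj₂)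
open import Data.Vec.Base using (Vec; lookup; updateAt; tabulate)
import Data.Vec.Properties as Vec
open import Function.Base using (_∘_; id)
open import Function.Definitions using (Injective; Surjective)
open import Level using (0ℓ)
open import Relation.Binary.Definitions using (tri<; tri≈; tri>)
open import Relation.Binary.PropositionalEquality
open import Relation.Nullary.Decidable using (Dec; yes; no; _×-dec_; ¬?)
open import Relation.Nullary.Negation using (¬_; contradiction)
open import Tactic.RingSolver using () renaming (solve-∀ to ℚ-solve-∀)
open import Tactic.RingSolver.Core.AlmostCommutativeRing using (AlmostCommutativeRing; fromCommutativeRing)

-- Particles make the argument local: whether a box of given content can be added or removed depends
-- only on the occupation of two neighbouring sites. A factor 1 + βu at the sites c, c + 1 goes
-- together with exchanging the values y(c) and y(c + 1) when these differ by β. This dictates the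
-- hook lengths: starting from y = id, which encodes the recurrence, the site pairs of each layer
-- straddle those of the previous one, and every layer widens the gap by 2, through 1, 3, 5, ...,
-- the hook lengths on successive antidiagonals of a staircase. As they are constant on an
-- antidiagonal, a layer is a block of factors on disjoint pairs of sites. After the last layer only
-- the empty partition is left, and its indicator satisfies the equation for every weight. The
-- eigenvalue is not computed from the permuted weights: a degree bound makes G vanish above the
-- full staircase, and evaluation there yields the eigenvalue. The value of G at that staircase is
-- squeezed between two bounds by the hook product. Commutators are stated with compensating terms
-- on both sides, so everything stays in ℕ.

module Counting where

  open import Algebra.Properties.Semiring.Sum ℕ.+-*-semiring
  open import Data.Nat.Base using (pred; _+_; _*_; _∸_; _^_; _≤_; _<_; _!; >-nonZero)

  -- Finite sums with decidable conditions

  when : ∀ {P : Set} → Dec P → ℕ → ℕ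
  when (yes _) x = x
  when (no _)  _ = 0

  when-yes : ∀ {P : Set} (d : Dec P) {x} → P → when d x ≡ x
  when-yes (yes _) _ = refl
  when-yes (no ¬p) p = contradiction p ¬p

  when-no : ∀ {P : Set} (d : Dec P) {x} → ¬ P → when d x ≡ 0
  when-no (yes p) ¬p = contradiction p ¬p
  when-no (no _)  _  = refl

  when-cong : ∀ {P Q : Set} (d : Dec P) (e : Dec Q) {x y} →
              (P → Q) → (Q → P) → (P → x ≡ y) → when d x ≡ when e y
  when-cong (yes p) e       to from eq = trans (eq p) (sym (when-yes e (to p)))
  when-cong (no ¬p) e       to from eq = sym (when-no e (¬p ∘ from))

  when-× : ∀ {P Q : Set} (d : Dec P) (e : Dec Q) {x} → when d (when e x) ≡ when (d ×-dec e) x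
  when-× (yes _) (yes _) = refl
  when-× (yes _) (no _)  = refl
  when-× (no _)  _       = refl

  when-when : ∀ {P Q P′ Q′ : Set} (d : Dec P) (e : Dec Q) (d′ : Dec P′) (e′ : Dec Q′) {x y} →
              (P → Q → P′ × Q′) → (P′ → Q′ → P × Q) → (P → Q → x ≡ y) →
              when d (when e x) ≡ when d′ (when e′ y)
  when-when d e d′ e′ to from eq = trans (when-× d e)
    (trans (when-cong (d ×-dec e) (d′ ×-dec e′) (λ (p , q) → to p q) (λ (p , q) → from p q) (λ (p , q) → eq p q))
           (sym (when-× d′ e′)))

  when-* : ∀ {P : Set} (d : Dec P) a x → when d (a * x) ≡ a * when d x
  when-* (yes _) a x = refl
  when-* (no _)  a x = sym (ℕ.*-zeroʳ a)

  when-+ : ∀ {P : Set} (d : Dec P) x y → when d (x + y) ≡ when d x + when d y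
  when-+ (yes _) x y = refl
  when-+ (no _)  x y = refl

  sum-when : ∀ {n} {P : Set} (d : Dec P) (f : Fin n → ℕ) → when d (sum f) ≡ sum (λ i → when d (f i))
  sum-when     (yes _) f = refl
  sum-when {n} (no _)  f = sym (sum-replicate-zero n)

  sum-zero : ∀ {n} (f : Fin n → ℕ) → (∀ i → f i ≡ 0) → sum f ≡ 0
  sum-zero {n} f f≡0 = trans (sum-cong-≗ f≡0) (sum-replicate-zero n)

  sum-single : ∀ {n} (f : Fin n → ℕ) i → (∀ j → j ≢ i → f j ≡ 0) → sum f ≡ f i
  sum-single f zero    h = trans (cong (f zero +_) (sum-zero (f ∘ suc) λ j → h (suc j) λ ())) (ℕ.+-identityʳ _)
  sum-single f (suc i) h = trans (cong (_+ sum (f ∘ suc)) (h zero λ ()))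
    (sum-single (f ∘ suc) i λ j j≢i → h (suc j) (j≢i ∘ Fin.suc-injective))

  sum-diagonal : ∀ {n} (f : Fin n → Fin n → ℕ) → ∑[ i < n ] ∑[ j < n ] when (i Fin.≟ j) (f i j) ≡ ∑[ i < n ] f i i
  sum-diagonal {n} f = sum-cong-≗ {n} λ i → trans
    (sum-single _ i λ j j≢i → when-no (i Fin.≟ j) (j≢i ∘ sym))
    (when-yes (i Fin.≟ i) refl)

  -- A partition is recorded by particles on ℕ: row i of M rows, with r boxes, sits at r + (M - 1 - i).
  -- Adding a box moves a particle one step to the right, onto a free site.
  State : ℕ → Set
  State = Vec ℕ

  -- Moving one particle: commutation of adding and removing boxes

  module _ {M : ℕ} where

    raise lower : State M → Fin M → State M
    raise p i = updateAt p i suc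
    lower p i = updateAt p i pred

    Free : ℕ → State M → Set
    Free a p = ∀ j → lookup p j ≢ a

    free? : ∀ a p → Dec (Free a p)
    free? a p = Fin.all? λ j → ¬? (lookup p j ℕ.≟ a)

    Lowerable : ℕ → State M → Fin M → Set
    Lowerable c p j = lookup p j ≡ suc c × Free c p

    lowerable? : ∀ c p j → Dec (Lowerable c p j)
    lowerable? c p j = (lookup p j ℕ.≟ suc c) ×-dec free? c p

    raisable? : ∀ p i → Dec (Free (suc (lookup p i)) p)
    raisable? p i = free? (suc (lookup p i)) p

    Distinct : State M → Set
    Distinct p = ∀ i j → lookup p i ≡ lookup p j → i ≡ j

    sumRaised : (State M → ℕ) → State M → ℕ
    sumRaised G p = ∑[ i < M ] when (raisable? p i) (G (raise p i))

    sumLowered : ℕ → (State M → ℕ) → State M → ℕ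
    sumLowered c G p = ∑[ j < M ] when (lowerable? c p j) (G (lower p j))

    -- The operator 1 + β u, where u adds a box on the diagonal given by the sites c and c + 1,
    -- acting on coefficient functions.
    hop : ℕ → ℕ → (State M → ℕ) → State M → ℕ
    hop c β G p = G p + β * sumLowered c G p

    weight : (ℕ → ℕ) → State M → ℕ
    weight y p = ∑[ i < M ] y (lookup p i)

    -- For `y = id` the weight is the number of boxes up to an additive constant, so this is the
    -- recurrence for G without subtraction. General `y` is needed because each factor of the
    -- operator product exchanges two values of `y`.
    Eigen : (ℕ → ℕ) → ℕ → (State M → ℕ) → Set
    Eigen y C G = ∀ p → Distinct p → sumRaised G p + weight y p * G p ≡ C * G p

    lookup-raise : ∀ p i → lookup (raise p i) i ≡ suc (lookup p i)
    lookup-raise p i = Vec.lookup∘updateAt i p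

    lookup-raise′ : ∀ p {i j} → j ≢ i → lookup (raise p i) j ≡ lookup p j
    lookup-raise′ p {i} {j} j≢i = Vec.lookup∘updateAt′ j i j≢i p

    lookup-lower : ∀ p i → lookup (lower p i) i ≡ pred (lookup p i)
    lookup-lower p i = Vec.lookup∘updateAt i p

    lookup-lower′ : ∀ p {i j} → j ≢ i → lookup (lower p i) j ≡ lookup p j
    lookup-lower′ p {i} {j} j≢i = Vec.lookup∘updateAt′ j i j≢i p

    lower-raise : ∀ p i → lower (raise p i) i ≡ p
    lower-raise p i = trans (Vec.updateAt-updateAt i p) (Vec.updateAt-id i p)

    raise-lower : ∀ p i {c} → lookup p i ≡ suc c → raise (lower p i) i ≡ p
    raise-lower p i eq = trans (Vec.updateAt-updateAt i p)
      (Vec.updateAt-id-local i p (trans (cong (λ a → suc (pred a)) eq) (sym eq)))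

    raise-distinct : ∀ p i → Distinct p → Free (suc (lookup p i)) p → Distinct (raise p i)
    raise-distinct p i d f j l eq with j Fin.≟ i | l Fin.≟ i
    ... | yes refl | yes refl = refl
    ... | yes refl | no l≢i = contradiction (trans (sym (lookup-raise′ p l≢i)) (trans (sym eq) (lookup-raise p i))) (f l)
    ... | no j≢i | yes refl = contradiction (trans (sym (lookup-raise′ p j≢i)) (trans eq (lookup-raise p i))) (f j)
    ... | no j≢i | no l≢i = d j l (trans (sym (lookup-raise′ p j≢i)) (trans eq (lookup-raise′ p l≢i)))

    module _ {c : ℕ} (p : State M) (j : Fin M) (h : Lowerable c p j) where

      lookup-lowered : lookup (lower p j) j ≡ c
      lookup-lowered = trans (lookup-lower p j) (cong pred (proj₁ h))

      lower-distinct : Distinct p → Distinct (lower p j)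
      lower-distinct d i l eq with i Fin.≟ j | l Fin.≟ j
      ... | yes refl | yes refl = refl
      ... | yes refl | no l≢j = contradiction (trans (sym (lookup-lower′ p l≢j)) (trans (sym eq) lookup-lowered)) (proj₂ h l)
      ... | no i≢j | yes refl = contradiction (trans (sym (lookup-lower′ p i≢j)) (trans eq lookup-lowered)) (proj₂ h i)
      ... | no i≢j | no l≢j = d i l (trans (sym (lookup-lower′ p i≢j)) (trans eq (lookup-lower′ p l≢j)))

    -- Different particles move independently: both orders impose the same conditions. For `i = j`
    -- both orders return to `p`, but under different conditions; each side receives the diagonal
    -- term of the other.
    exchange : ∀ c G p → Distinct p → ∀ i j →
      when (raisable? p i) (when (lowerable? c (raise p i) j) (G (lower (raise p i) j)))
        + when (i Fin.≟ j) (when (lowerable? c p j) (G p))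
      ≡ when (lowerable? c p j) (when (raisable? (lower p j) i) (G (raise (lower p j) i)))
        + when (i Fin.≟ j) (when (raisable? p i) (when (lookup p i ℕ.≟ c) (G p)))
    exchange c G p d i j with i Fin.≟ j
    ... | no i≢j = cong (_+ 0) (when-when (raisable? p i) (lowerable? c (raise p i) j)
                                          (lowerable? c p j) (raisable? (lower p j) i) to from
        λ _ _ → cong G (sym (Vec.updateAt-commutes i j i≢j p)))
      where
      to : Free (suc (lookup p i)) p → Lowerable c (raise p i) j →
           Lowerable c p j × Free (suc (lookup (lower p j) i)) (lower p j)
      to fi (eq , fc) = h , λ l eq′ → free l (trans eq′ (cong suc (lookup-lower′ p i≢j)))
        where
        pj : lookup p j ≡ suc c
        pj = trans (sym (lookup-raise′ p (i≢j ∘ sym))) eq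
        h : Lowerable c p j
        h = pj , λ l pl → case l pl (l Fin.≟ i)
          where
          case : ∀ l → lookup p l ≡ c → Dec (l ≡ i) → _
          case l pl (yes refl) = fi j (trans pj (cong suc (sym pl)))
          case l pl (no l≢i)   = fc l (trans (lookup-raise′ p l≢i) pl)
        free : ∀ l → lookup (lower p j) l ≢ suc (lookup p i)
        free l eq′ with l Fin.≟ j
        ... | yes refl = fc i (trans (lookup-raise p i) (trans (sym eq′) (lookup-lowered p j h)))
        ... | no l≢j   = fi l (trans (sym (lookup-lower′ p l≢j)) eq′)
      from : Lowerable c p j → Free (suc (lookup (lower p j) i)) (lower p j) →
             Free (suc (lookup p i)) p × Lowerable c (raise p i) j
      from h@(pj , fc) f = free , trans (lookup-raise′ p (i≢j ∘ sym)) pj , free′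
        where
        free : Free (suc (lookup p i)) p
        free l eq with l Fin.≟ j
        ... | yes refl = fc i (ℕ.suc-injective (trans (sym eq) pj))
        ... | no l≢j = f l (trans (lookup-lower′ p l≢j) (trans eq (cong suc (sym (lookup-lower′ p i≢j)))))
        free′ : Free c (raise p i)
        free′ l eq with l Fin.≟ i
        ... | yes refl = f j (trans (lookup-lowered p j h) (trans (sym eq)
                           (trans (lookup-raise p i) (cong suc (sym (lookup-lower′ p i≢j))))))
        ... | no l≢i = fc l (trans (sym (lookup-raise′ p l≢i)) eq)
    ... | yes refl = trans (ℕ.+-comm _ (when (lowerable? c p i) (G p))) (cong₂ _+_ second first)
      where
      second : when (lowerable? c p i) (G p)
               ≡ when (lowerable? c p i) (when (raisable? (lower p i) i) (G (raise (lower p i) i)))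
      second = when-cong (lowerable? c p i) (lowerable? c p i) id id λ h →
        trans (cong G (sym (raise-lower p i (proj₁ h))))
              (sym (when-yes (raisable? (lower p i) i) λ l eq → free h l (trans eq (cong suc (lookup-lowered p i h)))))
        where
        free : Lowerable c p i → ∀ l → lookup (lower p i) l ≢ suc c
        free h l eq with l Fin.≟ i
        ... | yes refl = ℕ.1+n≢n (sym (trans (sym (lookup-lowered p i h)) eq))
        ... | no l≢i = l≢i (d l i (trans (trans (sym (lookup-lower′ p l≢i)) eq) (sym (proj₁ h))))
      first : when (raisable? p i) (when (lowerable? c (raise p i) i) (G (lower (raise p i) i)))
              ≡ when (raisable? p i) (when (lookup p i ℕ.≟ c) (G p))
      first = when-cong (raisable? p i) (raisable? p i) id id λ fi →
        when-cong (lowerable? c (raise p i) i) (lookup p i ℕ.≟ c)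
          (λ h → ℕ.suc-injective (trans (sym (lookup-raise p i)) (proj₁ h)))
          (λ pi → trans (lookup-raise p i) (cong suc pi) , free pi)
          (λ _ → cong G (lower-raise p i))
        where
        free : lookup p i ≡ c → Free c (raise p i)
        free pi l eq with l Fin.≟ i
        ... | yes refl = ℕ.1+n≢n (trans (trans (sym (lookup-raise p i)) eq) (sym pi))
        ... | no l≢i = l≢i (d l i (trans (trans (sym (lookup-raise′ p l≢i)) eq) (sym pi)))

    occupancy : ℕ → State M → ℕ
    occupancy a p = ∑[ i < M ] when (lookup p i ℕ.≟ a) 1

    occupancy-free : ∀ {a} p → Free a p → occupancy a p ≡ 0
    occupancy-free {a} p f = sum-zero _ λ i → when-no (lookup p i ℕ.≟ a) (f i)

    occupancy-occupied : ∀ p → Distinct p → ∀ i → occupancy (lookup p i) p ≡ 1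
    occupancy-occupied p d i = trans
      (sum-single _ i λ j j≢i → when-no (lookup p j ℕ.≟ lookup p i) (j≢i ∘ d j i))
      (when-yes (lookup p i ℕ.≟ lookup p i) refl)

    ¬free⇒occupied : ∀ {a} {p : State M} → ¬ Free a p → ∃[ i ] lookup p i ≡ a
    ¬free⇒occupied {a} {p} ¬f with Fin.any? (λ i → lookup p i ℕ.≟ a)
    ... | yes r = r
    ... | no ¬r = contradiction (λ i eq → ¬r (i , eq)) ¬f

    -- If exactly one of the sites c and c + 1 is occupied, one jump between them is possible; if
    -- both or neither are, none is. Distinctness makes the occupancies 0 or 1.
    jumps : ∀ c p → Distinct p →
      (∑[ i < M ] when (raisable? p i) (when (lookup p i ℕ.≟ c) 1)) + occupancy (suc c) p
      ≡ (∑[ j < M ] when (lowerable? c p j) 1) + occupancy c p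
    jumps c p d = trans (cong (_+ occupancy (suc c) p) up) (trans (balance (free? (suc c) p) (free? c p))
                    (cong (_+ occupancy c p) (sym down)))
      where
      up : ∑[ i < M ] when (raisable? p i) (when (lookup p i ℕ.≟ c) 1) ≡ when (free? (suc c) p) (occupancy c p)
      up = trans (sum-cong-≗ λ i → when-when (raisable? p i) (lookup p i ℕ.≟ c) (free? (suc c) p) (lookup p i ℕ.≟ c)
                    (λ f pi → subst (λ a → Free (suc a) p) pi f , pi)
                    (λ f pi → subst (λ a → Free (suc a) p) (sym pi) f , pi) λ _ _ → refl)
                 (sym (sum-when {M} (free? (suc c) p) (λ i → when (lookup p i ℕ.≟ c) 1)))
      down : ∑[ j < M ] when (lowerable? c p j) 1 ≡ when (free? c p) (occupancy (suc c) p)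
      down = trans (sum-cong-≗ λ j → trans (when-cong (lowerable? c p j) (free? c p ×-dec (lookup p j ℕ.≟ suc c))
                      (λ (x , y) → y , x) (λ (x , y) → y , x) (λ _ → refl))
                      (sym (when-× (free? c p) (lookup p j ℕ.≟ suc c))))
                   (sym (sum-when {M} (free? c p) (λ i → when (lookup p i ℕ.≟ suc c) 1)))
      balance : (e : Dec (Free (suc c) p)) (e′ : Dec (Free c p)) →
        when e (occupancy c p) + occupancy (suc c) p ≡ when e′ (occupancy (suc c) p) + occupancy c p
      balance (yes f) (yes f′) = ℕ.+-comm (occupancy c p) _
      balance (yes f) (no ¬f′) = trans (cong (occupancy c p +_) (occupancy-free p f)) (ℕ.+-identityʳ _)
      balance (no ¬f) (yes f′) = sym (trans (cong (occupancy (suc c) p +_) (occupancy-free p f′)) (ℕ.+-identityʳ _))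
      balance (no ¬f) (no ¬f′) with ¬free⇒occupied {suc c} {p} ¬f | ¬free⇒occupied {c} {p} ¬f′
      ... | i , pi | i′ , pi′ =
        trans (subst (λ a → occupancy a p ≡ 1) pi (occupancy-occupied p d i))
              (sym (subst (λ a → occupancy a p ≡ 1) pi′ (occupancy-occupied p d i′)))

    weight-swap : ∀ {c β y y′} → y′ (suc c) ≡ y′ c + β → y c ≡ y′ (suc c) → y (suc c) ≡ y′ c →
      (∀ a → a ≢ c → a ≢ suc c → y a ≡ y′ a) →
      ∀ p → weight y p + β * occupancy (suc c) p ≡ weight y′ p + β * occupancy c p
    weight-swap {c} {β} {y} {y′} hβ hc hc′ ho p =
      trans (cong (weight y p +_) (*-distribˡ-sum β (λ i → when (lookup p i ℕ.≟ suc c) 1)))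
      (trans (sym (∑-distrib-+ (λ i → y (lookup p i)) (λ i → β * when (lookup p i ℕ.≟ suc c) 1)))
      (trans (sum-cong-≗ {M} λ i → pointwise (lookup p i) (lookup p i ℕ.≟ suc c) (lookup p i ℕ.≟ c))
      (trans (∑-distrib-+ (λ i → y′ (lookup p i)) (λ i → β * when (lookup p i ℕ.≟ c) 1))
      (cong (weight y′ p +_) (sym (*-distribˡ-sum β (λ i → when (lookup p i ℕ.≟ c) 1)))))))
      where
      pointwise : ∀ a (d : Dec (a ≡ suc c)) (e : Dec (a ≡ c)) → y a + β * when d 1 ≡ y′ a + β * when e 1
      pointwise a (yes refl) (yes ())
      pointwise a (yes refl) (no _) = trans (cong₂ _+_ hc′ (ℕ.*-identityʳ β)) (trans (sym hβ)
        (sym (trans (cong (y′ (suc c) +_) (ℕ.*-zeroʳ β)) (ℕ.+-identityʳ _))))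
      pointwise a (no _) (yes refl) = trans (cong (y c +_) (ℕ.*-zeroʳ β)) (trans (ℕ.+-identityʳ _)
        (trans hc (trans hβ (cong (y′ c +_) (sym (ℕ.*-identityʳ β))))))
      pointwise a (no a≢c′) (no a≢c) = cong (_+ β * 0) (ho a a≢c a≢c′)

    -- The moved particle carries its value from c + 1 to c, and no other particle stands on either
    -- site, before or after the move.
    weight-lower : ∀ {c y y′} → y c ≡ y′ (suc c) → (∀ a → a ≢ c → a ≢ suc c → y a ≡ y′ a) →
      ∀ p j → Distinct p → Lowerable c p j → weight y (lower p j) ≡ weight y′ p
    weight-lower {c} {y} {y′} hc ho p j d h = sum-cong-≗ {M} λ i → pointwise i (i Fin.≟ j)
      where
      pointwise : ∀ i → Dec (i ≡ j) → y (lookup (lower p j) i) ≡ y′ (lookup p i)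
      pointwise i (yes refl) = trans (cong y (lookup-lowered p j h)) (trans hc (cong y′ (sym (proj₁ h))))
      pointwise i (no i≢j) = trans (cong y (lookup-lower′ p i≢j))
        (ho (lookup p i) (proj₂ h i) (λ eq → i≢j (d i j (trans eq (sym (proj₁ h))))))

    sumRaised-hop : ∀ c β G p → sumRaised (hop c β G) p ≡ sumRaised G p + β * sumRaised (sumLowered c G) p
    sumRaised-hop c β G p = trans
      (sum-cong-≗ {M} λ i → trans (when-+ (raisable? p i) (G (raise p i)) _)
        (cong (when (raisable? p i) (G (raise p i)) +_) (when-* (raisable? p i) β _)))
      (trans (∑-distrib-+ (λ i → when (raisable? p i) (G (raise p i)))
                          (λ i → β * when (raisable? p i) (sumLowered c G (raise p i))))
      (cong (sumRaised G p +_) (sym (*-distribˡ-sum {M} β (λ i → when (raisable? p i) (sumLowered c G (raise p i)))))))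

    sum-when-const : ∀ {n} {P : Fin n → Set} (d : ∀ i → Dec (P i)) x →
      ∑[ i < n ] when (d i) x ≡ (∑[ i < n ] when (d i) 1) * x
    sum-when-const {n} d x = trans
      (sum-cong-≗ {n} λ i → trans (cong (when (d i)) (sym (ℕ.*-identityʳ x)))
        (trans (when-* (d i) x 1) (ℕ.*-comm x _)))
      (sym (*-distribʳ-sum x (λ i → when (d i) 1)))

    sum-exchange : ∀ c G p → Distinct p →
      sumRaised (sumLowered c G) p + (∑[ j < M ] when (lowerable? c p j) 1) * G p
      ≡ sumLowered c (sumRaised G) p + (∑[ i < M ] when (raisable? p i) (when (lookup p i ℕ.≟ c) 1)) * G p
    sum-exchange c G p d = begin
      sumRaised (sumLowered c G) p + (∑[ j < M ] when (lowerable? c p j) 1) * G p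
        ≡⟨ cong₂ _+_ (sum-cong-≗ {M} λ i → sum-when {M} (raisable? p i) (λ j → when (lowerable? c (raise p i) j) (G (lower (raise p i) j))))
                     (sym (trans (sum-diagonal (λ i j → when (lowerable? c p j) (G p)))
                                 (sum-when-const (lowerable? c p) (G p)))) ⟩
      (∑[ i < M ] ∑[ j < M ] a i j) + (∑[ i < M ] ∑[ j < M ] b i j)
        ≡⟨ sym (sum₂-+ a b) ⟩
      ∑[ i < M ] ∑[ j < M ] (a i j + b i j)
        ≡⟨ sum-cong-≗ {M} (λ i → sum-cong-≗ {M} (exchange c G p d i)) ⟩
      ∑[ i < M ] ∑[ j < M ] (a′ i j + b′ i j)
        ≡⟨ sum₂-+ a′ b′ ⟩
      (∑[ i < M ] ∑[ j < M ] a′ i j) + (∑[ i < M ] ∑[ j < M ] b′ i j)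
        ≡⟨ cong₂ _+_ (trans (∑-comm a′) (sum-cong-≗ {M} λ j → sym (sum-when {M} (lowerable? c p j) (λ i → when (raisable? (lower p j) i) (G (raise (lower p j) i))))))
                     (trans (sum-diagonal (λ i j → when (raisable? p i) (when (lookup p i ℕ.≟ c) (G p))))
                       (trans (sum-cong-≗ {M} λ i → when-× (raisable? p i) (lookup p i ℕ.≟ c))
                       (trans (sum-when-const (λ i → raisable? p i ×-dec (lookup p i ℕ.≟ c)) (G p))
                       (cong (_* G p) (sum-cong-≗ {M} λ i → sym (when-× (raisable? p i) (lookup p i ℕ.≟ c))))))) ⟩
      sumLowered c (sumRaised G) p + (∑[ i < M ] when (raisable? p i) (when (lookup p i ℕ.≟ c) 1)) * G p ∎
      where
      open ≡-Reasoning
      a b a′ b′ : Fin M → Fin M → ℕ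
      a i j  = when (raisable? p i) (when (lowerable? c (raise p i) j) (G (lower (raise p i) j)))
      b i j  = when (i Fin.≟ j) (when (lowerable? c p j) (G p))
      a′ i j = when (lowerable? c p j) (when (raisable? (lower p j) i) (G (raise (lower p j) i)))
      b′ i j = when (i Fin.≟ j) (when (raisable? p i) (when (lookup p i ℕ.≟ c) (G p)))
      sum₂-+ : ∀ (f g : Fin M → Fin M → ℕ) → ∑[ i < M ] ∑[ j < M ] (f i j + g i j)
               ≡ (∑[ i < M ] ∑[ j < M ] f i j) + (∑[ i < M ] ∑[ j < M ] g i j)
      sum₂-+ f g = trans (sum-cong-≗ {M} λ i → ∑-distrib-+ (f i) (g i)) (∑-distrib-+ (λ i → sum (f i)) (λ i → sum (g i)))

    -- sumRaised and the jump of hop commute up to the difference of the occupancies of c and c + 1,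
    -- and this difference is what exchanging the two values of y does to the weight.
    hop-eigen : ∀ {c β y y′ C G} → y′ (suc c) ≡ y′ c + β → y c ≡ y′ (suc c) → y (suc c) ≡ y′ c →
      (∀ a → a ≢ c → a ≢ suc c → y a ≡ y′ a) → Eigen y C G → Eigen y′ C (hop c β G)
    hop-eigen {c} {β} {y} {y′} {C} {G} hβ hc hc′ ho eigen p d = ℕ.+-cancelʳ-≡ _ _ _ (begin
      sumRaised (hop c β G) p + w′ * (g + β * r) + β * (nl + os) * g
        ≡⟨ cong (λ x → x + w′ * (g + β * r) + β * (nl + os) * g) (sumRaised-hop c β G p) ⟩
      A + β * rr + w′ * (g + β * r) + β * (nl + os) * g
        ≡⟨ e₁ A β rr w′ g r nl os ⟩
      A + β * (rr + nl * g) + w′ * (g + β * r) + β * os * g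
        ≡⟨ cong (λ x → A + β * x + w′ * (g + β * r) + β * os * g) (sum-exchange c G p d) ⟩
      A + β * (X + nu * g) + w′ * (g + β * r) + β * os * g
        ≡⟨ e₂ A β X nu w′ g r os ⟩
      A + β * (X + w′ * r) + w′ * g + β * (nu + os) * g
        ≡⟨ cong₂ (λ x y → A + β * x + w′ * g + β * y * g) lowered (jumps c p d) ⟩
      A + β * (C * r) + w′ * g + β * (nl + oc) * g
        ≡⟨ e₃ A β C r w′ g nl oc ⟩
      A + β * (C * r) + (w′ + β * oc) * g + β * nl * g
        ≡⟨ cong (λ x → A + β * (C * r) + x * g + β * nl * g) (sym (weight-swap hβ hc hc′ ho p)) ⟩
      A + β * (C * r) + (w + β * os) * g + β * nl * g
        ≡⟨ e₄ A β C r w g nl os ⟩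
      (A + w * g) + β * (C * r) + β * (nl + os) * g
        ≡⟨ cong (λ x → x + β * (C * r) + β * (nl + os) * g) (eigen p d) ⟩
      C * g + β * (C * r) + β * (nl + os) * g
        ≡⟨ e₅ C g β r nl os ⟩
      C * (g + β * r) + β * (nl + os) * g ∎)
      where
      open ≡-Reasoning
      g = G p ; r = sumLowered c G p ; A = sumRaised G p ; rr = sumRaised (sumLowered c G) p
      X = sumLowered c (sumRaised G) p
      w = weight y p ; w′ = weight y′ p ; os = occupancy (suc c) p ; oc = occupancy c p
      nl = ∑[ j < M ] when (lowerable? c p j) 1
      nu = ∑[ i < M ] when (raisable? p i) (when (lookup p i ℕ.≟ c) 1)
      e₁ : ∀ A β rr w′ g r nl os → A + β * rr + w′ * (g + β * r) + β * (nl + os) * g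
           ≡ A + β * (rr + nl * g) + w′ * (g + β * r) + β * os * g
      e₁ = solve-∀
      e₂ : ∀ A β X nu w′ g r os → A + β * (X + nu * g) + w′ * (g + β * r) + β * os * g
           ≡ A + β * (X + w′ * r) + w′ * g + β * (nu + os) * g
      e₂ = solve-∀
      e₃ : ∀ A β C r w′ g nl oc → A + β * (C * r) + w′ * g + β * (nl + oc) * g
           ≡ A + β * (C * r) + (w′ + β * oc) * g + β * nl * g
      e₃ = solve-∀
      e₄ : ∀ A β C r w g nl os → A + β * (C * r) + (w + β * os) * g + β * nl * g
           ≡ (A + w * g) + β * (C * r) + β * (nl + os) * g
      e₄ = solve-∀
      e₅ : ∀ C g β r nl os → C * g + β * (C * r) + β * (nl + os) * g ≡ C * (g + β * r) + β * (nl + os) * g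
      e₅ = solve-∀
      -- The equation for G is used at `lower p j`, whose weight under `y` is the weight of `p`
      -- under `y′`.
      lowered : X + w′ * r ≡ C * r
      lowered = begin
        X + w′ * r
          ≡⟨ cong (X +_) (*-distribˡ-sum w′ (λ j → when (lowerable? c p j) (G (lower p j)))) ⟩
        X + sum (λ j → w′ * when (lowerable? c p j) (G (lower p j)))
          ≡⟨ sym (∑-distrib-+ (λ j → when (lowerable? c p j) (sumRaised G (lower p j))) _) ⟩
        ∑[ j < M ] (when (lowerable? c p j) (sumRaised G (lower p j)) + w′ * when (lowerable? c p j) (G (lower p j)))
          ≡⟨ sum-cong-≗ {M} (λ j → trans
               (cong (when (lowerable? c p j) (sumRaised G (lower p j)) +_) (sym (when-* (lowerable? c p j) w′ _)))
               (trans (sym (when-+ (lowerable? c p j) _ _)) (trans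
                 (when-cong (lowerable? c p j) (lowerable? c p j) id id λ h →
                   trans (cong (λ x → sumRaised G (lower p j) + x * G (lower p j)) (sym (weight-lower hc ho p j d h)))
                         (eigen (lower p j) (lower-distinct p j h d)))
                 (when-* (lowerable? c p j) C _)))) ⟩
        ∑[ j < M ] (C * when (lowerable? c p j) (G (lower p j)))
          ≡⟨ sym (*-distribˡ-sum C (λ j → when (lowerable? c p j) (G (lower p j)))) ⟩
        C * r ∎

  -- Layers of exchanges and the hook lengths of a staircase

  swapAt : ℕ → (ℕ → ℕ) → ℕ → ℕ
  swapAt c y a with a ℕ.≟ c | a ℕ.≟ suc c
  ... | yes _ | _     = y (suc c)
  ... | no _  | yes _ = y c
  ... | no _  | no _  = y a

  swapAt-left : ∀ c y → swapAt c y c ≡ y (suc c)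
  swapAt-left c y with c ℕ.≟ c | c ℕ.≟ suc c
  ... | yes _ | _  = refl
  ... | no c≢c | _ = contradiction refl c≢c

  swapAt-right : ∀ c y → swapAt c y (suc c) ≡ y c
  swapAt-right c y with suc c ℕ.≟ c | suc c ℕ.≟ suc c
  ... | yes eq | _     = contradiction eq ℕ.1+n≢n
  ... | no _   | yes _ = refl
  ... | no _   | no n  = contradiction refl n

  swapAt-other : ∀ c y a → a ≢ c → a ≢ suc c → swapAt c y a ≡ y a
  swapAt-other c y a a≢c a≢sc with a ℕ.≟ c | a ℕ.≟ suc c
  ... | yes eq | _      = contradiction eq a≢c
  ... | no _   | yes eq = contradiction eq a≢sc
  ... | no _   | no _   = refl

  swapAt-below : ∀ c y {a} → a < c → swapAt c y a ≡ y a
  swapAt-below c y {a} a<c = swapAt-other c y a (ℕ.<⇒≢ a<c) (ℕ.<⇒≢ (ℕ.m<n⇒m<1+n a<c))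

  swapAt-above : ∀ c y {a} → suc c < a → swapAt c y a ≡ y a
  swapAt-above c y {a} c<a = swapAt-other c y a (ℕ.>⇒≢ (ℕ.<-trans (ℕ.n<1+n c) c<a)) (ℕ.>⇒≢ c<a)

  swaps : ℕ → ℕ → (ℕ → ℕ) → ℕ → ℕ
  swaps zero    c y = y
  swaps (suc n) c y = swaps n (2 + c) (swapAt c y)

  next-site : ∀ j c → 2 * suc j + c ≡ 2 * j + (2 + c)
  next-site = solve-∀

  above-pair : ∀ j c → suc c < 2 * j + (2 + c)
  above-pair j c = ℕ.m≤n+m (2 + c) (2 * j)

  swaps-below : ∀ n c y {a} → a < c → swaps n c y a ≡ y a
  swaps-below zero    c y a<c = refl
  swaps-below (suc n) c y a<c = trans (swaps-below n (2 + c) (swapAt c y) (ℕ.m<n⇒m<1+n (ℕ.m<n⇒m<1+n a<c)))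
                                      (swapAt-below c y a<c)

  swaps-left : ∀ n c y j → j < n → swaps n c y (2 * j + c) ≡ y (suc (2 * j + c))
  swaps-left (suc n) c y zero    _ = trans (swaps-below n (2 + c) (swapAt c y) (ℕ.m<n⇒m<1+n (ℕ.n<1+n c))) (swapAt-left c y)
  swaps-left (suc n) c y (suc j) (s≤s j<n) rewrite next-site j c =
    trans (swaps-left n (2 + c) (swapAt c y) j j<n) (swapAt-above c y (ℕ.m<n⇒m<1+n (above-pair j c)))

  swaps-right : ∀ n c y j → j < n → swaps n c y (suc (2 * j + c)) ≡ y (2 * j + c)
  swaps-right (suc n) c y zero    _ = trans (swaps-below n (2 + c) (swapAt c y) (ℕ.n<1+n (suc c))) (swapAt-right c y)
  swaps-right (suc n) c y (suc j) (s≤s j<n) rewrite next-site j c =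
    trans (swaps-right n (2 + c) (swapAt c y) j j<n) (swapAt-above c y (above-pair j c))

  StepsBy : ℕ → ℕ → ℕ → (ℕ → ℕ) → Set
  StepsBy n c β y = ∀ j → j < n → y (suc (2 * j + c)) ≡ y (2 * j + c) + β

  -- The values at the n site pairs used by an antidiagonal, after exchanging the values of the
  -- identity along the s outer antidiagonals.
  Spread : ℕ → ℕ → ℕ → (ℕ → ℕ) → Set
  Spread n c s y = ∀ j → j < n → (y (2 * j + c) + s ≡ 2 * j + c) × (y (suc (2 * j + c)) ≡ suc (2 * j + c) + s)

  -- The hook length of a staircase box lying s antidiagonals inside the outermost one.
  hook : ℕ → ℕ
  hook s = suc (2 * s)

  spread-steps : ∀ {n c s y} → Spread n c s y → StepsBy n c (hook s) y
  spread-steps {n} {c} {s} {y} h j j<n = begin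
    y (suc (2 * j + c))           ≡⟨ proj₂ (h j j<n) ⟩
    suc (2 * j + c) + s           ≡⟨ cong (λ a → suc a + s) (sym (proj₁ (h j j<n))) ⟩
    suc (y (2 * j + c) + s) + s   ≡⟨ e (y (2 * j + c)) s ⟩
    y (2 * j + c) + hook s        ∎
    where
    open ≡-Reasoning
    e : ∀ a s → suc (a + s) + s ≡ a + suc (2 * s)
    e = solve-∀

  -- The new pairs straddle the old ones: site 2j + c + 1 receives the lower value of pair j, and
  -- site 2j + c + 2 the upper value of pair j + 1.
  spread-swaps : ∀ {n c s y} → Spread (suc n) c s y → Spread n (suc c) (suc s) (swaps (suc n) c y)
  spread-swaps {n} {c} {s} {y} h j j<n rewrite ℕ.+-suc (2 * j) c =
      trans (cong (_+ suc s) (swaps-right (suc n) c y j (ℕ.m<n⇒m<1+n j<n)))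
        (trans (ℕ.+-suc _ s) (cong suc (proj₁ (h j (ℕ.m<n⇒m<1+n j<n)))))
    , trans (cong (swaps (suc n) c y) (sym (e j c)))
        (trans (swaps-left (suc n) c y (suc j) (s≤s j<n))
          (trans (proj₂ (h (suc j) (s≤s j<n))) (e′ j c s)))
    where
    e : ∀ j c → 2 * suc j + c ≡ suc (suc (2 * j + c))
    e = solve-∀
    e′ : ∀ j c s → suc (2 * suc j + c) + s ≡ suc (suc (2 * j + c)) + suc s
    e′ = solve-∀

  boxes : ℕ → ℕ
  boxes zero    = 0
  boxes (suc d) = suc d + boxes d

  -- The product of the hook lengths, taken in the staircase with d + s rows, over the boxes of the
  -- inner staircase with d rows.
  hookProduct : ℕ → ℕ → ℕ
  hookProduct zero    s = 1
  hookProduct (suc d) s = hook s ^ suc d * hookProduct d (suc s)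

  -- The sum over excited diagrams as an eigenfunction

  module _ {M : ℕ} where

    total : State M → ℕ
    total = weight id

    hops : ℕ → ℕ → ℕ → (State M → ℕ) → State M → ℕ
    hops zero    c β G = G
    hops (suc n) c β G = hop c β (hops n (2 + c) β G)

    hops-eigen : ∀ n c {β y C G} → StepsBy n c β y → Eigen (swaps n c y) C G → Eigen y C (hops n c β G)
    hops-eigen zero    c h eigen = eigen
    hops-eigen (suc n) c {β} {y} {C} {G} h eigen =
      hop-eigen {c = c} {y = swapAt c y} {C = C} {G = hops n (2 + c) β G} (h 0 (s≤s z≤n)) (swapAt-left c y) (swapAt-right c y) (swapAt-other c y)
        (hops-eigen n (2 + c) {C = C} {G = G} h′ eigen)
      where
      h′ : StepsBy n (2 + c) β (swapAt c y)
      h′ j j<n = trans (swapAt-above c y (ℕ.m<n⇒m<1+n (above-pair j c)))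
        (trans (subst (λ a → y (suc a) ≡ y a + β) (next-site j c) (h (suc j) (s≤s j<n)))
               (cong (_+ β) (sym (swapAt-above c y (above-pair j c)))))

    lookup-ext : ∀ {p q : State M} → (∀ i → lookup p i ≡ lookup q i) → p ≡ q
    lookup-ext {p} {q} h = trans (sym (Vec.tabulate∘lookup p)) (trans (Vec.tabulate-cong h) (Vec.tabulate∘lookup q))

    home : Fin M → ℕ
    home i = M ∸ suc (toℕ i)

    home-eq : ∀ i → home i + suc (toℕ i) ≡ M
    home-eq i = ℕ.m∸n+n≡m (Fin.toℕ<n i)

    home-mono-< : ∀ {i j} → toℕ i < toℕ j → home j < home i
    home-mono-< {i} {j} i<j = ℕ.∸-monoʳ-< (s≤s i<j) (Fin.toℕ<n j)

    staircase : ℕ → State M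
    staircase D = tabulate λ i → home i + (D ∸ toℕ i)

    lookup-staircase : ∀ D i → lookup (staircase D) i ≡ home i + (D ∸ toℕ i)
    lookup-staircase D i = Vec.lookup∘tabulate _ i

    lookup-empty : ∀ i → lookup (staircase 0) i ≡ home i
    lookup-empty i = trans (lookup-staircase 0 i) (trans (cong (home i +_) (ℕ.0∸n≡0 (toℕ i))) (ℕ.+-identityʳ _))

    decreasing⇒distinct : ∀ {p : State M} → (∀ {i j} → toℕ i < toℕ j → lookup p j < lookup p i) → Distinct p
    decreasing⇒distinct h i j eq with ℕ.<-cmp (toℕ i) (toℕ j)
    ... | tri< i<j _ _ = contradiction (sym eq) (ℕ.<⇒≢ (h i<j))
    ... | tri≈ _ i≡j _ = Fin.toℕ-injective i≡j
    ... | tri> _ _ j<i = contradiction eq (ℕ.<⇒≢ (h j<i))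

    staircase-decreasing : ∀ D {i j} → toℕ i < toℕ j → lookup (staircase D) j < lookup (staircase D) i
    staircase-decreasing D {i} {j} i<j = subst₂ _<_ (sym (lookup-staircase D j)) (sym (lookup-staircase D i))
      (ℕ.+-mono-<-≤ (home-mono-< i<j) (ℕ.∸-monoʳ-≤ D (ℕ.<⇒≤ i<j)))

    staircase-distinct : ∀ D → Distinct (staircase D)
    staircase-distinct D = decreasing⇒distinct {staircase D} (staircase-decreasing D)

    _≟ˢ_ : (p q : State M) → Dec (p ≡ q)
    _≟ˢ_ = Vec.≡-dec ℕ._≟_

    point : State M → State M → ℕ
    point q p = when (p ≟ˢ q) 1

    -- The sum over excited diagrams of a state inside the staircase with D rows, each weighted by the
    -- product of its hook lengths. These are constant along antidiagonals: each antidiagonal is one call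
    -- of hops, the outermost one starting at site c with hook length 2s + 1.
    excited : ℕ → ℕ → ℕ → State M → ℕ
    excited zero    c s = point (staircase 0)
    excited (suc d) c s = hops (suc d) c (hook s) (excited d (suc c) (suc s))

    below-home : ∀ i {c} → home i ≡ suc c → ∃[ j ] home j ≡ c × j ≢ i
    below-home i {c} eq = j , home-j , λ j≡i → ℕ.1+n≢n (trans (sym toℕ-j) (cong toℕ j≡i))
      where
      lt : suc (toℕ i) < M
      lt = subst (suc (suc (toℕ i)) ≤_) (trans (cong (_+ suc (toℕ i)) (sym eq)) (home-eq i)) (s≤s (ℕ.m≤n+m _ c))
      j = fromℕ< lt
      toℕ-j : toℕ j ≡ suc (toℕ i)
      toℕ-j = Fin.toℕ-fromℕ< lt
      home-j : home j ≡ c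
      home-j = ℕ.suc-injective (trans (ℕ.+-cancelʳ-≡ (suc (toℕ i)) _ _
        (trans (sym (ℕ.+-suc (home j) (suc (toℕ i)))) (trans (cong (λ a → home j + suc a) (sym toℕ-j))
          (trans (home-eq j) (sym (home-eq i)))))) eq)

    -- Before the move the particle would share the home site of the next row with the particle of
    -- that row.
    raise≢empty : ∀ p i → Distinct p → raise p i ≢ staircase 0
    raise≢empty p i d eq with below-home i {lookup p i}
        (trans (sym (lookup-empty i)) (trans (cong (λ q → lookup q i) (sym eq)) (lookup-raise p i)))
    ... | j , home-j , j≢i = j≢i (d j i (trans (sym (lookup-raise′ p j≢i))
        (trans (cong (λ q → lookup q j) eq) (trans (lookup-empty j) home-j))))

    -- No state can be raised to the empty one, and the indicator vanishes at every other state, so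
    -- any `y` is admissible.
    point-eigen : ∀ y → Eigen y (weight y (staircase 0)) (point (staircase 0))
    point-eigen y p d = trans (cong (_+ weight y p * point (staircase 0) p) (sum-zero _ λ i → trans
        (cong (when (raisable? p i)) (when-no (raise p i ≟ˢ staircase 0) (raise≢empty p i d))) (when-0 (raisable? p i))))
      (weights (p ≟ˢ staircase 0))
      where
      when-0 : ∀ {P : Set} (e : Dec P) → when e 0 ≡ 0
      when-0 (yes _) = refl
      when-0 (no _)  = refl
      weights : (e : Dec (p ≡ staircase 0)) → weight y p * when e 1 ≡ weight y (staircase 0) * when e 1
      weights (yes eq) = cong (λ q → weight y q * 1) eq
      weights (no _)   = trans (ℕ.*-zeroʳ (weight y p)) (sym (ℕ.*-zeroʳ (weight y (staircase 0))))

    -- The eigenvalue is a weight of the fully permuted `y`; it stays existential and is identified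
    -- later at the full staircase.
    excited-eigen : ∀ D c s y → Spread D c s y → ∃[ C ] Eigen y C (excited D c s)
    excited-eigen zero    c s y h = weight y (staircase 0) , point-eigen y
    excited-eigen (suc d) c s y h with excited-eigen d (suc c) (suc s) (swaps (suc d) c y) (spread-swaps {y = y} h)
    ... | C , eigen = C , hops-eigen (suc d) c {y = y} {C = C} {G = excited d (suc c) (suc s)} (spread-steps {y = y} h) eigen

    sum-nonzero : ∀ {n} (f : Fin n → ℕ) → sum f ≢ 0 → ∃[ i ] f i ≢ 0
    sum-nonzero f s≢0 with Fin.any? (λ i → ¬? (f i ℕ.≟ 0))
    ... | yes r = r
    ... | no ¬r = contradiction (sum-zero f λ i → zero? i) s≢0
      where
      zero? : ∀ i → f i ≡ 0
      zero? i with f i ℕ.≟ 0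
      ... | yes eq = eq
      ... | no ne = contradiction (i , ne) ¬r

    hop-nonzero : ∀ c β (G : State M → ℕ) p → hop c β G p ≢ 0 → (G p ≢ 0) ⊎ (∃[ j ] Lowerable c p j × G (lower p j) ≢ 0)
    hop-nonzero c β G p h with G p ℕ.≟ 0
    ... | no G≢0 = inj₁ G≢0
    ... | yes G≡0 with sum-nonzero (λ j → when (lowerable? c p j) (G (lower p j)))
                         (λ s≡0 → h (cong₂ _+_ G≡0 (trans (cong (β *_) s≡0) (ℕ.*-zeroʳ β))))
    ... | j , f≢0 with lowerable? c p j
    ... | yes l = inj₂ (j , l , f≢0)
    ... | no _  = contradiction refl f≢0

    Inside : ℕ → State M → Set
    Inside D p = ∀ i → lookup p i ≤ lookup (staircase D) i

    -- By parity: the nonempty rows of the staircase end at the sites c + 1, c + 3, ..., and the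
    -- empty rows rest below c. Hence a particle on 2j + c that is inside the staircase may move one
    -- step to the right and remain inside.
    no-edge : ∀ D c j i → c + D ≡ M → 2 * j + c ≢ home i + (D ∸ toℕ i)
    no-edge D c j i c+D≡M eq with ℕ.≤-total (toℕ i) D
    ... | inj₁ i≤D = ℕ.even≢odd D (j + toℕ i) (sym (ℕ.+-cancelʳ-≡ c _ _ (begin
        suc (2 * (j + toℕ i)) + c                       ≡⟨ e₁ j (toℕ i) c ⟩
        suc (2 * j + c + (toℕ i + toℕ i))               ≡⟨ cong (λ a → suc (a + (toℕ i + toℕ i))) eq ⟩
        suc (home i + (D ∸ toℕ i) + (toℕ i + toℕ i))    ≡⟨ e₂ (home i) (D ∸ toℕ i) (toℕ i) ⟩
        (home i + suc (toℕ i)) + (D ∸ toℕ i + toℕ i)    ≡⟨ cong₂ _+_ (trans (home-eq i) (sym c+D≡M)) (ℕ.m∸n+n≡m i≤D) ⟩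
        (c + D) + D                                     ≡⟨ e₃ c D ⟩
        2 * D + c                                       ∎)))
      where
      open ≡-Reasoning
      e₁ : ∀ j i c → suc (2 * (j + i)) + c ≡ suc (2 * j + c + (i + i))
      e₁ = solve-∀
      e₂ : ∀ h x i → suc (h + x + (i + i)) ≡ (h + suc i) + (x + i)
      e₂ = solve-∀
      e₃ : ∀ c D → (c + D) + D ≡ 2 * D + c
      e₃ = solve-∀
    ... | inj₂ D≤i = ℕ.<-irrefl refl (begin-strict
        M                         ≡⟨ sym c+D≡M ⟩
        c + D                     ≤⟨ ℕ.+-mono-≤ (ℕ.m≤n+m c (2 * j)) D≤i ⟩
        2 * j + c + toℕ i         <⟨ ℕ.n<1+n _ ⟩
        suc (2 * j + c + toℕ i)   ≡⟨ sym (ℕ.+-suc (2 * j + c) (toℕ i)) ⟩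
        2 * j + c + suc (toℕ i)   ≡⟨ cong (_+ suc (toℕ i)) (trans eq (trans (cong (home i +_) (ℕ.m≤n⇒m∸n≡0 D≤i)) (ℕ.+-identityʳ _))) ⟩
        home i + suc (toℕ i)      ≡⟨ home-eq i ⟩
        M                         ∎)
      where open ℕ.≤-Reasoning

    hops-inside : ∀ D c → c + D ≡ M → ∀ n j β (G : State M → ℕ) → (∀ p → G p ≢ 0 → Inside D p) →
                  ∀ p → hops n (2 * j + c) β G p ≢ 0 → Inside D p
    hops-inside D c eq zero    j β G h = h
    hops-inside D c eq (suc n) j β G h p ne with hop-nonzero (2 * j + c) β (hops n (2 + (2 * j + c)) β G) p ne
    ... | inj₁ G≢0 = rest
      where
      rest : Inside D p
      rest = hops-inside D c eq n (suc j) β G h p (subst (λ a → hops n a β G p ≢ 0) (e j c) G≢0)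
        where
        e : ∀ j c → 2 + (2 * j + c) ≡ 2 * suc j + c
        e = solve-∀
    ... | inj₂ (l , low , G≢0) = inside
      where
      rest : Inside D (lower p l)
      rest = hops-inside D c eq n (suc j) β G h (lower p l) (subst (λ a → hops n a β G (lower p l) ≢ 0) (e j c) G≢0)
        where
        e : ∀ j c → 2 + (2 * j + c) ≡ 2 * suc j + c
        e = solve-∀
      inside : Inside D p
      inside i with i Fin.≟ l
      ... | no i≢l = subst (_≤ lookup (staircase D) i) (lookup-lower′ p i≢l) (rest i)
      ... | yes refl = subst (_≤ lookup (staircase D) i) (sym (proj₁ low)) (ℕ.≤∧≢⇒< (subst (_≤ lookup (staircase D) i) (lookup-lowered p i low) (rest i))
          (λ eq′ → no-edge D c j i eq (trans eq′ (lookup-staircase D i))))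

    excited-inside : ∀ D c s → c + D ≡ M → ∀ p → excited D c s p ≢ 0 → Inside D p
    excited-inside zero c s eq p ne i with p ≟ˢ staircase 0
    ... | yes refl = ℕ.≤-refl
    ... | no _ = contradiction refl ne
    excited-inside (suc d) c s eq = hops-inside (suc d) c eq (suc d) 0 (hook s) (excited d (suc c) (suc s))
      λ p ne i → ℕ.≤-trans (excited-inside d (suc c) (suc s) (trans (sym (ℕ.+-suc c d)) eq) p ne i)
        (subst₂ _≤_ (sym (lookup-staircase d i)) (sym (lookup-staircase (suc d) i))
          (ℕ.+-monoʳ-≤ (home i) (ℕ.∸-monoˡ-≤ (toℕ i) (ℕ.n≤1+n d))))

  -- Degree bounds, chains of partitions and the hook formulas

  sum-mono : ∀ {n} {f g : Fin n → ℕ} → (∀ i → f i ≤ g i) → sum f ≤ sum g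
  sum-mono {zero}  h = z≤n
  sum-mono {suc n} h = ℕ.+-mono-≤ (h zero) (sum-mono (h ∘ suc))

  term≤sum : ∀ {n} (f : Fin n → ℕ) i → f i ≤ sum f
  term≤sum f zero    = ℕ.m≤m+n _ _
  term≤sum f (suc i) = ℕ.≤-trans (term≤sum (f ∘ suc) i) (ℕ.m≤n+m _ (f zero))

  sum-tight : ∀ {n} {f g : Fin n → ℕ} → (∀ i → f i ≤ g i) → sum f ≡ sum g → ∀ i → f i ≡ g i
  sum-tight {suc n} {f} {g} h eq i with f zero ℕ.≟ g zero
  ... | no ne = contradiction eq (ℕ.<⇒≢ (ℕ.+-mono-<-≤ (ℕ.≤∧≢⇒< (h zero) ne) (sum-mono (h ∘ suc))))
  sum-tight {suc n} h eq zero    | yes e = e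
  sum-tight {suc n} {f} {g} h eq (suc i) | yes e =
    sum-tight (h ∘ suc) (ℕ.+-cancelˡ-≡ (g zero) _ _ (trans (cong (_+ sum (f ∘ suc)) (sym e)) eq)) i

  module _ {M : ℕ} where

    total-raise : ∀ (p : State M) i → total (raise p i) ≡ suc (total p)
    total-raise p i = begin
      total (raise p i)
        ≡⟨ sum-cong-≗ {M} (λ j → pointwise j (j Fin.≟ i)) ⟩
      ∑[ j < M ] (lookup p j + when (j Fin.≟ i) 1)
        ≡⟨ ∑-distrib-+ (lookup p) (λ j → when (j Fin.≟ i) 1) ⟩
      total p + ∑[ j < M ] when (j Fin.≟ i) 1
        ≡⟨ cong (total p +_) (trans (sum-single (λ j → when (j Fin.≟ i) 1) i (λ j → when-no (j Fin.≟ i)))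
                                    (when-yes (i Fin.≟ i) refl)) ⟩
      total p + 1
        ≡⟨ ℕ.+-comm (total p) 1 ⟩
      suc (total p) ∎
      where
      open ≡-Reasoning
      pointwise : ∀ j (d : Dec (j ≡ i)) → lookup (raise p i) j ≡ lookup p j + when d 1
      pointwise j (yes refl) = trans (lookup-raise p j) (ℕ.+-comm 1 _)
      pointwise j (no j≢i)   = trans (lookup-raise′ p j≢i) (sym (ℕ.+-identityʳ _))

    total-lower : ∀ (p : State M) {c} j → Lowerable c p j → suc (total (lower p j)) ≡ total p
    total-lower p j h = trans (sym (total-raise (lower p j) j)) (cong total (raise-lower p j (proj₁ h)))

    -- G vanishes on states with more than N boxes (up to a shift) and is at most w on those with N:
    -- a coefficient of top degree uses every factor of the operator product.
    Graded : ℕ → ℕ → (State M → ℕ) → Set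
    Graded N w G = ∀ p → Distinct p → (N < total p → G p ≡ 0) × (total p ≡ N → G p ≤ w)

    hop-graded : ∀ {N w} c β {G} → Graded N w G → Graded (suc N) (β * w) (hop c β G)
    hop-graded {N} {w} c β {G} g p d = above , at
      where
      above : suc N < total p → hop c β G p ≡ 0
      above lt = cong₂ _+_ (proj₁ (g p d) (ℕ.<-trans (ℕ.n<1+n N) lt))
        (trans (cong (β *_) (sum-zero {M} _ λ j → vanish j (lowerable? c p j))) (ℕ.*-zeroʳ β))
        where
        vanish : ∀ j (l : Dec (Lowerable c p j)) → when l (G (lower p j)) ≡ 0
        vanish j (yes l) = proj₁ (g (lower p j) (lower-distinct p j l d))
          (s≤s⁻¹ (subst (suc N <_) (sym (total-lower p j l)) lt))
        vanish j (no _)  = refl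
      -- At most one particle stands on c + 1, so the sum has at most one nonzero term.
      lowered : total p ≡ suc N → sumLowered c G p ≤ w
      lowered eq with Fin.any? (lowerable? c p)
      ... | no ¬l = subst (_≤ w) (sym (sum-zero {M} _ λ j → when-no (lowerable? c p j) λ l → ¬l (j , l))) z≤n
      ... | yes (j , l) = subst (_≤ w)
        (sym (trans (sum-single {M} (λ j′ → when (lowerable? c p j′) (G (lower p j′))) j
                      λ j′ j′≢j → when-no (lowerable? c p j′) λ l′ → j′≢j (d j′ j (trans (proj₁ l′) (sym (proj₁ l)))))
                    (when-yes (lowerable? c p j) l)))
        (proj₂ (g (lower p j) (lower-distinct p j l d)) (ℕ.suc-injective (trans (total-lower p j l) eq)))
      at : total p ≡ suc N → hop c β G p ≤ β * w
      at eq = subst (λ x → x + β * sumLowered c G p ≤ β * w)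
        (sym (proj₁ (g p d) (ℕ.≤-reflexive (sym eq)))) (ℕ.*-monoʳ-≤ β (lowered eq))

    hops-graded : ∀ n {N w} c β {G} → Graded N w G → Graded (n + N) (β ^ n * w) (hops n c β G)
    hops-graded zero    {w = w} c β {G} g = subst (λ x → Graded _ x G) (sym (ℕ.+-identityʳ w)) g
    hops-graded (suc n) {N} {w} c β {G} g = subst (λ x → Graded (suc n + N) x (hops (suc n) c β G))
      (sym (ℕ.*-assoc β (β ^ n) w)) (hop-graded c β {hops n (2 + c) β G} (hops-graded n (2 + c) β {G} g))

    excited-graded : ∀ D c s → Graded (boxes D + total {M} (staircase 0)) (hookProduct D s) (excited {M} D c s)
    excited-graded zero c s p d = (λ lt → when-no (p ≟ˢ staircase 0) λ eq → ℕ.<⇒≢ lt (cong (total {M}) (sym eq)))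
                                , λ _ → bounded (p ≟ˢ staircase 0)
      where
      bounded : ∀ {P : Set} (e : Dec P) → when e 1 ≤ 1
      bounded (yes _) = ℕ.≤-refl
      bounded (no _)  = z≤n
    excited-graded (suc d) c s = subst (λ N → Graded N (hookProduct (suc d) s) (excited {M} (suc d) c s))
      (sym (ℕ.+-assoc (suc d) (boxes d) (total {M} (staircase 0))))
      (hops-graded (suc d) c (hook s) {excited {M} d (suc c) (suc s)} (excited-graded d (suc c) (suc s)))

    -- The staircase with d rows and the top n boxes of the next antidiagonal.
    partial : ℕ → ℕ → State M
    partial d n = tabulate λ i → home i + (when (toℕ i ℕ.<? n) 1 + d ∸ toℕ i)

    lookup-partial : ∀ d n i → lookup (partial d n) i ≡ home i + (when (toℕ i ℕ.<? n) 1 + d ∸ toℕ i)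
    lookup-partial d n i = Vec.lookup∘tabulate _ i

    partial-zero : ∀ d → partial d 0 ≡ staircase d
    partial-zero d = lookup-ext λ i → trans (lookup-partial d 0 i)
      (trans (cong (λ x → home i + (x + d ∸ toℕ i)) (when-no (toℕ i ℕ.<? 0) {1} ℕ.n≮0)) (sym (lookup-staircase d i)))

    partial-full : ∀ d → partial d (suc d) ≡ staircase (suc d)
    partial-full d = lookup-ext λ i → trans (lookup-partial d (suc d) i)
      (trans (cong (home i +_) (at-row i (toℕ i ℕ.<? suc d))) (sym (lookup-staircase (suc d) i)))
      where
      at-row : ∀ i (e : Dec (toℕ i < suc d)) → when e 1 + d ∸ toℕ i ≡ suc d ∸ toℕ i
      at-row i (yes _) = refl
      at-row i (no ≮)  = trans (ℕ.m≤n⇒m∸n≡0 (ℕ.<⇒≤ (ℕ.≮⇒≥ ≮))) (sym (ℕ.m≤n⇒m∸n≡0 (ℕ.≮⇒≥ ≮)))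

    partial-suc : ∀ d n (i : Fin M) → toℕ i ≡ n → n ≤ d → partial d (suc n) ≡ raise (partial d n) i
    partial-suc d n i refl n≤d = lookup-ext λ j → at-row j (j Fin.≟ i)
      where
      at-row : ∀ j → Dec (j ≡ i) → lookup (partial d (suc n)) j ≡ lookup (raise (partial d n) i) j
      at-row j (yes refl) = trans (lookup-partial d (suc n) i) (trans
        (cong (λ x → home i + (x + d ∸ toℕ i)) (when-yes (toℕ i ℕ.<? suc n) (ℕ.n<1+n n)))
        (trans (trans (cong (home i +_) (ℕ.+-∸-assoc 1 n≤d)) (ℕ.+-suc (home i) (d ∸ toℕ i)))
        (sym (trans (lookup-raise (partial d n) i) (cong suc (trans (lookup-partial d n i)
          (cong (λ x → home i + (x + d ∸ toℕ i)) (when-no (toℕ i ℕ.<? n) (ℕ.<-irrefl refl)))))))))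
      at-row j (no j≢i) = trans (lookup-partial d (suc n) j) (trans
        (cong (λ x → home j + (x + d ∸ toℕ j)) (when-cong (toℕ j ℕ.<? suc n) (toℕ j ℕ.<? n)
          (λ lt → ℕ.≤∧≢⇒< (s≤s⁻¹ lt) (j≢i ∘ Fin.toℕ-injective)) ℕ.m<n⇒m<1+n (λ _ → refl)))
        (sym (trans (lookup-raise′ (partial d n) j≢i) (lookup-partial d n j))))

    partial-decreasing : ∀ d n {i j} → toℕ i < toℕ j → lookup (partial d n) j < lookup (partial d n) i
    partial-decreasing d n {i} {j} i<j = subst₂ _<_ (sym (lookup-partial d n j)) (sym (lookup-partial d n i))
      (ℕ.+-mono-<-≤ (home-mono-< i<j) (ℕ.∸-mono (ℕ.+-monoˡ-≤ d (bound (toℕ j ℕ.<? n) (toℕ i ℕ.<? n))) (ℕ.<⇒≤ i<j)))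
      where
      bound : (e : Dec (toℕ j < n)) (e′ : Dec (toℕ i < n)) → when e 1 ≤ when e′ 1
      bound (yes _)   (yes _) = ℕ.≤-refl
      bound (yes j<n) (no ≮)  = contradiction (ℕ.<-trans i<j j<n) ≮
      bound (no _)    _       = z≤n

    total-partial : ∀ d n → n ≤ suc d → suc d ≤ M → total (partial d n) ≡ n + total {M} (staircase d)
    total-partial d zero    _   _   = cong total (partial-zero d)
    total-partial d (suc n) n≤d d<M = begin
      total (partial d (suc n))     ≡⟨ cong total (partial-suc d n i (Fin.toℕ-fromℕ< n<M) (s≤s⁻¹ n≤d)) ⟩
      total (raise (partial d n) i) ≡⟨ total-raise (partial d n) i ⟩
      suc (total (partial d n))     ≡⟨ cong suc (total-partial d n (ℕ.<⇒≤ n≤d) d<M) ⟩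
      suc n + total {M} (staircase d)   ∎
      where
      open ≡-Reasoning
      n<M = ℕ.≤-trans n≤d d<M
      i = fromℕ< n<M

    total-staircase : ∀ D → D ≤ M → total {M} (staircase D) ≡ boxes D + total {M} (staircase 0)
    total-staircase zero    _   = refl
    total-staircase (suc d) d<M = trans (cong total (sym (partial-full d))) (trans (total-partial d (suc d) ℕ.≤-refl d<M)
      (trans (cong (suc d +_) (total-staircase d (ℕ.<⇒≤ d<M))) (sym (ℕ.+-assoc (suc d) (boxes d) _))))

    hop-≥ : ∀ c β (G : State M → ℕ) p j → Lowerable c p j → β * G (lower p j) ≤ hop c β G p
    hop-≥ c β G p j l = ℕ.≤-trans (ℕ.*-monoʳ-≤ β (subst (_≤ sumLowered c G p) (when-yes (lowerable? c p j) l)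
      (term≤sum (λ j → when (lowerable? c p j) (G (lower p j))) j))) (ℕ.m≤n+m _ (G p))

    -- The last n hops of the layer add the top n boxes of the antidiagonal. The first of these
    -- hops, at the smallest site `a`, accounts for the lowest of these boxes; only that term is
    -- kept.
    hops-≥ : ∀ d n c a β (G : State M → ℕ) {w} → c + suc d ≡ M → a + 2 * n ≡ c + 2 * suc d → n ≤ suc d →
             w ≤ G (staircase d) → β ^ n * w ≤ hops n a β G (partial d n)
    hops-≥ d zero    c a β G {w} eq _  _   w≤G = subst₂ _≤_ (sym (ℕ.+-identityʳ w)) (cong G (sym (partial-zero d))) w≤G
    hops-≥ d (suc n) c a β G {w} eq ea n≤d w≤G = begin
      β * β ^ n * w                           ≡⟨ ℕ.*-assoc β (β ^ n) w ⟩
      β * (β ^ n * w)                         ≤⟨ ℕ.*-monoʳ-≤ β (hops-≥ d n c (2 + a) β G eq (trans (e a n) ea) (ℕ.<⇒≤ n≤d) w≤G) ⟩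
      β * hops n (2 + a) β G (partial d n)    ≡⟨ cong (λ q → β * hops n (2 + a) β G q) (sym lowered) ⟩
      β * hops n (2 + a) β G (lower p i)      ≤⟨ hop-≥ a β (hops n (2 + a) β G) p i (top , free) ⟩
      hops (suc n) a β G p                    ∎
      where
      open ℕ.≤-Reasoning
      e : ∀ a n → 2 + a + 2 * n ≡ a + 2 * suc n
      e = solve-∀
      p = partial d (suc n)
      n<M = ℕ.≤-trans n≤d (subst (suc d ≤_) eq (ℕ.m≤n+m (suc d) c))
      i = fromℕ< n<M
      toℕ-i : toℕ i ≡ n
      toℕ-i = Fin.toℕ-fromℕ< n<M
      raised : p ≡ raise (partial d n) i
      raised = partial-suc d n i toℕ-i (s≤s⁻¹ n≤d)
      lowered : lower p i ≡ partial d n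
      lowered = trans (cong (λ q → lower q i) raised) (lower-raise (partial d n) i)
      below : lookup (partial d n) i ≡ a
      below = trans (lookup-partial d n i) (trans
        (cong₂ (λ x y → home i + (x + d ∸ y)) (when-no (toℕ i ℕ.<? n) (ℕ.<-irrefl toℕ-i)) toℕ-i) site)
        where
        site : home i + (d ∸ n) ≡ a
        site = ℕ.+-cancelʳ-≡ (2 * suc n) _ _ (trans (e₁ (home i) (d ∸ n) n) (trans
          (cong₂ _+_ (trans (cong (λ x → home i + suc x) (sym toℕ-i)) (trans (home-eq i) (sym eq)))
                     (cong suc (ℕ.m∸n+n≡m (s≤s⁻¹ n≤d)))) (trans (e₂ c d) (sym ea))))
          where
          e₁ : ∀ h x n → h + x + 2 * suc n ≡ (h + suc n) + suc (x + n)
          e₁ = solve-∀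
          e₂ : ∀ c d → c + suc d + suc d ≡ c + 2 * suc d
          e₂ = solve-∀
      top : lookup p i ≡ suc a
      top = trans (cong (λ q → lookup q i) raised) (trans (lookup-raise (partial d n) i) (cong suc below))
      free : Free a p
      free j eq′ with ℕ.<-cmp (toℕ i) (toℕ j)
      ... | tri< i<j _ _ = ℕ.<-irrefl (trans (sym (lookup-raise′ (partial d n) {i} {j} (λ j≡i → ℕ.<⇒≢ i<j (cong toℕ (sym j≡i)))))
                             (trans (cong (λ q → lookup q j) (sym raised)) (trans eq′ (sym below)))) (partial-decreasing d n i<j)
      ... | tri≈ _ i≡j _ = ℕ.1+n≢n (trans (sym top) (trans (cong (lookup p) (Fin.toℕ-injective i≡j)) eq′))
      ... | tri> _ _ j<i = ℕ.<-asym (subst₂ _<_ top eq′ (partial-decreasing d (suc n) j<i)) (ℕ.n<1+n a)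

    excited-≥ : ∀ D c s → c + D ≡ M → hookProduct D s ≤ excited {M} D c s (staircase D)
    excited-≥ zero    c s eq = ℕ.≤-reflexive (sym (when-yes (staircase 0 ≟ˢ staircase 0) refl))
    excited-≥ (suc d) c s eq = subst (λ q → hookProduct (suc d) s ≤ excited {M} (suc d) c s q) (partial-full d)
      (hops-≥ d (suc d) c c (hook s) (excited {M} d (suc c) (suc s)) eq refl ℕ.≤-refl
        (excited-≥ d (suc c) (suc s) (trans (sym (ℕ.+-suc c d)) eq)))

    hops-mono : ∀ n c β (G : State M → ℕ) p → G p ≤ hops n c β G p
    hops-mono zero    c β G p = ℕ.≤-refl
    hops-mono (suc n) c β G p = ℕ.≤-trans (hops-mono n (2 + c) β G p) (ℕ.m≤m+n _ _)

    -- Keeping the summand 1 of every factor in the j outer layers leaves the excited diagrams that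
    -- use only the inner layers. Evaluated at the inner staircase, this is how E = μ is singled
    -- out.
    excited-mono : ∀ j D c s (p : State M) → excited {M} D (j + c) (j + s) p ≤ excited {M} (j + D) c s p
    excited-mono zero    D c s p = ℕ.≤-refl
    excited-mono (suc j) D c s p = ℕ.≤-trans
      (subst₂ (λ x y → excited {M} D x y p ≤ excited {M} (j + D) (suc c) (suc s) p) (ℕ.+-suc j c) (ℕ.+-suc j s)
        (excited-mono j D (suc c) (suc s) p))
      (hops-mono (suc (j + D)) c (hook s) (excited {M} (j + D) (suc c) (suc s)) p)

    hops-empty : ∀ n c β (G : State M → ℕ) → hops n c β G (staircase 0) ≡ G (staircase 0)
    hops-empty zero    c β G = refl
    hops-empty (suc n) c β G = trans (cong₂ _+_ (hops-empty n (2 + c) β G)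
      (trans (cong (β *_) (sum-zero {M} _ λ j → when-no (lowerable? c (staircase 0) j) λ (eq , free) →
        let l , home-l , _ = below-home j (trans (sym (lookup-empty j)) eq)
        in free l (trans (lookup-empty l) home-l))) (ℕ.*-zeroʳ β))) (ℕ.+-identityʳ _)

    excited-empty : ∀ D c s → excited {M} D c s (staircase 0) ≡ 1
    excited-empty zero    c s = when-yes (staircase 0 ≟ˢ staircase 0) refl
    excited-empty (suc d) c s = trans (hops-empty (suc d) c (hook s) (excited {M} d (suc c) (suc s)))
      (excited-empty d (suc c) (suc s))

    paths# : ℕ → State M → State M → ℕ
    paths# zero    q = point q
    paths# (suc n) q = sumRaised (paths# n q)

    paths#-concat : ∀ m n p q r → paths# m q p * paths# n r q ≤ paths# (m + n) r p
    paths#-concat zero n p q r with p ≟ˢ q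
    ... | yes refl = ℕ.≤-reflexive (ℕ.+-identityʳ _)
    ... | no _     = z≤n
    paths#-concat (suc m) n p q r = subst (_≤ paths# (suc m + n) r p)
      (sym (*-distribʳ-sum {M} (paths# n r q) (λ i → when (raisable? p i) (paths# m q (raise p i)))))
      (sum-mono λ i → step (raisable? p i) i)
      where
      step : ∀ {P : Set} (d : Dec P) i →
             when d (paths# m q (raise p i)) * paths# n r q ≤ when d (paths# (m + n) r (raise p i))
      step (yes _) i = paths#-concat m n (raise p i) q r
      step (no _)  i = z≤n

    hookProduct-pos : ∀ D s → 0 < hookProduct D s
    hookProduct-pos zero    s = s≤s z≤n
    hookProduct-pos (suc d) s = ℕ.*-mono-≤ (ℕ.m^n>0 (hook s) (suc d)) (hookProduct-pos d (suc s))

    module _ (D c : ℕ) (c+D≡M : c + D ≡ M) where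
      private
        G : State M → ℕ
        G = excited {M} D c 0
        q : State M
        q = staircase D
        D≤M = subst (D ≤_) c+D≡M (ℕ.m≤n+m D c)
        grade : ∀ {p} → Distinct p → total q < total p → G p ≡ 0
        grade {p} d lt = proj₁ (excited-graded D c 0 p d) (subst (_< total p) (total-staircase D D≤M) lt)

      excited-≤ : G q ≤ hookProduct D 0
      excited-≤ = proj₂ (excited-graded D c 0 q (staircase-distinct D)) (total-staircase D D≤M)

      -- The eigenvalue is found at `q`: each raise of `q` exceeds the degree of G, so the sum
      -- vanishes there, and the nonzero G q cancels.
      excited-recurrence : ∀ p → Distinct p → sumRaised G p + total p * G p ≡ total q * G p
      excited-recurrence p d with excited-eigen D c 0 id (λ j _ → ℕ.+-identityʳ _ , sym (ℕ.+-identityʳ _))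
      ... | C , eigen = trans (eigen p d) (cong (_* G p) (sym C≡))
        where
        top : sumRaised G q ≡ 0
        top = sum-zero {M} _ λ i → vanish i (raisable? q i)
          where
          vanish : ∀ i (e : Dec (Free (suc (lookup q i)) q)) → when e (G (raise q i)) ≡ 0
          vanish i (yes f) = grade (raise-distinct q i (staircase-distinct D) f)
            (subst (total q <_) (sym (total-raise q i)) (ℕ.n<1+n _))
          vanish i (no _)  = refl
        instance
          G≢0 : NonZero (G q)
          G≢0 = >-nonZero (ℕ.≤-trans (hookProduct-pos D 0) (excited-≥ D c 0 c+D≡M))
        C≡ : total q ≡ C
        C≡ = ℕ.*-cancelʳ-≡ (total q) C (G q)
          (trans (cong (_+ total q * G q) (sym top)) (eigen q (staircase-distinct D)))

      -- Naruse's formula, with G q in place of the product of all hook lengths. Both sides obey the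
      -- same recurrence in n. For n = 0, a state with as many boxes as `q` and nonzero G lies
      -- inside `q`, hence equals `q`.
      paths#-excited : ∀ n p → Distinct p → n + total p ≡ total q → paths# n q p * G q ≡ n ! * G p
      paths#-excited zero p d eq with p ≟ˢ q
      ... | yes refl = refl
      ... | no p≢q = sym (trans (ℕ.+-identityʳ (G p)) G≡0)
        where
        G≡0 : G p ≡ 0
        G≡0 with G p ℕ.≟ 0
        ... | yes e = e
        ... | no ne = contradiction (lookup-ext (sum-tight (excited-inside D c 0 c+D≡M p ne) eq)) p≢q
      paths#-excited (suc n) p d eq = begin
        sumRaised (paths# n q) p * G q
          ≡⟨ *-distribʳ-sum {M} (G q) (λ i → when (raisable? p i) (paths# n q (raise p i))) ⟩
        ∑[ i < M ] (when (raisable? p i) (paths# n q (raise p i)) * G q)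
          ≡⟨ sum-cong-≗ {M} (λ i → step i (raisable? p i)) ⟩
        ∑[ i < M ] (n ! * when (raisable? p i) (G (raise p i)))
          ≡⟨ sym (*-distribˡ-sum {M} (n !) (λ i → when (raisable? p i) (G (raise p i)))) ⟩
        n ! * sumRaised G p
          ≡⟨ cong (n ! *_) (ℕ.+-cancelʳ-≡ (total p * G p) _ _ (trans (excited-recurrence p d)
               (trans (cong (_* G p) (sym eq)) (ℕ.*-distribʳ-+ (G p) (suc n) (total p))))) ⟩
        n ! * (suc n * G p)
          ≡⟨ e (n !) (suc n) (G p) ⟩
        suc n ! * G p ∎
        where
        open ≡-Reasoning
        e : ∀ a b c → a * (b * c) ≡ b * a * c
        e = solve-∀
        step : ∀ i (r : Dec (Free (suc (lookup p i)) p)) →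
               when r (paths# n q (raise p i)) * G q ≡ n ! * when r (G (raise p i))
        step i (yes f) = paths#-excited n (raise p i) (raise-distinct p i d f)
          (trans (cong (n +_) (total-raise p i)) (trans (ℕ.+-suc n (total p)) eq))
        step i (no _)  = sym (ℕ.*-zeroʳ (n !))

    -- This and the next bound are the two halves of the hook length formula, as G is 1 at the empty
    -- partition.
    paths#-from-empty-≥ : ∀ D c → c + D ≡ M →
      boxes D ! ≤ paths# (boxes D) (staircase D) (staircase 0) * hookProduct D 0
    paths#-from-empty-≥ D c eq = begin
      boxes D !                                     ≡⟨ sym (ℕ.*-identityʳ _) ⟩
      boxes D ! * 1                                 ≡⟨ cong (boxes D ! *_) (sym (excited-empty D c 0)) ⟩
      boxes D ! * excited {M} D c 0 (staircase 0)       ≡⟨ sym (paths#-excited D c eq (boxes D) (staircase 0) (staircase-distinct 0)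
                                                         (sym (total-staircase D (subst (D ≤_) eq (ℕ.m≤n+m D c))))) ⟩
      paths# (boxes D) (staircase D) (staircase 0) * excited {M} D c 0 (staircase D)
                                                    ≤⟨ ℕ.*-monoʳ-≤ (paths# (boxes D) (staircase D) (staircase 0)) (excited-≤ D c eq) ⟩
      paths# (boxes D) (staircase D) (staircase 0) * hookProduct D 0 ∎
      where open ℕ.≤-Reasoning

    paths#-from-empty-≤ : ∀ D c → c + D ≡ M →
      paths# (boxes D) (staircase D) (staircase 0) * hookProduct D 0 ≤ boxes D !
    paths#-from-empty-≤ D c eq = begin
      paths# (boxes D) (staircase D) (staircase 0) * hookProduct D 0
                                                    ≤⟨ ℕ.*-monoʳ-≤ (paths# (boxes D) (staircase D) (staircase 0)) (excited-≥ D c 0 eq) ⟩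
      paths# (boxes D) (staircase D) (staircase 0) * excited {M} D c 0 (staircase D)
                                                    ≡⟨ paths#-excited D c eq (boxes D) (staircase 0) (staircase-distinct 0)
                                                         (sym (total-staircase D (subst (D ≤_) eq (ℕ.m≤n+m D c)))) ⟩
      boxes D ! * excited {M} D c 0 (staircase 0)       ≡⟨ cong (boxes D ! *_) (excited-empty D c 0) ⟩
      boxes D ! * 1                                 ≡⟨ ℕ.*-identityʳ _ ⟩
      boxes D !                                     ∎
      where open ℕ.≤-Reasoning

    module _ (j D : ℕ) (j+D≡M : j + D ≡ M) where

      skew-paths#-≥ : ∀ n → n + boxes D ≡ boxes M →
        n ! * hookProduct D j ≤ paths# n (staircase M) (staircase D) * hookProduct M 0
      skew-paths#-≥ n eq = begin
        n ! * hookProduct D j                          ≤⟨ ℕ.*-monoʳ-≤ (n !) (excited-≥ D j j j+D≡M) ⟩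
        n ! * excited {M} D j j (staircase D)              ≤⟨ ℕ.*-monoʳ-≤ (n !) mono ⟩
        n ! * excited {M} M 0 0 (staircase D)              ≡⟨ sym (paths#-excited M 0 refl n (staircase D) (staircase-distinct D) totals) ⟩
        paths# n (staircase M) (staircase D) * excited {M} M 0 0 (staircase M)
                                                       ≤⟨ ℕ.*-monoʳ-≤ (paths# n (staircase M) (staircase D)) (excited-≤ M 0 refl) ⟩
        paths# n (staircase M) (staircase D) * hookProduct M 0 ∎
        where
        open ℕ.≤-Reasoning
        mono : excited {M} D j j (staircase D) ≤ excited {M} M 0 0 (staircase D)
        mono = subst₂ (λ x y → excited {M} D x x (staircase D) ≤ excited {M} y 0 0 (staircase D)) (ℕ.+-identityʳ j) j+D≡M
          (excited-mono j D 0 0 (staircase D))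
        totals : n + total {M} (staircase D) ≡ total {M} (staircase M)
        totals = trans (cong (n +_) (total-staircase D (subst (D ≤_) j+D≡M (ℕ.m≤n+m D j))))
          (trans (sym (ℕ.+-assoc n (boxes D) _)) (trans (cong (_+ total {M} (staircase 0)) eq) (sym (total-staircase M ℕ.≤-refl))))

      skew-paths#-≤ : ∀ n → boxes D + n ≡ boxes M →
        paths# n (staircase M) (staircase D) * boxes D ! * hookProduct M 0 ≤ boxes M ! * hookProduct D 0
      skew-paths#-≤ n eq = begin
        f * boxes D ! * hookProduct M 0            ≤⟨ ℕ.*-monoˡ-≤ (hookProduct M 0) (ℕ.*-monoʳ-≤ f (paths#-from-empty-≥ D j j+D≡M)) ⟩
        f * (g * hookProduct D 0) * hookProduct M 0   ≡⟨ e f g (hookProduct D 0) (hookProduct M 0) ⟩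
        (g * f) * hookProduct M 0 * hookProduct D 0   ≤⟨ ℕ.*-monoˡ-≤ (hookProduct D 0) (ℕ.*-monoˡ-≤ (hookProduct M 0)
                                                          (paths#-concat (boxes D) n (staircase 0) (staircase D) (staircase M))) ⟩
        paths# (boxes D + n) (staircase M) (staircase 0) * hookProduct M 0 * hookProduct D 0
                                                   ≡⟨ cong (λ N → paths# N (staircase M) (staircase 0) * hookProduct M 0 * hookProduct D 0) eq ⟩
        paths# (boxes M) (staircase M) (staircase 0) * hookProduct M 0 * hookProduct D 0
                                                   ≤⟨ ℕ.*-monoˡ-≤ (hookProduct D 0) (paths#-from-empty-≤ M 0 refl) ⟩
        boxes M ! * hookProduct D 0                ∎
        where
        open ℕ.≤-Reasoning
        f = paths# n (staircase M) (staircase D)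
        g = paths# (boxes D) (staircase D) (staircase 0)
        e : ∀ a b c d → a * (b * c) * d ≡ (b * a) * d * c
        e = solve-∀

  -- Chains of partitions as orderings of cells

  infix 4 _≺_

  _≺_ : Cell → Cell → Set
  (i , j) ≺ (i′ , j′) = (i ≡ i′ × j < j′) ⊎ (j ≡ j′ × i < i′)

  ≺-irrefl : ∀ {x} → ¬ x ≺ x
  ≺-irrefl (inj₁ (_ , lt)) = ℕ.<-irrefl refl lt
  ≺-irrefl (inj₂ (_ , lt)) = ℕ.<-irrefl refl lt

  whenList : ∀ {P A : Set} → Dec P → List A → List A
  whenList (yes _) xs = xs
  whenList (no _)  _  = []

  length-whenList : ∀ {P A : Set} (d : Dec P) (xs : List A) → length (whenList d xs) ≡ when d (length xs)
  length-whenList (yes _) xs = refl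
  length-whenList (no _)  xs = refl

  ∈-whenList⁻ : ∀ {P A : Set} (d : Dec P) {xs : List A} {x} → x ∈ whenList d xs → P × x ∈ xs
  ∈-whenList⁻ (yes p) x∈ = p , x∈

  ∈-whenList⁺ : ∀ {P A : Set} (d : Dec P) {xs : List A} {x} → P → x ∈ xs → x ∈ whenList d xs
  ∈-whenList⁺ (yes _) p x∈ = x∈
  ∈-whenList⁺ (no ¬p) p x∈ = contradiction p ¬p

  whenList-unique : ∀ {P A : Set} (d : Dec P) {xs : List A} → Unique xs → Unique (whenList d xs)
  whenList-unique (yes _) u = u
  whenList-unique (no _)  u = []

  length-concat-tabulate : ∀ {A : Set} {n} (f : Fin n → List A) → length (concat (List.tabulate f)) ≡ sum (length ∘ f)
  length-concat-tabulate {n = zero}  f = refl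
  length-concat-tabulate {n = suc n} f = trans (List.length-++ (f zero)) (cong (length (f zero) +_) (length-concat-tabulate (f ∘ suc)))

  module _ {M : ℕ} where

    row# : State M → Fin M → ℕ
    row# p i = lookup p i ∸ home i

    firstCell : State M → Fin M → Cell
    firstCell p i = toℕ i , row# p i

    -- The chains counted by `paths#`, each recorded by its boxes in the order of their addition.
    paths : ℕ → State M → State M → List (List Cell)
    paths zero    q p = whenList (p ≟ˢ q) ([] ∷ [])
    paths (suc n) q p = concat (List.tabulate λ i →
      whenList (raisable? p i) (map (firstCell p i ∷_) (paths n q (raise p i))))

    length-paths : ∀ n q p → length (paths n q p) ≡ paths# n q p
    length-paths zero    q p = length-whenList (p ≟ˢ q) _
    length-paths (suc n) q p = trans (length-concat-tabulate {n = M} λ i → whenList (raisable? p i) (map (firstCell p i ∷_) (paths n q (raise p i)))) (sum-cong-≗ {M} λ i →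
      trans (length-whenList (raisable? p i) (map (firstCell p i ∷_) (paths n q (raise p i)))) (cong (when (raisable? p i))
        (trans (List.length-map (firstCell p i ∷_) (paths n q (raise p i))) (length-paths n q (raise p i)))))

    ∈-paths⁻ : ∀ {n q p xs} → xs ∈ paths (suc n) q p →
      ∃[ i ] ∃[ ys ] xs ≡ firstCell p i ∷ ys × Free (suc (lookup p i)) p × ys ∈ paths n q (raise p i)
    ∈-paths⁻ {n} {q} {p} xs∈ with ∈-concat⁻′ _ xs∈
    ... | _ , xs∈l , l∈ with ∈-tabulate⁻
        {f = λ i → whenList (raisable? p i) (map (firstCell p i ∷_) (paths n q (raise p i)))} l∈
    ... | i , refl with ∈-whenList⁻ (raisable? p i) xs∈l
    ... | f , xs∈m with ∈-map⁻ (firstCell p i ∷_) xs∈m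
    ... | ys , ys∈ , eq = i , ys , eq , f , ys∈

    ∈-paths⁺ : ∀ {n q p ys} i → Free (suc (lookup p i)) p → ys ∈ paths n q (raise p i) →
      firstCell p i ∷ ys ∈ paths (suc n) q p
    ∈-paths⁺ {n} {q} {p} i f ys∈ = ∈-concat⁺′
      (∈-whenList⁺ (raisable? p i) f (∈-map⁺ (firstCell p i ∷_) ys∈)) (∈-tabulate⁺ i)

    paths-unique : ∀ n q p → Unique (paths n q p)
    paths-unique zero    q p = whenList-unique (p ≟ˢ q) ([] ∷ [])
    paths-unique (suc n) q p = Unique.concat⁺
      (All.tabulate⁺ λ i → whenList-unique (raisable? p i)
        (Unique.map⁺ List.∷-injectiveʳ (paths-unique n q (raise p i))))
      (AllPairs.tabulate⁺ λ {i} {j} i≢j (xs∈i , xs∈j) →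
        let _ , xs∈i′ = ∈-whenList⁻ (raisable? p i) xs∈i
            _ , xs∈j′ = ∈-whenList⁻ (raisable? p j) xs∈j
            _ , _ , eq₁ = ∈-map⁻ (firstCell p i ∷_) xs∈i′
            _ , _ , eq₂ = ∈-map⁻ (firstCell p j ∷_) xs∈j′
        in i≢j (Fin.toℕ-injective (cong proj₁ (List.∷-injectiveˡ (trans (sym eq₁) eq₂)))))

    -- The states that come from partitions. Distinct positions suffice for the recurrences, but
    -- cells are read off from row lengths, and the truncated difference in `row#` is faithful only
    -- from the home site on.
    record Valid (p : State M) : Set where
      field
        home≤   : ∀ i → home i ≤ lookup p i
        antitone : ∀ {i j} → toℕ i ≤ toℕ j → row# p j ≤ row# p i

      position : ∀ i → home i + row# p i ≡ lookup p i
      position i = ℕ.m+[n∸m]≡n (home≤ i)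

    row-raise : ∀ {p} → Valid p → ∀ i → row# (raise p i) i ≡ suc (row# p i)
    row-raise {p} v i = trans (cong (_∸ home i) (lookup-raise p i)) (ℕ.+-∸-assoc 1 (Valid.home≤ v i))

    row-raise′ : ∀ p {i j} → j ≢ i → row# (raise p i) j ≡ row# p j
    row-raise′ p {i} {j} j≢i = cong (_∸ home j) (lookup-raise′ p j≢i)

    row-raise-≥ : ∀ {p} → Valid p → ∀ i j → row# p j ≤ row# (raise p i) j
    row-raise-≥ {p} v i j with j Fin.≟ i
    ... | yes refl = subst (row# p j ≤_) (sym (row-raise v j)) (ℕ.n≤1+n _)
    ... | no j≢i   = ℕ.≤-reflexive (sym (row-raise′ p j≢i))

    Corner : State M → Fin M → Set
    Corner p i = ∀ j → toℕ j < toℕ i → row# p i < row# p j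

    -- If some row above were not longer, the row directly above would have equal length and its
    -- particle would block the next site.
    free⇒corner : ∀ {p} → Valid p → ∀ i → Free (suc (lookup p i)) p → Corner p i
    free⇒corner {p} v i f j j<i with ℕ.<-≤-connex (row# p i) (row# p j)
    ... | inj₁ lt = lt
    ... | inj₂ ge = contradiction at (f l)
      where
      open Valid v
      l<M : pred (toℕ i) < M
      l<M = ℕ.≤-<-trans ℕ.pred[n]≤n (Fin.toℕ<n i)
      l = fromℕ< l<M
      suc-l : suc (toℕ l) ≡ toℕ i
      suc-l = trans (cong suc (Fin.toℕ-fromℕ< l<M)) (ℕ.suc-pred (toℕ i) {{>-nonZero (ℕ.≤-<-trans z≤n j<i)}})
      row-eq : row# p l ≡ row# p i
      row-eq = ℕ.≤-antisym (ℕ.≤-trans (antitone (s≤s⁻¹ (subst (toℕ j <_) (sym suc-l) j<i))) ge)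
        (antitone (ℕ.≤-trans (ℕ.n≤1+n _) (ℕ.≤-reflexive suc-l)))
      home-l : home l ≡ suc (home i)
      home-l = ℕ.+-cancelʳ-≡ (toℕ i) _ _ (trans (trans (cong (home l +_) (sym suc-l)) (home-eq l))
        (sym (trans (sym (ℕ.+-suc (home i) (toℕ i))) (home-eq i))))
      at : lookup p l ≡ suc (lookup p i)
      at = trans (sym (position l)) (trans (cong₂ _+_ home-l row-eq) (cong suc (position i)))

    corner⇒free : ∀ {p} → Valid p → ∀ i → Corner p i → Free (suc (lookup p i)) p
    corner⇒free {p} v i c j eq with ℕ.<-cmp (toℕ j) (toℕ i)
    ... | tri< j<i _ _ = ℕ.<-irrefl (sym eq) (subst₂ _<_ (cong suc (Valid.position v i)) (Valid.position v j)
                           (ℕ.+-mono-≤-< (home-mono-< j<i) (c j j<i)))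
    ... | tri≈ _ j≡i _ = ℕ.1+n≢n (trans (sym eq) (cong (lookup p) (Fin.toℕ-injective j≡i)))
    ... | tri> _ _ i<j = ℕ.<-irrefl eq (ℕ.m<n⇒m<1+n (subst₂ _<_ (Valid.position v j) (Valid.position v i)
                           (ℕ.+-mono-<-≤ (home-mono-< i<j) (Valid.antitone v (ℕ.<⇒≤ i<j)))))

    raise-valid : ∀ {p} → Valid p → ∀ i → Corner p i → Valid (raise p i)
    raise-valid {p} v i c = record { home≤ = home≤′ ; antitone = λ {j} {l} → antitone′ j l }
      where
      open Valid v
      home≤′ : ∀ j → home j ≤ lookup (raise p i) j
      home≤′ j with j Fin.≟ i
      ... | yes refl = subst (home j ≤_) (sym (lookup-raise p j)) (ℕ.m≤n⇒m≤1+n (home≤ j))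
      ... | no j≢i   = subst (home j ≤_) (sym (lookup-raise′ p j≢i)) (home≤ j)
      antitone′ : ∀ j l → toℕ j ≤ toℕ l → row# (raise p i) l ≤ row# (raise p i) j
      antitone′ j l j≤l with l Fin.≟ i
      ... | no l≢i = ℕ.≤-trans (ℕ.≤-reflexive (row-raise′ p l≢i)) (ℕ.≤-trans (antitone j≤l) (row-raise-≥ v i j))
      ... | yes refl with j Fin.≟ i
      ...   | yes refl = ℕ.≤-refl
      ...   | no j≢i = subst₂ _≤_ (sym (row-raise v i)) (sym (row-raise′ p j≢i))
                         (c j (ℕ.≤∧≢⇒< j≤l (j≢i ∘ Fin.toℕ-injective)))

    Remaining : State M → Cell → Set
    Remaining p (i , j) = ∃[ f ] toℕ f ≡ i × row# p f ≤ j × j < M ∸ i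

    -- The linear extensions of the cells outside `p`: a standard tableau, with its cells listed by
    -- increasing entry.
    record Listing (p : State M) (xs : List Cell) : Set where
      field
        unique   : Unique xs
        ordered  : AllPairs (λ x y → ¬ y ≺ x) xs
        complete : ∀ {c} → Remaining p c → c ∈ xs
        sound    : ∀ {c} → c ∈ xs → Remaining p c

    row-staircase : ∀ D i → row# (staircase D) i ≡ D ∸ toℕ i
    row-staircase D i = trans (cong (_∸ home i) (lookup-staircase D i)) (ℕ.m+n∸m≡n (home i) _)

    staircase-valid : ∀ D → Valid (staircase D)
    staircase-valid D = record
      { home≤    = λ i → subst (home i ≤_) (sym (lookup-staircase D i)) (ℕ.m≤m+n _ _)
      ; antitone = λ {i} {j} i≤j → subst₂ _≤_ (sym (row-staircase D j)) (sym (row-staircase D i)) (ℕ.∸-monoʳ-≤ D i≤j)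
      }

    Fits : State M → Set
    Fits p = ∀ i → row# p i ≤ M ∸ toℕ i

    raise-remaining : ∀ {p c} → Valid p → ∀ i → Remaining (raise p i) c → Remaining p c
    raise-remaining v i (f , eq , le , lt) = f , eq , ℕ.≤-trans (row-raise-≥ v i f) le , lt

    remaining-raise : ∀ {p c} → Valid p → ∀ i → Remaining p c → c ≢ firstCell p i → Remaining (raise p i) c
    remaining-raise {p} {_ , b} v i (f , refl , le , lt) c≢ = f , refl , bound , lt
      where
      bound : row# (raise p i) f ≤ b
      bound with f Fin.≟ i
      ... | no f≢i = subst (_≤ b) (sym (row-raise′ p f≢i)) le
      ... | yes refl = subst (_≤ b) (sym (row-raise v f)) (ℕ.≤∧≢⇒< le λ eq → c≢ (cong (toℕ f ,_) (sym eq)))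

    first-removed : ∀ {p} → Valid p → ∀ i → ¬ Remaining (raise p i) (firstCell p i)
    first-removed {p} v i (f , eq , le , _) = ℕ.1+n≰n (subst (_≤ row# p i)
      (trans (cong (row# (raise p i)) (Fin.toℕ-injective eq)) (row-raise v i)) le)

    listing-cons : ∀ {p ys} → Valid p → ∀ i → Corner p i → row# p i < M ∸ toℕ i →
                   Listing (raise p i) ys → Listing p (firstCell p i ∷ ys)
    listing-cons {p} {ys} v i c fits L = record
      { unique   = All.tabulate (λ x∈ eq → first-removed v i (sound (subst (_∈ ys) (sym eq) x∈))) ∷ unique
      ; ordered  = All.tabulate (λ y∈ → minimal (sound y∈)) ∷ ordered
      ; complete = complete′
      ; sound    = sound′
      }
      where
      open Listing L
      minimal : ∀ {y} → Remaining (raise p i) y → ¬ y ≺ firstCell p i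
      minimal (f , refl , le , _) (inj₁ (eq , lt)) with Fin.toℕ-injective eq
      ... | refl = ℕ.<⇒≱ lt (ℕ.≤-trans (row-raise-≥ v i f) le)
      minimal (f , refl , le , _) (inj₂ (refl , lt)) = ℕ.<⇒≱ (c f lt) (ℕ.≤-trans (row-raise-≥ v i f) le)
      complete′ : ∀ {x} → Remaining p x → x ∈ firstCell p i ∷ ys
      complete′ {a , b} r with a ℕ.≟ toℕ i | b ℕ.≟ row# p i
      ... | yes refl | yes refl = here refl
      ... | no a≢    | _        = there (complete (remaining-raise v i r (a≢ ∘ cong proj₁)))
      ... | yes _    | no b≢    = there (complete (remaining-raise v i r (b≢ ∘ cong proj₂)))
      sound′ : ∀ {x} → x ∈ firstCell p i ∷ ys → Remaining p x
      sound′ (here refl) = i , refl , ℕ.≤-refl , fits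
      sound′ (there x∈)  = raise-remaining v i (sound x∈)

    listing-tail : ∀ {p ys} → Valid p → ∀ i → Listing p (firstCell p i ∷ ys) → Listing (raise p i) ys
    listing-tail {p} {ys} v i L = record
      { unique   = AllPairs.tail unique
      ; ordered  = AllPairs.tail ordered
      ; complete = λ {c} r → drop r (complete (raise-remaining v i r))
      ; sound    = λ c∈ → remaining-raise v i (sound (there c∈))
                     λ eq → Unique.Unique[x∷xs]⇒x∉xs unique (subst (_∈ ys) eq c∈)
      }
      where
      open Listing L
      drop : ∀ {c} → Remaining (raise p i) c → c ∈ firstCell p i ∷ ys → c ∈ ys
      drop r (here refl) = contradiction r (first-removed v i)
      drop r (there c∈)  = c∈

    paths-sound : ∀ n {p xs} → Valid p → xs ∈ paths n (staircase M) p → length xs ≡ n × Fits p × Listing p xs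
    paths-sound zero {p} {xs} v xs∈ with ∈-whenList⁻ (p ≟ˢ staircase M) xs∈
    ... | refl , here refl = refl , (λ i → ℕ.≤-reflexive (row-staircase M i)) , record
      { unique   = []
      ; ordered  = []
      ; complete = λ (f , eq , le , lt) → contradiction (ℕ.≤-trans (ℕ.≤-reflexive (sym
          (trans (row-staircase M f) (cong (M ∸_) eq)))) le) (ℕ.<⇒≱ lt)
      ; sound    = λ ()
      }
    paths-sound (suc n) {p} {xs} v xs∈ with ∈-paths⁻ {n} {staircase M} {p} xs∈
    ... | i , ys , refl , f , ys∈ with paths-sound n (raise-valid v i (free⇒corner v i f)) ys∈
    ... | len , fits , L = cong suc len , (λ j → ℕ.≤-trans (row-raise-≥ v i j) (fits j))
      , listing-cons v i (free⇒corner v i f) (subst (_≤ M ∸ toℕ i) (row-raise v i) (fits i)) L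

    -- Nothing precedes the head of a listing, so it is the first remaining cell of its row and all
    -- rows above are longer: adding it is a legal move.
    paths-complete : ∀ xs {p} → Valid p → Fits p → Listing p xs → xs ∈ paths (length xs) (staircase M) p
    paths-complete [] {p} v fits L = ∈-whenList⁺ (p ≟ˢ staircase M) (lookup-ext λ i →
        trans (sym (Valid.position v i)) (trans (cong (home i +_) (full i)) (sym (lookup-staircase M i)))) (here refl)
      where
      full : ∀ i → row# p i ≡ M ∸ toℕ i
      full i with ℕ.<-≤-connex (row# p i) (M ∸ toℕ i)
      ... | inj₂ ge = ℕ.≤-antisym (fits i) ge
      ... | inj₁ lt with Listing.complete L (i , refl , ℕ.≤-refl , lt)
      ...   | ()
    paths-complete ((a , b) ∷ xs) {p} v fits L with Listing.sound L (here refl)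
    ... | i , refl , le , lt = subst (λ x → x ∷ xs ∈ paths (suc (length xs)) (staircase M) p) (cong (toℕ i ,_) b≡)
      (∈-paths⁺ {length xs} {staircase M} {p} i (corner⇒free v i corner)
        (paths-complete xs (raise-valid v i corner) fits′
          (listing-tail v i (subst (λ b → Listing p ((toℕ i , b) ∷ xs)) (sym b≡) L))))
      where
      open Listing L
      earlier : ∀ {y} → Remaining p y → ¬ y ≺ (toℕ i , b)
      earlier r y≺ with complete r
      ... | here refl = ≺-irrefl y≺
      ... | there y∈ = All.lookup (AllPairs.head ordered) y∈ y≺
      b≡ : row# p i ≡ b
      b≡ with row# p i ℕ.≟ b
      ... | yes eq = eq
      ... | no ne = contradiction (inj₁ (refl , ℕ.≤∧≢⇒< le ne))
                      (earlier (i , refl , ℕ.≤-refl , ℕ.≤-<-trans le lt))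
      corner : Corner p i
      corner j j<i with ℕ.<-≤-connex (row# p i) (row# p j)
      ... | inj₁ lt′ = lt′
      ... | inj₂ ge = contradiction (inj₂ (refl , j<i))
        (earlier (j , refl , subst (row# p j ≤_) b≡ ge , ℕ.<-≤-trans lt (ℕ.∸-monoʳ-≤ M (ℕ.<⇒≤ j<i))))
      fits′ : Fits (raise p i)
      fits′ j with j Fin.≟ i
      ... | yes refl = subst (_≤ M ∸ toℕ j) (sym (row-raise v j)) (subst (_< M ∸ toℕ j) (sym b≡) lt)
      ... | no j≢i = subst (_≤ M ∸ toℕ j) (sym (row-raise′ p j≢i)) (fits j)

  -- Positions in lists, and counting by injective relations

  -- Positions are natural numbers rather than elements of `Fin`, so that lists whose lengths are
  -- only propositionally equal can be compared.
  data At {A : Set} : List A → ℕ → A → Set where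
    here  : ∀ {x xs} → At (x ∷ xs) zero x
    there : ∀ {x y xs t} → At xs t x → At (y ∷ xs) (suc t) x

  module _ {A : Set} where

    At-functional : ∀ {xs : List A} {t x y} → At xs t x → At xs t y → x ≡ y
    At-functional here here = refl
    At-functional (there a) (there b) = At-functional a b

    At⇒∈ : ∀ {xs : List A} {t x} → At xs t x → x ∈ xs
    At⇒∈ here      = here refl
    At⇒∈ (there a) = there (At⇒∈ a)

    ∈⇒At : ∀ {xs : List A} {x} → x ∈ xs → ∃[ t ] t < length xs × At xs t x
    ∈⇒At (here refl) = 0 , s≤s z≤n , here
    ∈⇒At (there x∈)  = let t , t< , a = ∈⇒At x∈ in suc t , s≤s t< , there a

    At-exists : ∀ {xs : List A} {t} → t < length xs → ∃[ x ] At xs t x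
    At-exists {x ∷ xs} {zero}  _       = x , here
    At-exists {x ∷ xs} {suc t} (s≤s t<) = let y , a = At-exists t< in y , there a

    At-injective : ∀ {xs : List A} {s t x} → Unique xs → At xs s x → At xs t x → s ≡ t
    At-injective (x∉ ∷ u) here      here      = refl
    At-injective (x∉ ∷ u) here      (there b) = contradiction refl (All.lookup x∉ (At⇒∈ b))
    At-injective (x∉ ∷ u) (there a) here      = contradiction refl (All.lookup x∉ (At⇒∈ a))
    At-injective (x∉ ∷ u) (there a) (there b) = cong suc (At-injective u a b)

    At-ordered : ∀ {R : A → A → Set} {xs s t x y} → AllPairs R xs → At xs s x → At xs t y → s < t → R x y
    At-ordered (r ∷ rs) here      (there b) _        = All.lookup r (At⇒∈ b)
    At-ordered (r ∷ rs) (there a) (there b) (s≤s lt) = At-ordered rs a b lt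

    At-ext : ∀ {xs ys : List A} → length xs ≡ length ys →
             (∀ {t} → t < length xs → ∃[ x ] At xs t x × At ys t x) → xs ≡ ys
    At-ext {[]}     {[]}     eq h = refl
    At-ext {x ∷ xs} {y ∷ ys} eq h with h {0} (s≤s z≤n)
    ... | _ , here , here = cong (x ∷_) (At-ext (ℕ.suc-injective eq) λ t< → tail (h (s≤s t<)))
      where
      tail : ∀ {t} → ∃[ z ] At (x ∷ xs) (suc t) z × At (y ∷ ys) (suc t) z → ∃[ z ] At xs t z × At ys t z
      tail (z , there a , there b) = z , a , b

    At-tabulate : ∀ {n} (f : Fin n → A) t → At (List.tabulate f) (toℕ t) (f t)
    At-tabulate f zero    = here
    At-tabulate f (suc t) = there (At-tabulate (f ∘ suc) t)

    At-lookup : ∀ (xs : List A) i → At xs (toℕ i) (List.lookup xs i)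
    At-lookup (x ∷ xs) zero    = here
    At-lookup (x ∷ xs) (suc i) = there (At-lookup xs i)

    lookup-injective : ∀ {xs : List A} → Unique xs → ∀ i j → List.lookup xs i ≡ List.lookup xs j → i ≡ j
    lookup-injective {xs} u i j eq = Fin.toℕ-injective
      (At-injective u (At-lookup xs i) (subst (At xs (toℕ j)) (sym eq) (At-lookup xs j)))

    remove : ∀ {y : A} {ys} → y ∈ ys → ∃[ zs ] length ys ≡ suc (length zs) × (∀ {z} → z ∈ ys → z ≢ y → z ∈ zs)
    remove {y} {_ ∷ ys} (here refl) = ys , refl , λ { (here eq) z≢y → contradiction eq z≢y ; (there z∈) _ → z∈ }
    remove {y} {x ∷ ys} (there y∈) = let zs , len , keep = remove y∈ in
      x ∷ zs , cong suc len , λ { (here eq) _ → here eq ; (there z∈) z≢y → there (keep z∈ z≢y) }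

  -- The partner of the head is deleted from `ys`; injectivity of R keeps all other partners. A
  -- relation suffices, so the correspondence between tableaux and lists need not be a function on
  -- either side.
  matching-≤ : ∀ {A B : Set} (R : A → B → Set) {xs ys} → Unique xs →
    (∀ {x} → x ∈ xs → ∃[ y ] y ∈ ys × R x y) →
    (∀ {x x′ y} → R x y → R x′ y → x ≡ x′) → length xs ≤ length ys
  matching-≤ R {[]} u f inj = z≤n
  matching-≤ R {x ∷ xs} {ys} (x∉ ∷ u) f inj with f (here refl)
  ... | y , y∈ , Rxy with remove y∈
  ... | zs , len , keep = subst (suc (length xs) ≤_) (sym len) (s≤s (matching-≤ R u g inj))
    where
    g : ∀ {x′} → x′ ∈ xs → ∃[ z ] z ∈ zs × R x′ z
    g x′∈ with f (there x′∈)
    ... | z , z∈ , Rx′z = z , keep z∈ (λ { refl → All.lookup x∉ x′∈ (inj Rxy Rx′z) }) , Rx′z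

  length-filter-map : ∀ {A B : Set} {P : B → Set} (P? : ∀ b → Dec (P b)) (f : A → B) xs →
    length (List.filter P? (map f xs)) ≡ length (List.filter (P? ∘ f) xs)
  length-filter-map P? f []       = refl
  length-filter-map P? f (x ∷ xs) with P? (f x)
  ... | yes _ = cong suc (length-filter-map P? f xs)
  ... | no _  = length-filter-map P? f xs

  funToFin-cong : ∀ {m n} {f g : Fin m → Fin n} → (∀ i → f i ≡ g i) → funToFin f ≡ funToFin g
  funToFin-cong {zero}  h = refl
  funToFin-cong {suc m} h = cong₂ Fin.combine (h zero) (funToFin-cong (h ∘ suc))

  finToFun-injective : ∀ m n {a b : Fin (n ^ m)} → (∀ i → finToFun {n} {m} a i ≡ finToFun b i) → a ≡ b
  finToFun-injective m n {a} {b} h = trans (sym (Fin.funToFin-finToFin {m} {n} a))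
    (trans (funToFin-cong {m} {n} h) (Fin.funToFin-finToFin {m} {n} b))

  -- Tableaux of a skew shape and listings of its cells

  module _ (s : SkewShape) where

    entry-beyond : ∀ xs i → length xs ≤ i → entry xs i ≡ 0
    entry-beyond []       i       _        = refl
    entry-beyond (x ∷ xs) (suc i) (s≤s le) = entry-beyond xs i le

    ∈-cells⁻ : ∀ {i j} → (i , j) ∈ cells s → part (inner s) i ≤ j × j < part (outer s) i
    ∈-cells⁻ {i} {j} c∈ with ∈-concat⁻′ (map (rowCells s) (upTo (length (parts (outer s))))) c∈
    ... | _ , c∈r , r∈ with ∈-map⁻ (rowCells s) r∈
    ... | i′ , _ , refl with ∈-map⁻ (λ j → i′ , part (inner s) i′ + j) c∈r
    ... | j′ , j′∈ , refl = ℕ.m≤m+n _ j′ , subst (part (inner s) i + j′ <_) (ℕ.m+[n∸m]≡n (contained s i)) (ℕ.+-monoʳ-< (part (inner s) i) (∈-upTo⁻ j′∈))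

    ∈-cells⁺ : ∀ {i j} → part (inner s) i ≤ j → j < part (outer s) i → (i , j) ∈ cells s
    ∈-cells⁺ {i} {j} ge lt = ∈-concat⁺′ {xss = map (rowCells s) (upTo (length (parts (outer s))))}
      (subst (λ x → (i , x) ∈ rowCells s i) (ℕ.m+[n∸m]≡n ge)
        (∈-map⁺ (λ j → i , part (inner s) i + j) (∈-upTo⁺ (ℕ.∸-monoˡ-< lt ge))))
      (∈-map⁺ (rowCells s) (∈-upTo⁺ row<))
      where
      row< : i < length (parts (outer s))
      row< with ℕ.<-≤-connex i (length (parts (outer s)))
      ... | inj₁ lt′ = lt′
      ... | inj₂ ge′ = contradiction (subst (j <_) (entry-beyond (parts (outer s)) i ge′) lt) λ ()

    cells-unique : Unique (cells s)
    cells-unique = Unique.concat⁺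
      (All.map⁺ (All.tabulate λ {i} _ → Unique.map⁺ (λ eq → ℕ.+-cancelˡ-≡ (part (inner s) i) _ _ (cong proj₂ eq)) (Unique.upTo⁺ _)))
      (AllPairs.map⁺ (AllPairs.map disjoint (Unique.upTo⁺ (length (parts (outer s))))))
      where
      disjoint : ∀ {i j} → i ≢ j → ∀ {c} → ¬ (c ∈ rowCells s i × c ∈ rowCells s j)
      disjoint {i} {j} i≢j (c∈i , c∈j) with ∈-map⁻ (λ x → i , part (inner s) i + x) c∈i | ∈-map⁻ (λ x → j , part (inner s) j + x) c∈j
      ... | _ , _ , refl | _ , _ , eq = i≢j (cong proj₁ eq)

    module _ {M : ℕ} (μ : State M) (valid : Valid μ) (fits : Fits μ)
             (remaining⇒∈ : ∀ {c} → Remaining μ c → c ∈ cells s)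
             (∈⇒remaining : ∀ {c} → c ∈ cells s → Remaining μ c) where
      private
        n = size s
        cell : Fin n → Cell
        cell = List.lookup (cells s)

      Encodes : Filling s → List Cell → Set
      Encodes T xs = ∀ c → At xs (toℕ (T c)) (cell c)

      cell-index : ∀ {x} → x ∈ cells s → ∃[ c ] x ≡ cell c
      cell-index x∈ = Any.index x∈ , lookup-index x∈

      syt⇒listing : ∀ {T} → IsSYT s T → ∃[ xs ] length xs ≡ n × Listing μ xs × Encodes T xs
      syt⇒listing {T} syt = xs , List.length-tabulate f , record
          { unique   = Unique.tabulate⁺ λ {t} {u} eq → trans (sym (T-T⁻¹ t)) (trans (cong T (lookup-injective cells-unique _ _ eq)) (T-T⁻¹ u))
          ; ordered  = AllPairs.tabulate⁺-< λ {t} {u} t<u c≺ → ℕ.<-asym t<u (subst₂ Fin._<_ (T-T⁻¹ u) (T-T⁻¹ t) (increases c≺))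
          ; complete = λ r → let c , eq = cell-index (remaining⇒∈ r)
                             in subst (_∈ xs) (sym eq) (At⇒∈ (encodes c))
          ; sound    = λ x∈ → let t , eq = ∈-tabulate⁻ {f = f} x∈ in ∈⇒remaining (subst (_∈ cells s) (sym eq) (∈-lookup (T⁻¹ t)))
          } , encodes
        where
        open IsSYT syt
        T⁻¹ : Fin n → Fin n
        T⁻¹ t = proj₁ (proj₂ bijective t)
        T-T⁻¹ : ∀ t → T (T⁻¹ t) ≡ t
        T-T⁻¹ t = proj₂ (proj₂ bijective t) refl
        f : Fin n → Cell
        f t = cell (T⁻¹ t)
        xs = List.tabulate f
        increases : ∀ {c d} → cell c ≺ cell d → T c Fin.< T d
        increases {c} {d} (inj₁ (eq , lt)) = rowsIncrease c d eq lt
        increases {c} {d} (inj₂ (eq , lt)) = columnsIncrease c d eq lt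
        encodes : Encodes T xs
        encodes c = subst (At xs (toℕ (T c))) (cong cell (proj₁ bijective (T-T⁻¹ (T c)))) (At-tabulate f (T c))

      listing⇒syt : ∀ {T xs} → length xs ≡ n → Listing μ xs → Encodes T xs → IsSYT s T
      listing⇒syt {T} {xs} len L enc = record
        { bijective       = injective , surjective
        ; rowsIncrease    = λ c d eq lt → increases c d (inj₁ (eq , lt))
        ; columnsIncrease = λ c d eq lt → increases c d (inj₂ (eq , lt))
        }
        where
        open Listing L
        injective : Injective _≡_ _≡_ T
        injective {c} {d} eq = lookup-injective cells-unique c d
          (At-functional (enc c) (subst (λ t → At xs (toℕ t) (cell d)) (sym eq) (enc d)))
        surjective : Surjective _≡_ _≡_ T
        surjective t =
          let x , a = At-exists (subst (toℕ t <_) (sym len) (Fin.toℕ<n t))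
              c , eq = cell-index (remaining⇒∈ (sound (At⇒∈ a)))
          in c , λ z≡c → trans (cong T z≡c) (Fin.toℕ-injective
                   (At-injective unique (subst (At xs (toℕ (T c))) (sym eq) (enc c)) a))
        increases : ∀ c d → cell c ≺ cell d → T c Fin.< T d
        increases c d c≺d with ℕ.<-cmp (toℕ (T c)) (toℕ (T d))
        ... | tri< lt _ _ = lt
        ... | tri> _ _ gt = contradiction c≺d (At-ordered ordered (enc d) (enc c) gt)
        ... | tri≈ _ eq _ = contradiction (subst (cell c ≺_) (sym (At-functional (enc c)
                              (subst (λ t → At xs t (cell d)) (sym eq) (enc d)))) c≺d) ≺-irrefl

      listing⇒filling : ∀ {xs} → length xs ≡ n → Listing μ xs → ∃[ T ] Encodes T xs
      listing⇒filling {xs} len L = T , λ c → subst (λ t → At xs t (cell c)) (sym (Fin.toℕ-fromℕ< _)) (proj₂ (proj₂ (pos c)))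
        where
        pos : ∀ c → ∃[ t ] t < length xs × At xs t (cell c)
        pos c = ∈⇒At (Listing.complete L (∈⇒remaining (∈-lookup c)))
        T : Filling s
        T c = fromℕ< (subst (proj₁ (pos c) <_) len (proj₁ (proj₂ (pos c))))

      private
        tableaux = List.filter (isSYT? s ∘ finToFun) (List.allFin (n ^ n))

        length-tableaux : #SYT s ≡ length tableaux
        length-tableaux = length-filter-map (isSYT? s) finToFun (List.allFin (n ^ n))

        tableaux-unique : Unique tableaux
        tableaux-unique = Unique.filter⁺ (isSYT? s ∘ finToFun) (Unique.allFin⁺ (n ^ n))

      #SYT≤paths# : #SYT s ≤ paths# n (staircase M) μ
      #SYT≤paths# = subst₂ _≤_ (sym length-tableaux) (length-paths n (staircase M) μ)
        (matching-≤ (λ a xs → Unique xs × Encodes (finToFun a) xs) tableaux-unique exists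
          λ (u , enc) (_ , enc′) → finToFun-injective n n λ c → Fin.toℕ-injective (At-injective u (enc c) (enc′ c)))
        where
        exists : ∀ {a} → a ∈ tableaux → ∃[ xs ] xs ∈ paths n (staircase M) μ × Unique xs × Encodes (finToFun a) xs
        exists {a} a∈ =
          let xs , len , L , enc = syt⇒listing (proj₂ (∈-filter⁻ (isSYT? s ∘ finToFun) {xs = List.allFin (n ^ n)} a∈))
          in xs , subst (λ m → xs ∈ paths m (staircase M) μ) len (paths-complete xs valid fits L) , Listing.unique L , enc

      paths#≤#SYT : paths# n (staircase M) μ ≤ #SYT s
      paths#≤#SYT = subst₂ _≤_ (length-paths n (staircase M) μ) (sym length-tableaux)
        (matching-≤ (λ xs a → length xs ≡ n × IsSYT s (finToFun a) × Encodes (finToFun a) xs) (paths-unique n (staircase M) μ) exists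
          λ {xs} {ys} {a} (len , syt , enc) (len′ , _ , enc′) → At-ext (trans len (sym len′)) λ {t} t< →
            let t′ = fromℕ< (subst (t <_) len t<)
                c , T-c = proj₂ (IsSYT.bijective syt) t′
                eq = trans (cong toℕ (T-c refl)) (Fin.toℕ-fromℕ< (subst (t <_) len t<))
            in cell c , subst (λ t → At xs t (cell c)) eq (enc c) , subst (λ t → At ys t (cell c)) eq (enc′ c))
        where
        exists : ∀ {xs} → xs ∈ paths n (staircase M) μ →
                 ∃[ a ] a ∈ tableaux × length xs ≡ n × IsSYT s (finToFun a) × Encodes (finToFun a) xs
        exists {xs} xs∈ =
          let len , _ , L = paths-sound n valid xs∈
              T , enc = listing⇒filling len L
              enc′ : Encodes (finToFun (funToFin T)) xs
              enc′ c = subst (λ t → At xs (toℕ t) (cell c)) (sym (Fin.finToFun-funToFin T c)) (enc c)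
              syt = listing⇒syt len L enc′
          in funToFin T , ∈-filter⁺ (isSYT? s ∘ finToFun) (∈-allFin (funToFin T)) syt , len , syt , enc′

      #SYT≡paths# : #SYT s ≡ paths# n (staircase M) μ
      #SYT≡paths# = ℕ.≤-antisym #SYT≤paths# paths#≤#SYT

  -- Hook products for the shape υ_k

  boxes-+ : ∀ m n → boxes (m + n) ≡ boxes m + boxes n + m * n
  boxes-+ zero    n = sym (ℕ.+-identityʳ _)
  boxes-+ (suc m) n = trans (cong (suc (m + n) +_) (boxes-+ m n)) (e m n (boxes m) (boxes n))
    where
    e : ∀ m n a b → suc (m + n) + (a + b + m * n) ≡ (suc m + a) + b + (n + m * n)
    e = solve-∀

  double-boxes : ∀ d → boxes d * 2 ≡ d * suc d
  double-boxes zero    = refl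
  double-boxes (suc d) = trans (ℕ.*-distribʳ-+ 2 (suc d) (boxes d)) (trans (cong (suc d * 2 +_) (double-boxes d)) (e d))
    where
    e : ∀ d → suc d * 2 + d * suc d ≡ suc d * suc (suc d)
    e = solve-∀

  -- ∏ (2s + 1) ^ (e + K - 1 - s) over s < K.
  oddProduct : ℕ → ℕ → ℕ
  oddProduct zero    e = 1
  oddProduct (suc K) e = oddProduct K (suc e) * hook K ^ e

  -- The j outer antidiagonals have j + D, ..., D + 1 boxes. The second factor is the weight of E =
  -- μ, which therefore cancels in the lower bound.
  hookProduct-split : ∀ j D → hookProduct (j + D) 0 ≡ oddProduct j (suc D) * hookProduct D j
  hookProduct-split zero    D = sym (ℕ.+-identityʳ _)
  hookProduct-split (suc j) D = begin
    hookProduct (suc j + D) 0                              ≡⟨ cong (λ x → hookProduct x 0) (sym (ℕ.+-suc j D)) ⟩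
    hookProduct (j + suc D) 0                              ≡⟨ hookProduct-split j (suc D) ⟩
    oddProduct j (2 + D) * (hook j ^ suc D * hookProduct D (suc j)) ≡⟨ sym (ℕ.*-assoc (oddProduct j (2 + D)) _ _) ⟩
    oddProduct (suc j) (suc D) * hookProduct D (suc j)     ∎
    where open ≡-Reasoning

  hookProduct-odd : ∀ D → hookProduct D 0 ≡ oddProduct D 1
  hookProduct-odd D = trans (cong (λ x → hookProduct x 0) (sym (ℕ.+-identityʳ D)))
    (trans (hookProduct-split D 0) (ℕ.*-identityʳ _))

  module _ (b : ℕ) where
    private
      k = suc b
      -- δ_{2k} has 2k - 1 = M rows, and δ_k has k - 1 = b.
      M = suc b + b
      n = size (υ k)
      f = #SYT (υ k)
      μ : State M
      μ = staircase b

    size-υ-boxes : n ≡ k * k + boxes b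
    size-υ-boxes = trans (size-υ k) (trans (cong (ℕ._/ 2) (trans (cong (k *_) (e₁ b)) (trans (e₂ b)
      (sym (trans (ℕ.*-distribʳ-+ 2 (k * k) (boxes b)) (cong (k * k * 2 +_) (double-boxes b)))))))
      (ℕ.m*n/n≡m (k * k + boxes b) 2))
      where
      e₁ : ∀ b → b + (suc b + (suc b + 0)) ≡ 3 * b + 2
      e₁ = solve-∀
      e₂ : ∀ b → suc b * (3 * b + 2) ≡ suc b * suc b * 2 + b * suc b
      e₂ = solve-∀

    boxes-υ : boxes M ≡ boxes b + n
    boxes-υ = trans (boxes-+ (suc b) b) (trans (e b (boxes b)) (cong (boxes b +_) (sym size-υ-boxes)))
      where
      e : ∀ b x → suc b + x + x + suc b * b ≡ x + (suc b * suc b + x)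
      e = solve-∀

    part-outer : ∀ i → part (outer (υ k)) i ≡ M ∸ i
    part-outer i = trans (part-δ (2 * k) i) (cong (_∸ i) (trans (cong (λ x → b + suc x) (ℕ.+-identityʳ b)) (ℕ.+-suc b b)))

    #SYT-υ : f ≡ paths# n (staircase M) μ
    #SYT-υ = #SYT≡paths# (υ k) μ (staircase-valid b)
      (λ i → ℕ.≤-trans (ℕ.≤-reflexive (row-staircase b i)) (ℕ.∸-monoˡ-≤ (toℕ i) (ℕ.m≤n+m b (suc b))))
      (λ { {_ , j} (i , refl , le , lt) → ∈-cells⁺ (υ k)
        (subst (_≤ j) (trans (row-staircase b i) (sym (part-δ k (toℕ i)))) le)
        (subst (j <_) (sym (part-outer (toℕ i))) lt) })
      (λ { {i , j} c∈ → let ge , lt = ∈-cells⁻ (υ k) c∈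
                            lt′ = subst (j <_) (part-outer i) lt
                            i<M = ℕ.≰⇒> λ M≤i → ℕ.n≮0 (subst (j <_) (ℕ.m≤n⇒m∸n≡0 M≤i) lt′)
                            ix = Fin.toℕ-fromℕ< i<M
        in fromℕ< i<M , ix , subst (_≤ j) (trans (part-δ k i) (trans (cong (b ∸_) (sym ix)) (sym (row-staircase b (fromℕ< i<M))))) ge , lt′ })

    #SYT-υ-≥ : n ! ≤ f * oddProduct k k
    #SYT-υ-≥ = ℕ.*-cancelʳ-≤ (n !) (f * oddProduct k k) (hookProduct b k) (begin
      n ! * hookProduct b k                     ≤⟨ skew-paths#-≥ k b refl n (trans (ℕ.+-comm n (boxes b)) (sym boxes-υ)) ⟩
      paths# n (staircase M) μ * hookProduct M 0 ≡⟨ cong₂ _*_ (sym #SYT-υ) (hookProduct-split k b) ⟩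
      f * (oddProduct k k * hookProduct b k)     ≡⟨ sym (ℕ.*-assoc f _ _) ⟩
      f * oddProduct k k * hookProduct b k       ∎)
      where
      open ℕ.≤-Reasoning
      instance
        pos : NonZero (hookProduct b k)
        pos = >-nonZero (hookProduct-pos {M} b k)

    #SYT-υ-≤ : f * boxes b ! * oddProduct M 1 ≤ boxes M ! * oddProduct b 1
    #SYT-υ-≤ = subst₂ _≤_ (cong₂ (λ x y → x * boxes b ! * y) (sym #SYT-υ) (hookProduct-odd M)) (cong (boxes M ! *_) (hookProduct-odd b))
      (skew-paths#-≤ k b refl n (sym boxes-υ))

open import Data.Integer.Base using (+_)

module Asymptotics where

  open Counting using (boxes; hook; oddProduct; double-boxes; size-υ-boxes; #SYT-υ-≥; #SYT-υ-≤)
  open import Data.Rational.Base using (_+_; _*_; _-_; -_; _≤_; _<_)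

  -- Ordered arithmetic of rationals and reciprocals

  ring : AlmostCommutativeRing 0ℓ 0ℓ
  ring = fromCommutativeRing ℚ.+-*-commutativeRing isZero
    where
    isZero : ∀ x → Maybe (0ℚ ≡ x)
    isZero x with 0ℚ ℚ.≟ x
    ... | yes eq = just eq
    ... | no _   = nothing

  -- Abstract, so that the gcd in + n / 1 is never unfolded.
  abstract
    ι : ℕ → ℚ
    ι n = + n / 1

    ι-def : ∀ n → ι n ≡ + n / 1
    ι-def n = refl

  toℚᵘ-ι : ∀ n → ℚ.toℚᵘ (ι n) ℚᵘ.≃ ℚᵘ.mkℚᵘ (+ n) 0
  toℚᵘ-ι n = subst (λ q → ℚ.toℚᵘ q ℚᵘ.≃ ℚᵘ.mkℚᵘ (+ n) 0) (sym (ι-def n)) (ℚ.toℚᵘ-fromℚᵘ (ℚᵘ.mkℚᵘ (+ n) 0))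

  ι-+ : ∀ m n → ι (m ℕ.+ n) ≡ ι m + ι n
  ι-+ m n = ℚ.toℚᵘ-injective (begin
    ℚ.toℚᵘ (ι (m ℕ.+ n))                         ≈⟨ toℚᵘ-ι (m ℕ.+ n) ⟩
    ℚᵘ.mkℚᵘ (+ (m ℕ.+ n)) 0                      ≈⟨ ℚᵘ.*≡* (e (+ m) (+ n)) ⟩
    ℚᵘ.mkℚᵘ (+ m) 0 ℚᵘ.+ ℚᵘ.mkℚᵘ (+ n) 0         ≈⟨ ℚᵘ.≃-sym (ℚᵘ.+-cong (toℚᵘ-ι m) (toℚᵘ-ι n)) ⟩
    ℚ.toℚᵘ (ι m) ℚᵘ.+ ℚ.toℚᵘ (ι n)               ≈⟨ ℚᵘ.≃-sym (ℚ.toℚᵘ-homo-+ (ι m) (ι n)) ⟩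
    ℚ.toℚᵘ (ι m + ι n)                           ∎)
    where
    open ℚᵘ.≃-Reasoning
    e : ∀ a b → (a ℤ.+ b) ℤ.* (+ 1 ℤ.* + 1) ≡ (a ℤ.* + 1 ℤ.+ b ℤ.* + 1) ℤ.* + 1
    e = ℤ-Solver.solve-∀

  ι-* : ∀ m n → ι (m ℕ.* n) ≡ ι m * ι n
  ι-* m n = ℚ.toℚᵘ-injective (begin
    ℚ.toℚᵘ (ι (m ℕ.* n))                         ≈⟨ toℚᵘ-ι (m ℕ.* n) ⟩
    ℚᵘ.mkℚᵘ (+ (m ℕ.* n)) 0                      ≈⟨ ℚᵘ.*≡* (cong (ℤ._* + 1) (ℤ.pos-* m n)) ⟩
    ℚᵘ.mkℚᵘ (+ m) 0 ℚᵘ.* ℚᵘ.mkℚᵘ (+ n) 0         ≈⟨ ℚᵘ.≃-sym (ℚᵘ.*-cong (toℚᵘ-ι m) (toℚᵘ-ι n)) ⟩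
    ℚ.toℚᵘ (ι m) ℚᵘ.* ℚ.toℚᵘ (ι n)               ≈⟨ ℚᵘ.≃-sym (ℚ.toℚᵘ-homo-* (ι m) (ι n)) ⟩
    ℚ.toℚᵘ (ι m * ι n)                           ∎)
    where open ℚᵘ.≃-Reasoning

  ι-suc : ∀ n → ι (suc n) ≡ ι n + 1ℚ
  ι-suc n = trans (cong ι (ℕ.+-comm 1 n)) (trans (ι-+ n 1) (cong (λ x → ι n + x) (ι-def 1)))

  ι≥0 : ∀ n → 0ℚ ≤ ι n
  ι≥0 n = subst (0ℚ ≤_) (sym (ι-def n)) (ℚ.nonNegative⁻¹ (+ n / 1) {{ℚ.normalize-nonNeg n 1}})

  ι0* : ∀ c → ι 0 * c ≡ 0ℚ
  ι0* c = trans (cong (_* c) (ι-def 0)) (ℚ.*-zeroˡ c)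

  diff : ∀ {p q} → p ≤ q → 0ℚ ≤ q - p
  diff {p} {q} h = subst (_≤ q - p) (ℚ.+-inverseʳ p) (ℚ.+-monoˡ-≤ (- p) h)

  -- Linear arithmetic: q - p is exhibited as a combination s of nonnegative terms.
  linear : ∀ {p q} s → 0ℚ ≤ s → q - p ≡ s → p ≤ q
  linear {p} {q} s 0≤s eq = subst₂ _≤_ (ℚ.+-identityˡ p) (cancel q p)
    (ℚ.+-monoˡ-≤ p (subst (0ℚ ≤_) (sym eq) 0≤s))
    where
    cancel : ∀ q p → (q - p) + p ≡ q
    cancel = ℚ-solve-∀ ring

  infixl 6 _⊕_
  infixl 7 _⊛_

  _⊕_ : ∀ {p q} → 0ℚ ≤ p → 0ℚ ≤ q → 0ℚ ≤ p + q
  _⊕_ = ℚ.+-mono-≤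

  _⊛_ : ∀ {p q} → 0ℚ ≤ p → 0ℚ ≤ q → 0ℚ ≤ p * q
  _⊛_ {p} {q} 0≤p 0≤q = subst (_≤ p * q) (ℚ.*-zeroˡ q) (ℚ.*-monoʳ-≤-nonNeg q {{ℚ.nonNegative 0≤q}} 0≤p)

  *-monoˡ : ∀ {r p q} → 0ℚ ≤ r → p ≤ q → r * p ≤ r * q
  *-monoˡ {r} 0≤r = ℚ.*-monoˡ-≤-nonNeg r {{ℚ.nonNegative 0≤r}}

  ι-mono : ∀ {m n} → m ℕ.≤ n → ι m ≤ ι n
  ι-mono {m} {n} m≤n = linear (ι (n ℕ.∸ m)) (ι≥0 (n ℕ.∸ m)) (trans
    (cong (_- ι m) (trans (cong ι (sym (ℕ.m+[n∸m]≡n m≤n))) (ι-+ m (n ℕ.∸ m))))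
    (cancel (ι m) (ι (n ℕ.∸ m))))
    where
    cancel : ∀ a b → (a + b) - a ≡ b
    cancel = ℚ-solve-∀ ring

  reciprocal : ℕ → ℚ
  reciprocal x = + 1 / suc x

  reciprocal≥0 : ∀ x → 0ℚ ≤ reciprocal x
  reciprocal≥0 x = ℚ.nonNegative⁻¹ (reciprocal x) {{ℚ.normalize-nonNeg 1 (suc x)}}

  reciprocal-inverse : ∀ x → reciprocal x * ι (suc x) ≡ 1ℚ
  reciprocal-inverse x = ℚ.toℚᵘ-injective (begin
    ℚ.toℚᵘ (reciprocal x * ι (suc x))                     ≈⟨ ℚ.toℚᵘ-homo-* (reciprocal x) (ι (suc x)) ⟩
    ℚ.toℚᵘ (reciprocal x) ℚᵘ.* ℚ.toℚᵘ (ι (suc x))         ≈⟨ ℚᵘ.*-cong (ℚ.toℚᵘ-fromℚᵘ (ℚᵘ.mkℚᵘ (+ 1) x)) (toℚᵘ-ι (suc x)) ⟩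
    ℚᵘ.mkℚᵘ (+ 1) x ℚᵘ.* ℚᵘ.mkℚᵘ (+ suc x) 0              ≈⟨ ℚᵘ.*≡* (cong +_ (e x)) ⟩
    ℚᵘ.mkℚᵘ (+ 1) 0                                       ∎)
    where
    open ℚᵘ.≃-Reasoning
    e : ∀ x → (suc x ℕ.+ 0) ℕ.* 1 ≡ 1 ℕ.* (suc x ℕ.* 1)
    e = solve-∀

  reciprocal-≤ : ∀ {x c} → 1ℚ ≤ c * ι (suc x) → reciprocal x ≤ c
  reciprocal-≤ {x} {c} h = linear (reciprocal x * (c * ι (suc x) - 1ℚ)) (reciprocal≥0 x ⊛ diff h)
    (trans (cong (_- reciprocal x) (trans (sym (ℚ.*-identityʳ c)) (cong (c *_) (sym (reciprocal-inverse x)))))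
           (e (reciprocal x) (ι (suc x)) c))
    where
    e : ∀ r y c → c * (r * y) - r ≡ r * (c * y - 1ℚ)
    e = ℚ-solve-∀ ring

  reciprocal-≥ : ∀ {x c} → c * ι (suc x) ≤ 1ℚ → c ≤ reciprocal x
  reciprocal-≥ {x} {c} h = linear (reciprocal x * (1ℚ - c * ι (suc x))) (reciprocal≥0 x ⊛ diff h)
    (trans (cong (λ a → reciprocal x - a) (trans (sym (ℚ.*-identityʳ c)) (cong (c *_) (sym (reciprocal-inverse x)))))
           (e (reciprocal x) (ι (suc x)) c))
    where
    e : ∀ r y c → r - c * (r * y) ≡ r * (1ℚ - c * y)
    e = ℚ-solve-∀ ring

  -- Increments of the logarithm

  recipSum-+ : ∀ a L L′ → recipSum a (L ℕ.+ L′) ≡ recipSum a L + recipSum (a ℕ.+ L) L′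
  recipSum-+ a L zero     = trans (cong (recipSum a) (ℕ.+-identityʳ L)) (sym (ℚ.+-identityʳ _))
  recipSum-+ a L (suc L′) = trans (cong (recipSum a) (ℕ.+-suc L L′))
    (trans (cong₂ _+_ (recipSum-+ a L L′) (cong reciprocal (sym (ℕ.+-assoc a L L′)))) (ℚ.+-assoc (recipSum a L) _ _))

  recipSum-≤ : ∀ a L c → (∀ j → j ℕ.< L → reciprocal (a ℕ.+ j) ≤ c) → recipSum a L ≤ ι L * c
  recipSum-≤ a zero    c h = ℚ.≤-reflexive (sym (ι0* c))
  recipSum-≤ a (suc L) c h = subst (recipSum a (suc L) ≤_) (trans (e (ι L) c) (cong (_* c) (sym (ι-suc L))))
    (ℚ.+-mono-≤ (recipSum-≤ a L c λ j j<L → h j (ℕ.m<n⇒m<1+n j<L)) (h L ℕ.≤-refl))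
    where
    e : ∀ x c → x * c + c ≡ (x + 1ℚ) * c
    e = ℚ-solve-∀ ring

  recipSum-≥ : ∀ a L c → (∀ j → j ℕ.< L → c ≤ reciprocal (a ℕ.+ j)) → ι L * c ≤ recipSum a L
  recipSum-≥ a zero    c h = ℚ.≤-reflexive (ι0* c)
  recipSum-≥ a (suc L) c h = subst (_≤ recipSum a (suc L)) (trans (e (ι L) c) (cong (_* c) (sym (ι-suc L))))
    (ℚ.+-mono-≤ (recipSum-≥ a L c λ j j<L → h j (ℕ.m<n⇒m<1+n j<L)) (h L ℕ.≤-refl))
    where
    e : ∀ x c → x * c + c ≡ (x + 1ℚ) * c
    e = ℚ-solve-∀ ring

  -- The new part of the Riemann sum consists of N + 1 terms, each at most 1/((j+1)(N+1)).
  log-suc : ∀ j N → logApprox (2 ℕ.+ j) N ≡ logApprox (suc j) N + recipSum (suc j ℕ.* suc N) (suc N)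
  log-suc j N = trans (cong (recipSum (suc N)) (ℕ.+-comm (suc N) (j ℕ.* suc N)))
    (recipSum-+ (suc N) (j ℕ.* suc N) (suc N))

  block : ∀ j N → ι (suc N) * (reciprocal j * reciprocal N) ≡ reciprocal j
  block j N = trans (e (ι (suc N)) (reciprocal j) (reciprocal N))
    (trans (cong (reciprocal j *_) (reciprocal-inverse N)) (ℚ.*-identityʳ _))
    where
    e : ∀ n a b → n * (a * b) ≡ a * (b * n)
    e = ℚ-solve-∀ ring

  reciprocal-product : ∀ j N → (reciprocal j * reciprocal N) * ι (suc j ℕ.* suc N) ≡ 1ℚ
  reciprocal-product j N = trans (cong ((reciprocal j * reciprocal N) *_) (ι-* (suc j) (suc N)))
    (trans (e (reciprocal j) (reciprocal N) (ι (suc j)) (ι (suc N)))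
    (trans (cong₂ _*_ (reciprocal-inverse j) (reciprocal-inverse N)) refl))
    where
    e : ∀ a b c d → (a * b) * (c * d) ≡ (a * c) * (b * d)
    e = ℚ-solve-∀ ring

  log-suc-≤ : ∀ j N → logApprox (2 ℕ.+ j) N ≤ logApprox (suc j) N + reciprocal j
  log-suc-≤ j N = subst (_≤ logApprox (suc j) N + reciprocal j) (sym (log-suc j N))
    (ℚ.+-monoʳ-≤ (logApprox (suc j) N) (subst (recipSum (suc j ℕ.* suc N) (suc N) ≤_) (block j N)
      (recipSum-≤ (suc j ℕ.* suc N) (suc N) _ λ i i≤N → reciprocal-≤ {suc j ℕ.* suc N ℕ.+ i} (subst (_≤ c * ι (suc (suc j ℕ.* suc N ℕ.+ i)))
        (reciprocal-product j N) (*-monoˡ (reciprocal≥0 j ⊛ reciprocal≥0 N) (ι-mono (ℕ.m≤n⇒m≤1+n (ℕ.m≤m+n (suc j ℕ.* suc N) i))))))))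
    where c = reciprocal j * reciprocal N

  log-suc-≥ : ∀ j N → logApprox (suc j) N + reciprocal (suc j) ≤ logApprox (2 ℕ.+ j) N
  log-suc-≥ j N = subst (logApprox (suc j) N + reciprocal (suc j) ≤_) (sym (log-suc j N))
    (ℚ.+-monoʳ-≤ (logApprox (suc j) N) (subst (_≤ recipSum (suc j ℕ.* suc N) (suc N)) (block (suc j) N)
      (recipSum-≥ (suc j ℕ.* suc N) (suc N) c λ i i≤N → reciprocal-≥ {suc j ℕ.* suc N ℕ.+ i} (subst (c * ι (suc (suc j ℕ.* suc N ℕ.+ i)) ≤_)
        (reciprocal-product (suc j) N) (*-monoˡ (reciprocal≥0 (suc j) ⊛ reciprocal≥0 N) (ι-mono (last i i≤N)))))))
    where
    c = reciprocal (suc j) * reciprocal N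
    last : ∀ i → i ℕ.< suc N → suc (suc j ℕ.* suc N ℕ.+ i) ℕ.≤ suc (suc j) ℕ.* suc N
    last i i≤N = ℕ.≤-trans (ℕ.≤-reflexive (sym (ℕ.+-suc (suc j ℕ.* suc N) i)))
      (ℕ.≤-trans (ℕ.+-monoʳ-≤ (suc j ℕ.* suc N) i≤N) (ℕ.≤-reflexive (ℕ.+-comm (suc j ℕ.* suc N) (suc N))))

  log-≤-suc : ∀ m N → logApprox m N ≤ logApprox (suc m) N
  log-≤-suc zero    N = ℚ.≤-refl
  log-≤-suc (suc j) N = ℚ.≤-trans (ℚ.≤-trans (ℚ.≤-reflexive (sym (ℚ.+-identityʳ _)))
    (ℚ.+-monoʳ-≤ (logApprox (suc j) N) (reciprocal≥0 (suc j)))) (log-suc-≥ j N)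

  log-mono : ∀ {m n} N → m ℕ.≤ n → logApprox m N ≤ logApprox n N
  log-mono {m} {n} N m≤n = subst (λ x → logApprox m N ≤ logApprox x N) (ℕ.m∸n+n≡m m≤n) (go (n ℕ.∸ m))
    where
    go : ∀ d → logApprox m N ≤ logApprox (d ℕ.+ m) N
    go zero    = ℚ.≤-refl
    go (suc d) = ℚ.≤-trans (go d) (log-≤-suc (d ℕ.+ m) N)

  log≥0 : ∀ m N → 0ℚ ≤ logApprox m N
  log≥0 m N = log-mono {0} {m} N z≤n

  log-step-≤ : ∀ m N → ι m * logApprox (suc m) N ≤ ι m * logApprox m N + 1ℚ
  log-step-≤ zero    N = subst₂ _≤_ (sym (ι0* (logApprox 1 N))) (sym (cong (_+ 1ℚ) (ι0* (logApprox 0 N)))) (ℚ.nonNegative⁻¹ 1ℚ)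
  log-step-≤ (suc j) N = subst (ι (suc j) * logApprox (2 ℕ.+ j) N ≤_)
    (trans (ℚ.*-distribˡ-+ (ι (suc j)) _ _) (cong (λ x → ι (suc j) * logApprox (suc j) N + x)
      (trans (ℚ.*-comm (ι (suc j)) _) (reciprocal-inverse j))))
    (*-monoˡ (ι≥0 (suc j)) (log-suc-≤ j N))

  log-step-≥ : ∀ j N → ι (2 ℕ.+ j) * logApprox (suc j) N + 1ℚ ≤ ι (2 ℕ.+ j) * logApprox (2 ℕ.+ j) N
  log-step-≥ j N = subst (_≤ ι (2 ℕ.+ j) * logApprox (2 ℕ.+ j) N)
    (trans (ℚ.*-distribˡ-+ (ι (2 ℕ.+ j)) _ _) (cong (λ x → ι (2 ℕ.+ j) * logApprox (suc j) N + x)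
      (trans (ℚ.*-comm (ι (2 ℕ.+ j)) _) (reciprocal-inverse (suc j)))))
    (*-monoˡ (ι≥0 (2 ℕ.+ j)) (log-suc-≥ j N))

  -- Summation by parts

  logFact : ℕ → ℕ → ℚ
  logFact zero    N = 0ℚ
  logFact (suc m) N = logFact m N + logApprox (suc m) N

  -- The logarithm of the hyperfactorial, the product of j^j over j ≤ m.
  logHyper : ℕ → ℕ → ℚ
  logHyper zero    N = 0ℚ
  logHyper (suc m) N = logHyper m N + ι (suc m) * logApprox (suc m) N

  2ℚ 3ℚ 4ℚ 5ℚ : ℚ
  3ℚ = + 3 / 1
  2ℚ = + 2 / 1
  4ℚ = + 4 / 1
  5ℚ = + 5 / 1

  -- In one step m log m grows by at most 1 + log (m + 1).
  logFact-≥ : ∀ m N → ι m * logApprox m N ≤ logFact m N + ι m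
  logFact-≥ zero    N = subst (λ z → z * 0ℚ ≤ 0ℚ + z) (sym (ι-def 0)) ℚ.≤-refl
  logFact-≥ (suc m) N = linear _
    (diff (log-step-≤ m N) ⊕ diff (logFact-≥ m N))
    (trans (cong (λ y → (logFact (suc m) N + y) - y * logApprox (suc m) N) (ι-suc m))
      (e (ι m) (logApprox m N) (logApprox (suc m) N) (logFact m N)))
    where
    e : ∀ x l l′ f → (f + l′ + (x + 1ℚ)) - (x + 1ℚ) * l′ ≡ ((x * l + 1ℚ) - x * l′) + ((f + x) - x * l)
    e = ℚ-solve-∀ ring

  logFact-≤ : ∀ m N → logFact m N + ι m ≤ ι m * logApprox m N + logApprox m N + 1ℚ
  logFact-≤ zero          N = subst (λ z → 0ℚ + z ≤ z * 0ℚ + 0ℚ + 1ℚ) (sym (ι-def 0)) (ℚ.nonNegative⁻¹ 1ℚ)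
  logFact-≤ (suc zero)    N = subst (λ z → 0ℚ + 0ℚ + z ≤ z * 0ℚ + 0ℚ + 1ℚ) (sym (ι-def 1)) ℚ.≤-refl
  logFact-≤ (suc (suc m)) N = linear _ (diff (log-step-≥ m N) ⊕ diff (logFact-≤ (suc m) N))
    (e′ (ι (suc m)) (ι-suc (suc m)) (logApprox (suc m) N) (logApprox (2 ℕ.+ m) N) (logFact (suc m) N))
    where
    e′ : ∀ x {y} → y ≡ x + 1ℚ → ∀ l l′ f → (y * l′ + l′ + 1ℚ) - (f + l′ + y)
         ≡ (y * l′ - (y * l + 1ℚ)) + ((x * l + l + 1ℚ) - (f + x))
    e′ x refl = e x
      where
      e : ∀ x l l′ f → ((x + 1ℚ) * l′ + l′ + 1ℚ) - (f + l′ + (x + 1ℚ))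
          ≡ ((x + 1ℚ) * l′ - ((x + 1ℚ) * l + 1ℚ)) + ((x * l + l + 1ℚ) - (f + x))
      e = ℚ-solve-∀ ring

  -- The discrete form of ∫ x log x dx = (1/2) x² log x - (1/4) x², multiplied by 4.
  logHyper-≥ : ∀ m N → 2ℚ * (ι m * ι m) * logApprox m N ≤ 4ℚ * logHyper m N + ι m * ι m
  logHyper-≥ zero    N = subst (λ z → 2ℚ * (z * z) * 0ℚ ≤ 4ℚ * 0ℚ + z * z) (sym (ι-def 0)) ℚ.≤-refl
  logHyper-≥ (suc m) N = linear _
    (diff (*-monoˡ (ℚ.nonNegative⁻¹ 2ℚ ⊛ ι≥0 m) (log-step-≤ m N)) ⊕ diff (logHyper-≥ m N)
      ⊕ (ℚ.nonNegative⁻¹ 2ℚ ⊛ log≥0 (suc m) N ⊕ ℚ.nonNegative⁻¹ 1ℚ))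
    (trans (cong (λ y → (4ℚ * (logHyper m N + y * logApprox (suc m) N) + y * y) - 2ℚ * (y * y) * logApprox (suc m) N) (ι-suc m))
      (e (ι m) (logApprox m N) (logApprox (suc m) N) (logHyper m N)))
    where
    e : ∀ x l l′ s → (4ℚ * (s + (x + 1ℚ) * l′) + (x + 1ℚ) * (x + 1ℚ)) - 2ℚ * ((x + 1ℚ) * (x + 1ℚ)) * l′
        ≡ ((2ℚ * x) * (x * l + 1ℚ) - (2ℚ * x) * (x * l′)) + ((4ℚ * s + x * x) - 2ℚ * (x * x) * l) + (2ℚ * l′ + 1ℚ)
    e = ℚ-solve-∀ ring

  logHyper-≤ : ∀ m N → 4ℚ * logHyper m N + ι m * ι m
               ≤ 2ℚ * (ι m * ι m) * logApprox m N + 4ℚ * ι m + 4ℚ * (ι m * logApprox m N)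
  logHyper-≤ zero          N = subst (λ z → 4ℚ * 0ℚ + z * z ≤ 2ℚ * (z * z) * 0ℚ + 4ℚ * z + 4ℚ * (z * 0ℚ)) (sym (ι-def 0)) ℚ.≤-refl
  logHyper-≤ (suc zero)    N = subst (λ z → 4ℚ * (0ℚ + z * 0ℚ) + z * z ≤ 2ℚ * (z * z) * 0ℚ + 4ℚ * z + 4ℚ * (z * 0ℚ)) (sym (ι-def 1))
    (linear 3ℚ (ℚ.nonNegative⁻¹ 3ℚ) refl)
  logHyper-≤ (suc (suc m)) N = linear _
    (diff (*-monoˡ (ℚ.nonNegative⁻¹ 2ℚ ⊛ ι≥0 (2 ℕ.+ m)) (log-step-≥ m N)) ⊕ diff (logHyper-≤ (suc m) N)
      ⊕ (ℚ.nonNegative⁻¹ 2ℚ ⊛ log≥0 (suc m) N ⊕ ℚ.nonNegative⁻¹ (5ℚ)))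
    (e′ (ι (suc m)) (ι-suc (suc m)) (logApprox (suc m) N) (logApprox (2 ℕ.+ m) N) (logHyper (suc m) N))
    where
    e′ : ∀ x {y} → y ≡ x + 1ℚ → ∀ l l′ s → (2ℚ * (y * y) * l′ + 4ℚ * y + 4ℚ * (y * l′)) - (4ℚ * (s + y * l′) + y * y)
         ≡ ((2ℚ * y) * (y * l′) - (2ℚ * y) * (y * l + 1ℚ))
           + ((2ℚ * (x * x) * l + 4ℚ * x + 4ℚ * (x * l)) - (4ℚ * s + x * x)) + (2ℚ * l + 5ℚ)
    e′ x refl = e x
      where
      e : ∀ x l l′ s → (2ℚ * ((x + 1ℚ) * (x + 1ℚ)) * l′ + 4ℚ * (x + 1ℚ) + 4ℚ * ((x + 1ℚ) * l′))
            - (4ℚ * (s + (x + 1ℚ) * l′) + (x + 1ℚ) * (x + 1ℚ))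
          ≡ ((2ℚ * (x + 1ℚ)) * ((x + 1ℚ) * l′) - (2ℚ * (x + 1ℚ)) * ((x + 1ℚ) * l + 1ℚ))
            + ((2ℚ * (x * x) * l + 4ℚ * x + 4ℚ * (x * l)) - (4ℚ * s + x * x)) + (2ℚ * l + 5ℚ)
      e = ℚ-solve-∀ ring

  -- log (oddProduct K (x - K)) with each odd factor 2j - 1 replaced by 2j.
  oddSum : ℚ → ℕ → ℕ → ℚ
  oddSum x zero    N = 0ℚ
  oddSum x (suc K) N = oddSum x K N + (x - ι (suc K)) * (logApprox 2 N + logApprox (suc K) N)

  -- The terms are (x - j)(log 2 + log j) for 1 ≤ j ≤ K; expanding the product separates `logFact`
  -- from `logHyper`.
  oddSum-closed : ∀ x K N → 2ℚ * oddSum x K N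
    ≡ (2ℚ * x * ι K - ι K * (ι K + 1ℚ)) * logApprox 2 N + 2ℚ * x * logFact K N - 2ℚ * logHyper K N
  oddSum-closed x zero    N = trans (e x (logApprox 2 N)) (cong (λ z → (2ℚ * x * z - z * (z + 1ℚ)) * logApprox 2 N + 2ℚ * x * 0ℚ - 2ℚ * 0ℚ)
      (sym (ι-def 0)))
    where
    e : ∀ x t → 2ℚ * 0ℚ ≡ (2ℚ * x * 0ℚ - 0ℚ * (0ℚ + 1ℚ)) * t + 2ℚ * x * 0ℚ - 2ℚ * 0ℚ
    e = ℚ-solve-∀ ring
  oddSum-closed x (suc K) N = trans
    (ℚ.*-distribˡ-+ 2ℚ (oddSum x K N) _)
    (trans (cong (λ a → a + 2ℚ * ((x - ι (suc K)) * (logApprox 2 N + logApprox (suc K) N))) (oddSum-closed x K N))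
           (e′ x (ι K) (ι-suc K) (logApprox 2 N) (logApprox (suc K) N) (logFact K N) (logHyper K N)))
    where
    e′ : ∀ x y {z} → z ≡ y + 1ℚ → ∀ t l f s →
      (2ℚ * x * y - y * (y + 1ℚ)) * t + 2ℚ * x * f - 2ℚ * s + 2ℚ * ((x - z) * (t + l))
        ≡ (2ℚ * x * z - z * (z + 1ℚ)) * t + 2ℚ * x * (f + l) - 2ℚ * (s + z * l)
    e′ x y refl = e x y
      where
      e : ∀ x y t l f s → (2ℚ * x * y - y * (y + 1ℚ)) * t + 2ℚ * x * f - 2ℚ * s + 2ℚ * ((x - (y + 1ℚ)) * (t + l))
          ≡ (2ℚ * x * (y + 1ℚ) - (y + 1ℚ) * (y + 1ℚ + 1ℚ)) * t + 2ℚ * x * (f + l) - 2ℚ * (s + (y + 1ℚ) * l)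
      e = ℚ-solve-∀ ring

  -- Asymptotic comparison and the functional equation of log

  infix 4 _≲_ _≈_

  -- The comparison `_≤ᴿ_` for bare sequences, so that intermediate expressions need no proof of the
  -- Cauchy property.
  record _≲_ (x y : ℕ → ℚ) : Set where
    constructor eventually
    field
      within : ∀ ε → 0ℚ < ε → ∃[ N ] (∀ n → N ℕ.≤ n → x n ≤ y n + ε)

  open _≲_

  _≈_ : (ℕ → ℚ) → (ℕ → ℚ) → Set
  x ≈ y = x ≲ y × y ≲ x

  halve : ∀ {ε} → 0ℚ < ε → 0ℚ < ℚ.½ * ε
  halve {ε} 0<ε = ℚ.positive⁻¹ (ℚ.½ * ε) {{ℚ.pos*pos⇒pos ℚ.½ ε {{ℚ.positive 0<ε}}}}

  ≤⇒≲ : ∀ {x y} → (∀ n → x n ≤ y n) → x ≲ y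
  ≤⇒≲ {x} {y} h = eventually λ ε 0<ε → 0 , λ n _ → ℚ.≤-trans (h n)
    (subst (_≤ y n + ε) (ℚ.+-identityʳ (y n)) (ℚ.+-monoʳ-≤ (y n) (ℚ.<⇒≤ 0<ε)))

  ≲-+ : ∀ {x y u v} → x ≲ y → u ≲ v → (λ n → x n + u n) ≲ (λ n → y n + v n)
  ≲-+ {x} {y} {u} {v} h k = eventually λ ε 0<ε →
    let N , h′ = within h (ℚ.½ * ε) (halve 0<ε)
        N′ , k′ = within k (ℚ.½ * ε) (halve 0<ε)
    in N ℕ.⊔ N′ , λ n le → subst (x n + u n ≤_) (e (y n) (v n) ε)
         (ℚ.+-mono-≤ (h′ n (ℕ.m⊔n≤o⇒m≤o N N′ le)) (k′ n (ℕ.m⊔n≤o⇒n≤o N N′ le)))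
    where
    e₀ : ∀ y v h ε → (y + h * ε) + (v + h * ε) ≡ y + v + (h + h) * ε
    e₀ = ℚ-solve-∀ ring
    e : ∀ y v ε → (y + ℚ.½ * ε) + (v + ℚ.½ * ε) ≡ y + v + ε
    e y v ε = trans (e₀ y v ℚ.½ ε) (cong (λ a → y + v + a) (ℚ.*-identityˡ ε))

  -- All ε are confined to one hypothesis; what remains is pointwise, and `linear` reduces it to a
  -- ring identity.
  ≲-linear : ∀ {x y X Y} → x ≲ y → (∀ n → X n + y n ≤ Y n + x n) → X ≲ Y
  ≲-linear {x} {y} {X} {Y} h k = eventually λ ε 0<ε → let N , h′ = within h ε 0<ε in
    N , λ n le → linear _ (diff (h′ n le) ⊕ diff (k n)) (e (x n) (y n) (X n) (Y n) ε)
    where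
    e : ∀ x y X Y ε → (Y + ε) - X ≡ ((y + ε) - x) + ((Y + x) - (X + y))
    e = ℚ-solve-∀ ring

  ≲-trans : ∀ {x y z} → x ≲ y → y ≲ z → x ≲ z
  ≲-trans {x} {y} {z} h k = ≲-linear {λ n → x n + y n} {λ n → y n + z n} {x} {z} (≲-+ {x} {y} {y} {z} h k)
    λ n → ℚ.≤-reflexive (e (x n) (y n) (z n))
    where
    e : ∀ x y z → x + (y + z) ≡ z + (x + y)
    e = ℚ-solve-∀ ring

  ≲-scale : ∀ {q x y} → 0ℚ ≤ q → x ≲ y → (λ n → q * x n) ≲ (λ n → q * y n)
  ≲-scale {q} {x} {y} 0≤q h = eventually λ ε 0<ε →
    let N , h′ = within h (1/K * ε) (ℚ.positive⁻¹ (1/K * ε) {{ℚ.pos*pos⇒pos 1/K {{ℚ.1/pos⇒pos K}} ε {{ℚ.positive 0<ε}}}})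
    in N , λ n le → linear _ (0≤q ⊛ diff (h′ n le) ⊕ (ℚ.<⇒≤ (ℚ.positive⁻¹ 1/K {{ℚ.1/pos⇒pos K}}) ⊛ ℚ.<⇒≤ 0<ε))
         (trans (cong (λ a → (q * y n + a) - q * x n) (trans (sym (ℚ.*-identityˡ ε)) (cong (_* ε) (sym (ℚ.*-inverseʳ K)))))
                (e q (x n) (y n) 1/K ε))
    where
    -- ε is divided by q + 1, since q may be 0.
    K = q + 1ℚ
    instance
      K⁺ : ℚ.Positive K
      K⁺ = ℚ.nonNeg+pos⇒pos q {{ℚ.nonNegative 0≤q}} 1ℚ
      K≢0 : ℚ.NonZero K
      K≢0 = ℚ.pos⇒nonZero K
    1/K = ℚ.1/ K
    e : ∀ q x y r ε → (q * y + ((q + 1ℚ) * r) * ε) - q * x ≡ q * ((y + r * ε) - x) + r * ε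
    e = ℚ-solve-∀ ring

  ≲-refl : ∀ {x} → x ≲ x
  ≲-refl {x} = ≤⇒≲ {x} {x} λ n → ℚ.≤-refl

  p≤∣p∣ : ∀ p → p ≤ ℚ.∣ p ∣
  p≤∣p∣ p with ℚ.∣p∣≡p∨∣p∣≡-p p
  ... | inj₁ eq = ℚ.≤-reflexive (sym eq)
  ... | inj₂ eq = linear (ℚ.∣ p ∣ + ℚ.∣ p ∣) (ℚ.0≤∣p∣ p ⊕ ℚ.0≤∣p∣ p)
    (cong (λ a → ℚ.∣ p ∣ + a) (sym eq))

  -- Substituting t ↦ at in the second part of the integral over [1, ab] = [1, a] ∪ [a, ab] gives
  -- exactly the Riemann sum of log b for another mesh.
  log-*-mesh : ∀ a b N → logApprox (suc a ℕ.* suc b) N ≡ logApprox (suc a) N + logApprox (suc b) (N ℕ.+ a ℕ.* suc N)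
  log-*-mesh a b N = trans (cong (recipSum (suc N)) (e a b N))
    (recipSum-+ (suc N) (a ℕ.* suc N) (b ℕ.* (suc N ℕ.+ a ℕ.* suc N)))
    where
    e : ∀ a b N → (b ℕ.+ a ℕ.* suc b) ℕ.* suc N ≡ a ℕ.* suc N ℕ.+ b ℕ.* (suc N ℕ.+ a ℕ.* suc N)
    e = solve-∀

  -- The two meshes give Riemann sums of the same logarithm, and the Cauchy property bounds their
  -- difference.
  log-* : ∀ a b → logApprox (suc a ℕ.* suc b) ≈ (λ N → logApprox (suc a) N + logApprox (suc b) N)
  log-* a b = eventually (λ ε 0<ε → let N₀ , h = cauchy (log (suc b)) ε 0<ε in N₀ , λ N le →
        let N′ = N ℕ.+ a ℕ.* suc N
            h′ = ℚ.≤-trans (p≤∣p∣ (B N′ - B N)) (h N′ N (ℕ.≤-trans le (ℕ.m≤m+n N _)) le)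
        in linear _ (diff h′) (trans (cong (λ x → A N + B N + ε - x) (log-*-mesh a b N)) (e₁ (A N) (B N) (B N′) ε)))
    , eventually λ ε 0<ε → let N₀ , h = cauchy (log (suc b)) ε 0<ε in N₀ , λ N le →
        let N′ = N ℕ.+ a ℕ.* suc N
            h′ = ℚ.≤-trans (p≤∣p∣ (B N - B N′)) (h N N′ le (ℕ.≤-trans le (ℕ.m≤m+n N _)))
        in linear _ (diff h′) (trans (cong (λ x → x + ε - (A N + B N)) (log-*-mesh a b N)) (e₂ (A N) (B N) (B N′) ε))
    where
    A B : ℕ → ℚ
    A = logApprox (suc a)
    B = logApprox (suc b)
    e₁ : ∀ a b b′ ε → (a + b + ε) - (a + b′) ≡ ε - (b′ - b)
    e₁ = ℚ-solve-∀ ring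
    e₂ : ∀ a b b′ ε → (a + b′ + ε) - (a + b) ≡ ε - (b - b′)
    e₂ = ℚ-solve-∀ ring

  log-*′ : ∀ m n → .{{ℕ.NonZero m}} → .{{ℕ.NonZero n}} → logApprox (m ℕ.* n) ≈ (λ N → logApprox m N + logApprox n N)
  log-*′ (suc a) (suc b) = log-* a b

  ≈-trans-+ : ∀ {x y z w v : ℕ → ℚ} → x ≈ (λ n → y n + z n) → z ≈ w → (∀ n → y n + w n ≡ v n) → x ≈ v
  ≈-trans-+ {x} {y} {z} {w} {v} (h , h′) (k , k′) eq =
      ≲-linear {λ n → x n + z n} {λ n → (y n + z n) + w n} {x} {v} (≲-+ {x} {λ n → y n + z n} {z} {w} h k)
        (λ n → ℚ.≤-reflexive (trans (e (x n) (y n) (z n) (w n)) (cong (_+ (x n + z n)) (eq n))))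
    , ≲-linear {λ n → (y n + z n) + w n} {λ n → x n + z n} {v} {x} (≲-+ {λ n → y n + z n} {x} {w} {z} h′ k′)
        (λ n → ℚ.≤-reflexive (trans (cong (_+ (x n + z n)) (sym (eq n))) (e′ (x n) (y n) (z n) (w n))))
    where
    e : ∀ x y z w → x + ((y + z) + w) ≡ (y + w) + (x + z)
    e = ℚ-solve-∀ ring
    e′ : ∀ x y z w → (y + w) + (x + z) ≡ x + ((y + z) + w)
    e′ = ℚ-solve-∀ ring

  log-^ : ∀ a e → logApprox (suc a ℕ.^ e) ≈ (λ N → ι e * logApprox (suc a) N)
  log-^ a zero    = ≤⇒≲ (λ N → ℚ.≤-reflexive (sym (ι0* (logApprox (suc a) N))))
                  , ≤⇒≲ (λ N → ℚ.≤-reflexive (ι0* (logApprox (suc a) N)))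
  log-^ a (suc e) = ≈-trans-+ {y = logApprox (suc a)} (log-*′ (suc a) (suc a ℕ.^ e) {{_}} {{ℕ.m^n≢0 (suc a) e}}) (log-^ a e)
    λ N → trans (eq (logApprox (suc a) N) (ι e)) (cong (_* logApprox (suc a) N) (sym (ι-suc e)))
    where
    eq : ∀ l x → l + x * l ≡ (x + 1ℚ) * l
    eq = ℚ-solve-∀ ring

  log-! : ∀ n → logApprox (n ℕ.!) ≈ logFact n
  log-! zero    = ≤⇒≲ (λ N → ℚ.≤-refl) , ≤⇒≲ (λ N → ℚ.≤-refl)
  log-! (suc n) = ≈-trans-+ {y = logApprox (suc n)} (log-*′ (suc n) (n ℕ.!) {{_}} {{n ℕ.!≢0}}) (log-! n)
    λ N → ℚ.+-comm (logApprox (suc n) N) (logFact n N)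

  -- Odd factors are rounded to even ones, which split as 2 times an integer: here 2K + 1 goes up to
  -- 2(K + 1), and in the next bound 2K + 3 goes down to it.
  log-hook-≤ : ∀ K → logApprox (hook K) ≲ (λ N → logApprox 2 N + logApprox (suc K) N)
  log-hook-≤ K = ≲-trans {logApprox (hook K)} {logApprox (2 ℕ.* suc K)}
    (≤⇒≲ λ N → log-mono {hook K} {2 ℕ.* suc K} N (ℕ.≤-trans (ℕ.n≤1+n _) (ℕ.≤-reflexive (e K)))) (proj₁ (log-* 1 K))
    where
    e : ∀ K → suc (suc (2 ℕ.* K)) ≡ 2 ℕ.* suc K
    e = solve-∀

  log-hook-≥ : ∀ K → (λ N → logApprox 2 N + logApprox (suc K) N) ≲ logApprox (hook (suc K))
  log-hook-≥ K = ≲-trans {y = logApprox (2 ℕ.* suc K)} {z = logApprox (hook (suc K))} (proj₂ (log-* 1 K)) (≤⇒≲ λ N → log-mono {2 ℕ.* suc K} {hook (suc K)} N (ℕ.n≤1+n _))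

  oddProduct≢0 : ∀ K e → ℕ.NonZero (oddProduct K e)
  oddProduct≢0 zero    e = _
  oddProduct≢0 (suc K) e = ℕ.m*n≢0 (oddProduct K (suc e)) (hook K ℕ.^ e) {{oddProduct≢0 K (suc e)}} {{ℕ.m^n≢0 (hook K) e}}

  log-oddProduct-suc : ∀ K e → logApprox (oddProduct (suc K) e) ≈
    (λ N → logApprox (oddProduct K (suc e)) N + ι e * logApprox (hook K) N)
  log-oddProduct-suc K e = ≈-trans-+ {y = logApprox (oddProduct K (suc e))}
    (log-*′ (oddProduct K (suc e)) (hook K ℕ.^ e) {{oddProduct≢0 K (suc e)}} {{ℕ.m^n≢0 (hook K) e}})
    (log-^ (2 ℕ.* K) e) (λ N → refl)

  exponent : ∀ K e → ι (suc e ℕ.+ K) - ι (suc K) ≡ ι e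
  exponent K e = trans (cong (λ n → ι n - ι (suc K)) (sym (ℕ.+-suc e K)))
    (trans (cong (_- ι (suc K)) (ι-+ e (suc K))) (cancel (ι e) (ι (suc K))))
    where
    cancel : ∀ a b → (a + b) - b ≡ a
    cancel = ℚ-solve-∀ ring

  log-oddProduct-≤ : ∀ K e → logApprox (oddProduct K e) ≲ oddSum (ι (e ℕ.+ K)) K
  log-oddProduct-≤ zero    e = ≤⇒≲ λ N → ℚ.≤-refl
  log-oddProduct-≤ (suc K) e = ≲-trans {logApprox (oddProduct (suc K) e)} {z = oddSum (ι (e ℕ.+ suc K)) (suc K)}
    (proj₁ (log-oddProduct-suc K e))
    (subst (λ x → (λ N → logApprox (oddProduct K (suc e)) N + ι e * logApprox (hook K) N) ≲ oddSum (ι x) (suc K)) (sym (ℕ.+-suc e K))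
      (≲-trans {z = oddSum (ι (suc e ℕ.+ K)) (suc K)} (≲-+ {logApprox (oddProduct K (suc e))} {u = λ N → ι e * logApprox (hook K) N}
          (log-oddProduct-≤ K (suc e)) (≲-scale {ι e} {logApprox (hook K)} (ι≥0 e) (log-hook-≤ K)))
        (≤⇒≲ λ N → ℚ.≤-reflexive (cong (λ x → oddSum (ι (suc e ℕ.+ K)) K N + x * (logApprox 2 N + logApprox (suc K) N)) (sym (exponent K e))))))

  -- The factor with s = 0 is 1 and drops out, and 2j + 1 is rounded down to 2j; hence the shift of
  -- K against the upper bound.
  log-oddProduct-≥ : ∀ K e → oddSum (ι (e ℕ.+ K)) K ≲ logApprox (oddProduct (suc K) e)
  log-oddProduct-≥ zero    e = ≤⇒≲ {oddSum (ι (e ℕ.+ 0)) 0} {logApprox (oddProduct 1 e)} λ N → log≥0 (oddProduct 1 e) N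
  log-oddProduct-≥ (suc K) e = ≲-trans {oddSum (ι (e ℕ.+ suc K)) (suc K)} {z = logApprox (oddProduct (2 ℕ.+ K) e)}
    (subst (λ x → oddSum (ι x) (suc K) ≲ (λ N → logApprox (oddProduct (suc K) (suc e)) N + ι e * logApprox (hook (suc K)) N)) (sym (ℕ.+-suc e K))
      (≲-trans {oddSum (ι (suc e ℕ.+ K)) (suc K)}
        (≤⇒≲ λ N → ℚ.≤-reflexive (cong (λ x → oddSum (ι (suc e ℕ.+ K)) K N + x * (logApprox 2 N + logApprox (suc K) N)) (exponent K e)))
        (≲-+ {v = λ N → ι e * logApprox (hook (suc K)) N} (log-oddProduct-≥ K (suc e)) (≲-scale {ι e} {y = logApprox (hook (suc K))} (ι≥0 e) (log-hook-≥ K)))))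
    (proj₂ (log-oddProduct-suc (suc K) e))

  -- Bounds for the logarithm of the number of tableaux

  ¼ 8ℚ : ℚ
  ¼ = + 1 / 4
  8ℚ = + 8 / 1

  half : ∀ {p q} → 2ℚ * p ≡ q → p ≡ ½ * q
  half {p} {q} eq = trans (sym (ℚ.*-identityˡ p)) (trans (ℚ.*-assoc ½ 2ℚ p) (cong (½ *_) eq))

  half-ι : ∀ {m n} → m ℕ.* 2 ≡ n → ι m ≡ ½ * ι n
  half-ι {m} {n} eq = half (trans (cong (_* ι m) (sym (ι-def 2))) (trans (sym (ι-* 2 m)) (cong ι (trans (ℕ.*-comm 2 m) eq))))

  boxes-M : ∀ b → boxes (suc b ℕ.+ b) ≡ suc b ℕ.* (suc b ℕ.+ b)
  boxes-M b = ℕ.*-cancelʳ-≡ _ _ 2 (trans (double-boxes (suc b ℕ.+ b)) (e b))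
    where
    e : ∀ b → (suc b ℕ.+ b) ℕ.* suc (suc b ℕ.+ b) ≡ suc b ℕ.* (suc b ℕ.+ b) ℕ.* 2
    e = solve-∀

  log-2≤1 : ∀ N → logApprox 2 N ≤ 1ℚ
  log-2≤1 N = log-suc-≤ 0 N

  ½≤log-2 : ∀ N → ½ ≤ logApprox 2 N
  ½≤log-2 N = log-suc-≥ 0 N

  -- From 9/8 > 1.
  log-3-≥ : (λ N → 3ℚ * logApprox 2 N + + 1 / 9) ≲ (λ N → 2ℚ * logApprox 3 N)
  log-3-≥ = ≲-trans (≲-+ (subst (λ x → (λ N → x * logApprox 2 N) ≲ logApprox 8) (ι-def 3) (proj₂ (log-^ 1 3))) (≲-refl {λ N → + 1 / 9}))
    (≲-trans (≤⇒≲ (log-suc-≥ 7)) (subst (λ x → logApprox 9 ≲ (λ N → x * logApprox 3 N)) (ι-def 2) (proj₁ (log-^ 2 2))))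

  -- 2m = b(b + 1) for m = boxes b.
  log-boxes-≥ : ∀ b → (λ i → ι (b ℕ.* suc b) * (logApprox b i + logApprox (suc b) i))
                      ≲ (λ i → ι (b ℕ.* suc b) * (logApprox 2 i + logApprox (boxes b) i))
  -- Here log 0 occurs with its default value; the factor b(b + 1) = 0 removes it.
  log-boxes-≥ zero    = ≤⇒≲ λ i → ℚ.≤-reflexive (trans (ι0* _) (sym (ι0* _)))
  log-boxes-≥ (suc b) = ≲-scale (ι≥0 (suc b ℕ.* (2 ℕ.+ b))) (≲-trans (proj₂ (log-* b (suc b)))
    (subst (λ y → logApprox y ≲ (λ i → logApprox 2 i + logApprox (boxes (suc b)) i))
      (trans (ℕ.*-comm 2 (boxes (suc b))) (double-boxes (suc b))) (proj₁ (log-*′ 2 (boxes (suc b))))))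

  module _ (b : ℕ) where
    private
      k M n m N f : ℕ
      k = suc b
      M = suc b ℕ.+ b
      n = size (υ k)
      m = boxes b
      N = boxes M
      f = #SYT (υ k)
      -- The values of b, k, n, m and M.
      β κ ν μ θ : ℚ
      β = ι b
      κ = β + 1ℚ
      ν = ½ * (κ * (3ℚ * β + 2ℚ))
      μ = ½ * (β * κ)
      θ = 2ℚ * β + 1ℚ

      n*2 : n ℕ.* 2 ≡ k ℕ.* (3 ℕ.* b ℕ.+ 2)
      n*2 = trans (cong (ℕ._* 2) (size-υ-boxes b)) (trans (ℕ.*-distribʳ-+ 2 (k ℕ.* k) m)
        (trans (cong (λ x → k ℕ.* k ℕ.* 2 ℕ.+ x) (double-boxes b)) (e b)))
        where
        e : ∀ b → suc b ℕ.* suc b ℕ.* 2 ℕ.+ b ℕ.* suc b ≡ suc b ℕ.* (3 ℕ.* b ℕ.+ 2)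
        e = solve-∀

      ι-k : ι k ≡ κ
      ι-k = ι-suc b

      ι-x : ι (3 ℕ.* b ℕ.+ 2) ≡ 3ℚ * β + 2ℚ
      ι-x = trans (ι-+ (3 ℕ.* b) 2) (cong₂ _+_ (trans (ι-* 3 b) (cong (_* β) (ι-def 3))) (ι-def 2))

      ι-n : ι n ≡ ν
      ι-n = trans (half-ι n*2) (cong (½ *_) (trans (ι-* k _) (cong₂ _*_ ι-k ι-x)))

      ι-m : ι m ≡ μ
      ι-m = trans (half-ι (double-boxes b)) (cong (½ *_) (trans (ι-* b k) (cong (β *_) ι-k)))

      ι-M : ι M ≡ θ
      ι-M = trans (ι-+ k b) (trans (cong (_+ β) ι-k) (e β))
        where
        e : ∀ β → β + 1ℚ + β ≡ 2ℚ * β + 1ℚ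
        e = ℚ-solve-∀ ring

      ι-N : ι N ≡ κ * θ
      ι-N = trans (cong ι (boxes-M b)) (trans (ι-* k M) (cong₂ _*_ ι-k ι-M))

      L : ℕ → ℕ → ℚ
      L = logApprox

      f≢0 : ℕ.NonZero f
      f≢0 = ℕ.≢-nonZero λ f≡0 → ℕ.<⇒≱ (ℕ.>-nonZero⁻¹ (n ℕ.!) {{n ℕ.!≢0}})
        (subst (λ x → n ℕ.! ℕ.≤ x ℕ.* oddProduct k k) f≡0 (#SYT-υ-≥ b))

      syt-≥ : logFact n ≲ (λ i → L f i + oddSum (ι (k ℕ.+ k)) k i)
      syt-≥ = ≲-trans (proj₂ (log-! n)) (≲-trans (≤⇒≲ λ i → log-mono {n ℕ.!} i (#SYT-υ-≥ b))
        (≲-trans (proj₁ (log-*′ f (oddProduct k k) {{f≢0}} {{oddProduct≢0 k k}}))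
                 (≲-+ (≲-refl {L f}) (log-oddProduct-≤ k k))))

      syt-≤ : (λ i → L f i + logFact m i + oddSum (ι M) (b ℕ.+ b) i) ≲ (λ i → logFact N i + oddSum (ι k) b i)
      syt-≤ = ≲-trans (≲-+ (≲-+ (≲-refl {L f}) (proj₂ (log-! m))) (log-oddProduct-≥ (b ℕ.+ b) 1))
        (≲-trans (≲-+ (proj₂ (log-*′ f (m ℕ.!) {{f≢0}} {{m ℕ.!≢0}})) (≲-refl {L (oddProduct M 1)}))
        (≲-trans (proj₂ (log-*′ (f ℕ.* m ℕ.!) (oddProduct M 1) {{ℕ.m*n≢0 f (m ℕ.!) {{f≢0}} {{m ℕ.!≢0}}}} {{oddProduct≢0 M 1}}))
        (≲-trans (≤⇒≲ λ i → log-mono {f ℕ.* m ℕ.! ℕ.* oddProduct M 1} i (#SYT-υ-≤ b))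
        (≲-trans (proj₁ (log-*′ (N ℕ.!) (oddProduct b 1) {{N ℕ.!≢0}} {{oddProduct≢0 b 1}}))
                 (≲-+ (proj₁ (log-! N)) (log-oddProduct-≤ b 1))))))

      -- 2n = k(3k - 1).
      log-n-≥ : (λ i → 2ℚ * ν * (L 3 i + 2ℚ * L k i)) ≲ (λ i → 2ℚ * ν * (L 2 i + L n i) + κ)
      log-n-≥ = ≲-linear (≲-+ (≲-scale 0≤2ν (proj₂ (log-* 2 b))) (≲-scale 0≤2ν (≲-trans (proj₂ (log-*′ k x {{_}} {{x≢0}}))
          (subst (λ y → L y ≲ (λ i → L 2 i + L n i)) (trans (ℕ.*-comm 2 n) n*2) (proj₁ (log-*′ 2 n {{_}} {{size-υ-nonZero k}}))))))
        λ i → linear _ (0≤κ ⊛ diff (step i)) (e κ (3ℚ * β + 2ℚ) (L 3 i) (L k i) (L x i) (L (3 ℕ.* k) i) (L 2 i) (L n i))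
        where
        x = 3 ℕ.* b ℕ.+ 2
        x≢0 : ℕ.NonZero x
        x≢0 = subst ℕ.NonZero (ℕ.+-comm 2 (3 ℕ.* b)) _
        0≤κ : 0ℚ ≤ κ
        0≤κ = subst (0ℚ ≤_) ι-k (ι≥0 k)
        0≤2ν : 0ℚ ≤ 2ℚ * ν
        0≤2ν = ℚ.nonNegative⁻¹ 2ℚ ⊛ subst (0ℚ ≤_) ι-n (ι≥0 n)
        -- With x = 3k - 1, replacing log x by log 3k costs at most 1/x. As 2ν = κx, this becomes
        -- the error κ.
        step : ∀ i → (3ℚ * β + 2ℚ) * L (3 ℕ.* k) i ≤ (3ℚ * β + 2ℚ) * L x i + 1ℚ
        step i = subst₂ (λ y z → y * L z i ≤ y * L x i + 1ℚ) ι-x (suc-x b) (log-step-≤ x i)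
          where
          suc-x : ∀ b → suc (3 ℕ.* b ℕ.+ 2) ≡ 3 ℕ.* suc b
          suc-x = solve-∀
        e : ∀ k x l₃ a lx l₃ₖ t l →
          let n = ½ * (k * x) in
          (2ℚ * n * (t + l) + k + (2ℚ * n * (l₃ + a) + 2ℚ * n * (a + lx)))
            - (2ℚ * n * (l₃ + 2ℚ * a) + (2ℚ * n * l₃ₖ + 2ℚ * n * (t + l)))
          ≡ k * ((x * lx + 1ℚ) - x * l₃ₖ)
        e = ℚ-solve-∀ ring

      -- From 2m = bk: since 2μ = βκ and β(log k - log b) ≤ 1, replacing log b by log k costs at
      -- most κ.
      log-m-≥ : (λ i → 2ℚ * μ * (2ℚ * L k i)) ≲ (λ i → 2ℚ * μ * (L 2 i + L m i) + κ)
      log-m-≥ = ≲-linear (subst (λ y → (λ i → y * (L b i + L k i)) ≲ (λ i → y * (L 2 i + L m i))) ι-2m (log-boxes-≥ b))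
        λ i → linear _ (subst (0ℚ ≤_) ι-k (ι≥0 k) ⊛ diff (log-step-≤ b i)) (e β (L b i) (L k i) (L 2 i) (L m i))
        where
        ι-2m : ι (b ℕ.* suc b) ≡ β * κ
        ι-2m = trans (ι-* b k) (cong (β *_) ι-k)
        e : ∀ β lb a t l → let κ = β + 1ℚ ; m = ½ * (β * κ) in
          (2ℚ * m * (t + l) + κ + β * κ * (lb + a)) - (2ℚ * m * (2ℚ * a) + β * κ * (t + l))
          ≡ κ * ((β * lb + 1ℚ) - β * a)
        e = ℚ-solve-∀ ring

      log-N-≤ : L N ≲ (λ i → L k i + L M i)
      log-N-≤ = subst (λ y → L y ≲ (λ i → L k i + L M i)) (sym (boxes-M b)) (proj₁ (log-*′ k M))

      log-M-≤ : L M ≲ (λ i → L k i + L 2 i)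
      log-M-≤ = ≲-trans (≤⇒≲ λ i → log-mono {M} {k ℕ.* 2} i (ℕ.≤-trans (ℕ.n≤1+n M) (ℕ.≤-reflexive (e b)))) (proj₁ (log-*′ k 2))
        where
        e : ∀ b → suc (suc b ℕ.+ b) ≡ suc b ℕ.* 2
        e = solve-∀

      -- The last coefficient vanishes, so the closed form may be taken at K + 1 = x, where both of
      -- its parameters agree.
      oddSum-top : ∀ x K i → x ≡ ι (suc K) → oddSum x (suc K) i ≡ oddSum x K i
      oddSum-top x K i refl = e (oddSum x K i) x (L 2 i + L (suc K) i)
        where
        e : ∀ o x y → o + (x - x) * y ≡ o
        e = ℚ-solve-∀ ring

      closed : ℚ → ℚ → ℚ → ℚ → ℚ → ℚ
      closed x K t F S = ½ * ((2ℚ * x * K - K * (K + 1ℚ)) * t + 2ℚ * x * F - 2ℚ * S)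

      oddSum-k : ∀ i → oddSum (ι (k ℕ.+ k)) k i ≡ closed (κ + κ) κ (L 2 i) (logFact k i) (logHyper k i)
      oddSum-k i = trans (half (oddSum-closed (ι (k ℕ.+ k)) k i))
        (cong₂ (λ x K → closed x K (L 2 i) (logFact k i) (logHyper k i)) (trans (ι-+ k k) (cong₂ _+_ ι-k ι-k)) ι-k)

      oddSum-diagonal : ∀ K i {x} → ι (suc K) ≡ x → oddSum (ι (suc K)) K i ≡ closed x x (L 2 i) (logFact (suc K) i) (logHyper (suc K) i)
      oddSum-diagonal K i refl = trans (sym (oddSum-top (ι (suc K)) K i refl)) (half (oddSum-closed (ι (suc K)) (suc K) i))

      factorial-≥ : ∀ j i {x} → ι j ≡ x → 0ℚ ≤ (logFact j i + x) - x * L j i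
      factorial-≥ j i refl = diff (logFact-≥ j i)

      factorial-≤ : ∀ j i {x} → ι j ≡ x → 0ℚ ≤ (x * L j i + L j i + 1ℚ) - (logFact j i + x)
      factorial-≤ j i refl = diff (logFact-≤ j i)

      hyper-≥ : ∀ j i {x} → ι j ≡ x → 0ℚ ≤ (4ℚ * logHyper j i + x * x) - 2ℚ * (x * x) * L j i
      hyper-≥ j i refl = diff (logHyper-≥ j i)

      hyper-≤ : ∀ j i {x} → ι j ≡ x →
        0ℚ ≤ (2ℚ * (x * x) * L j i + 4ℚ * x + 4ℚ * (x * L j i)) - (4ℚ * logHyper j i + x * x)
      hyper-≤ j i refl = diff (logHyper-≤ j i)

      0≤β : 0ℚ ≤ β
      0≤β = ι≥0 b
      0≤κ : 0ℚ ≤ κ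
      0≤κ = subst (0ℚ ≤_) ι-k (ι≥0 k)
      0≤ν : 0ℚ ≤ ν
      0≤ν = subst (0ℚ ≤_) ι-n (ι≥0 n)
      0≤θ : 0ℚ ≤ θ
      0≤θ = subst (0ℚ ≤_) ι-M (ι≥0 M)

      infixr 8 _·≥0_
      _·≥0_ : ∀ q {p} .{{_ : ℚ.NonNegative q}} → 0ℚ ≤ p → 0ℚ ≤ q * p
      q ·≥0 h = ℚ.nonNegative⁻¹ q ⊛ h

      constant : ∀ q .{{_ : ℚ.NonNegative q}} → 0ℚ ≤ q
      constant q = ℚ.nonNegative⁻¹ q

    ι-size : ι n ≡ ν
    ι-size = ι-n

    -- To leading order k² = 2n/3. The factorial contributes n log n - n, the odd product
    -- (3/2)k²(log k + log 2) - (7/4)k², whence 1/6 = (2/3)(7/4) - 1.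
    log-#SYT-≥ : (λ i → ½ * (ν * L n i) + ν * (+ 1 / 6 - + 3 / 2 * L 2 i + ½ * L 3 i) - 8ℚ * κ * (1ℚ + L k i)) ≲ L f
    -- The weight 1/4 trades half of n log n for (n/2)(log 3 + 2 log k - log 2), which absorbs the
    -- log k of the odd product.
    log-#SYT-≥ = ≲-linear (≲-+ syt-≥ (≲-scale (constant ¼) log-n-≥)) λ i →
      linear _
        (factorial-≥ n i ι-n
          ⊕ constant 2ℚ ⊛ 0≤κ ⊛ factorial-≤ k i ι-k
          ⊕ constant ¼ ⊛ hyper-≥ k i ι-k
          -- What the lower-order errors leave of 8κ(1 + log k).
          ⊕ (constant (+ 19 / 3) ⊕ (+ 11 / 2) ·≥0 log≥0 k i ⊕ (+ 11 / 2) ·≥0 (log≥0 k i ⊛ 0≤β) ⊕ (+ 19 / 3) ·≥0 0≤β))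
        (trans (cong (λ o → (L f i + (logFact n i + ¼ * (2ℚ * ν * (L 3 i + 2ℚ * L k i))))
                  - ((½ * (ν * L n i) + ν * (+ 1 / 6 - + 3 / 2 * L 2 i + ½ * L 3 i) - 8ℚ * κ * (1ℚ + L k i))
                     + ((L f i + o) + ¼ * (2ℚ * ν * (L 2 i + L n i) + κ)))) (oddSum-k i))
          (e β (L k i) (L 2 i) (L 3 i) (L n i) (L f i) (logFact n i) (logFact k i) (logHyper k i)))
      where
      e : ∀ b a t l3 ln lf Fn Fk Sk →
        let k = b + 1ℚ ; n = ½ * (k * (3ℚ * b + 2ℚ))
            O = ½ * ((2ℚ * (k + k) * k - k * (k + 1ℚ)) * t + 2ℚ * (k + k) * Fk - 2ℚ * Sk)
        in (lf + (Fn + ¼ * (2ℚ * n * (l3 + 2ℚ * a))))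
           - ((½ * (n * ln) + n * (+ 1 / 6 - + 3 / 2 * t + ½ * l3) - 8ℚ * k * (1ℚ + a))
              + ((lf + O) + ¼ * (2ℚ * n * (t + ln) + k)))
         ≡ ((Fn + n) - n * ln) + 2ℚ * k * ((k * a + a + 1ℚ) - (Fk + k))
           + ¼ * ((4ℚ * Sk + k * k) - 2ℚ * (k * k) * a)
           + (+ 19 / 3 + + 11 / 2 * a + + 11 / 2 * (a * b) + + 19 / 3 * b)
      e = ℚ-solve-∀ ring

    -- The slack uses 2 log 3 ≥ 3 log 2 + 1/9 and 1/2 ≤ log 2 ≤ 1.
    log-#SYT-≤ : L f ≲ (λ i → ½ * (ν * L n i) + ν * (+ 1 / 6 - + 7 / 2 * L 2 i + 2ℚ * L 3 i) + 8ℚ * κ * (1ℚ + L k i))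
    log-#SYT-≤ = ≲-linear
      (≲-+ (≲-+ (≲-+ (≲-+ (≲-+ syt-≤
        (≲-scale (0≤κ ⊛ 0≤θ ⊕ constant 1ℚ) log-N-≤))
        -- The coefficients quadratic in M of log M cancel, because 2k = M + 1; this weight is the
        -- linear rest.
        (≲-scale ((+ 3 / 2) ·≥0 0≤θ ⊕ constant 1ℚ) log-M-≤))
        (≲-scale (constant ½) log-m-≥))
        (≲-scale (constant ¼) log-n-≥))
        -- The argument yields the constant 1/2 - (1/6) log 2 - (1/2) log 3, and the claimed one
        -- exceeds it by (5/2) log 3 - (10/3) log 2 - 1/3. Replacing 2 log 3 with weight 5/4 leaves
        -- (5/12) log 2 - 7/36, at least 1/72; multiplied by n ~ (3/2)k², these become the
        -- coefficients 5/8 and 1/48 below.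
        (≲-scale ((+ 5 / 4) ·≥0 0≤ν) log-3-≥))
      λ i → linear _
        (factorial-≥ m i ι-m ⊕ factorial-≤ N i ι-N ⊕ 0≤θ ⊛ factorial-≥ M i ι-M
          ⊕ constant ¼ ⊛ hyper-≤ M i ι-M
          ⊕ 0≤κ ⊛ factorial-≤ k i ι-k ⊕ constant ¼ ⊛ hyper-≥ k i ι-k
          ⊕ (constant (+ 101 / 36) ⊕ 3ℚ ·≥0 log≥0 k i ⊕ (+ 7 / 2) ·≥0 (log≥0 k i ⊛ 0≤β) ⊕ (+ 43 / 18) ·≥0 0≤β
            ⊕ (+ 1 / 48) ·≥0 (0≤β ⊛ 0≤β) ⊕ (+ 5 / 8) ·≥0 (0≤β ⊛ 0≤β) ⊛ diff (½≤log-2 i)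
            ⊕ (+ 29 / 8) ·≥0 0≤β ⊛ diff (log-2≤1 i) ⊕ (+ 11 / 4) ·≥0 diff (log-2≤1 i)))
        (trans (cong₂ (λ o₁ o₂ →
            ((½ * (ν * L n i) + ν * (+ 1 / 6 - + 7 / 2 * L 2 i + 2ℚ * L 3 i) + 8ℚ * κ * (1ℚ + L k i))
              + ((L f i + logFact m i + o₁) + (κ * θ + 1ℚ) * L N i + (+ 3 / 2 * θ + 1ℚ) * L M i + ½ * (2ℚ * μ * (2ℚ * L k i))
                 + ¼ * (2ℚ * ν * (L 3 i + 2ℚ * L k i)) + + 5 / 4 * ν * (3ℚ * L 2 i + + 1 / 9)))
            - (L f i + ((logFact N i + o₂) + (κ * θ + 1ℚ) * (L k i + L M i) + (+ 3 / 2 * θ + 1ℚ) * (L k i + L 2 i)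
                 + ½ * (2ℚ * μ * (L 2 i + L m i) + κ) + ¼ * (2ℚ * ν * (L 2 i + L n i) + κ) + + 5 / 4 * ν * (2ℚ * L 3 i))))
            (oddSum-diagonal (b ℕ.+ b) i ι-M) (oddSum-diagonal b i ι-k))
          (e β (L k i) (L 2 i) (L 3 i) (L n i) (L f i) (logFact k i) (logHyper k i) (logFact m i) (L m i)
             (logFact N i) (L N i) (logFact M i) (logHyper M i) (L M i)))
      where
      e : ∀ b a t l3 ln lf Fk Sk Fm lm FN lN FM SM lM →
        let k = b + 1ℚ ; n = ½ * (k * (3ℚ * b + 2ℚ)) ; m = ½ * (b * k) ; M = 2ℚ * b + 1ℚ ; N = k * M
            O₁ = ½ * ((2ℚ * M * M - M * (M + 1ℚ)) * t + 2ℚ * M * FM - 2ℚ * SM)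
            O₂ = ½ * ((2ℚ * k * k - k * (k + 1ℚ)) * t + 2ℚ * k * Fk - 2ℚ * Sk)
            u = + 3 / 2 * M + 1ℚ
        in ((½ * (n * ln) + n * (+ 1 / 6 - + 7 / 2 * t + 2ℚ * l3) + 8ℚ * k * (1ℚ + a))
              + ((lf + Fm + O₁) + (N + 1ℚ) * lN + u * lM + ½ * (2ℚ * m * (2ℚ * a))
                 + ¼ * (2ℚ * n * (l3 + 2ℚ * a)) + + 5 / 4 * n * (3ℚ * t + + 1 / 9)))
           - (lf + ((FN + O₂) + (N + 1ℚ) * (a + lM) + u * (a + t) + ½ * (2ℚ * m * (t + lm) + k)
                 + ¼ * (2ℚ * n * (t + ln) + k) + + 5 / 4 * n * (2ℚ * l3)))
         ≡ ((Fm + m) - m * lm) + ((N * lN + lN + 1ℚ) - (FN + N)) + M * ((FM + M) - M * lM)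
           + ¼ * ((2ℚ * (M * M) * lM + 4ℚ * M + 4ℚ * (M * lM)) - (4ℚ * SM + M * M))
           + k * ((k * a + a + 1ℚ) - (Fk + k)) + ¼ * ((4ℚ * Sk + k * k) - 2ℚ * (k * k) * a)
           + (+ 101 / 36 + 3ℚ * a + + 7 / 2 * (a * b) + + 43 / 18 * b + + 1 / 48 * (b * b)
              + + 5 / 8 * (b * b) * (t - ½) + + 29 / 8 * b * (1ℚ - t) + + 11 / 4 * (1ℚ - t))
      e = ℚ-solve-∀ ring

  -- The error term

  log≤id : ∀ m N → logApprox m N ≤ ι m
  log≤id zero          N = ι≥0 0
  log≤id (suc zero)    N = ι≥0 1
  log≤id (suc (suc j)) N = ℚ.≤-trans (log-suc-≤ j N) (ℚ.≤-trans (ℚ.+-mono-≤ (log≤id (suc j) N) small)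
    (ℚ.≤-reflexive (sym (ι-suc (suc j)))))
    where
    small : reciprocal j ≤ 1ℚ
    small = reciprocal-≤ {j} {1ℚ} (subst (1ℚ ≤_) (sym (ℚ.*-identityˡ (ι (suc j))))
      (subst (_≤ ι (suc j)) (ι-def 1) (ι-mono {1} {suc j} (s≤s z≤n))))

  -- Beyond Q = q + 1 the increments of log are at most 1/Q.
  log-sublinear : ∀ q m N → ι (suc q) * logApprox m N ≤ ι (suc q) * ι (suc q) + ι m
  log-sublinear q m N with ℕ.≤-total m (suc q)
  ... | inj₁ m≤Q = linear _ (ι≥0 (suc q) ⊛ diff (ℚ.≤-trans (log≤id m N) (ι-mono m≤Q)) ⊕ ι≥0 m)
        (e (ι (suc q)) (logApprox m N) (ι m))
    where
    e : ∀ Q l x → (Q * Q + x) - Q * l ≡ Q * (Q - l) + x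
    e = ℚ-solve-∀ ring
  ... | inj₂ Q≤m = subst (λ m → ι (suc q) * logApprox m N ≤ ι (suc q) * ι (suc q) + ι m) (ℕ.m∸n+n≡m Q≤m) (beyond (m ℕ.∸ suc q))
    where
    Q = ι (suc q)
    beyond : ∀ d → Q * logApprox (d ℕ.+ suc q) N ≤ Q * Q + ι (d ℕ.+ suc q)
    beyond zero    = linear _ (ι≥0 (suc q) ⊛ diff (log≤id (suc q) N) ⊕ ι≥0 (suc q)) (e Q (logApprox (suc q) N))
      where
      e : ∀ Q l → (Q * Q + Q) - Q * l ≡ Q * (Q - l) + Q
      e = ℚ-solve-∀ ring
    beyond (suc d) = step (d ℕ.+ suc q) (ℕ.m≤n+m (suc q) d) (beyond d)
      where
      step : ∀ j → suc q ℕ.≤ j → Q * logApprox j N ≤ Q * Q + ι j → Q * logApprox (suc j) N ≤ Q * Q + ι (suc j)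
      step (suc j) Q≤j ih = linear _
        (ι≥0 (suc q) ⊛ diff (log-suc-≤ j N) ⊕ diff ih ⊕ (reciprocal≥0 j ⊛ diff (ι-mono Q≤j)))
        (trans (cong (λ x → Q * Q + x - Q * logApprox (2 ℕ.+ j) N) (trans (ι-suc (suc j)) (cong (λ x → ι (suc j) + x) (sym (reciprocal-inverse j)))))
               (e Q (logApprox (suc j) N) (logApprox (2 ℕ.+ j) N) (ι (suc j)) (reciprocal j)))
        where
        e : ∀ Q l l′ x r → Q * Q + (x + r * x) - Q * l′ ≡ Q * ((l + r) - l′) + ((Q * Q + x) - Q * l) + r * (x - Q)
        e = ℚ-solve-∀ ring

  archimedean : ∀ ε → 0ℚ < ε → ∃[ d ] 1ℚ ≤ ε * ι (suc d)
  archimedean (mkℚ (+ zero)       _ _) (ℚ.*<* (ℤ.+<+ ()))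
  archimedean (mkℚ (ℤ.-[1+ _ ])   _ _) (ℚ.*<* ())
  archimedean ε@(mkℚ (+ suc p) d _) _ = d , ℚ.toℚᵘ-cancel-≤ (ℚᵘ.≤-respʳ-≃
    (ℚᵘ.≃-sym (ℚᵘ.≃-trans (ℚ.toℚᵘ-homo-* ε (ι (suc d))) (ℚᵘ.*-congˡ {ℚ.toℚᵘ ε} (toℚᵘ-ι (suc d)))))
    (ℚᵘ.*≤* (ℤ.+≤+ (subst₂ ℕ._≤_ (e₁ d) (e₂ p d) (ℕ.m≤m+n (suc d) (p ℕ.* suc d))))))
    where
    e₁ : ∀ d → suc d ≡ 1 ℕ.* (suc d ℕ.* 1)
    e₁ = solve-∀
    e₂ : ∀ p d → suc d ℕ.+ p ℕ.* suc d ≡ suc p ℕ.* suc d ℕ.* 1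
    e₂ = solve-∀

  -- A bound for 8k(1 + log k)/n, using n ≥ k².
  error : ℕ → ℝ
  error zero    = fromℚ 0ℚ
  error (suc b) = (8ℚ * reciprocal b) · (fromℚ 1ℚ +ᴿ log (suc b))

  error≥0 : ∀ k i → 0ℚ ≤ approx (error k) i
  error≥0 zero    i = ℚ.≤-refl
  error≥0 (suc b) i = ℚ.nonNegative⁻¹ 8ℚ ⊛ reciprocal≥0 b ⊛ (ℚ.nonNegative⁻¹ 1ℚ ⊕ log≥0 (suc b) i)

  16ℚ : ℚ
  16ℚ = + 16 / 1

  -- With Q = q + 1, sublinearity gives Q(1 + log k) ≤ Q + Q² + k ≤ 2k, so Q times the error is at
  -- most 16.
  error-small : ∀ q b i ε → 16ℚ ≤ ε * ι (suc q) → suc q ℕ.+ suc q ℕ.* suc q ℕ.≤ suc b → approx (error (suc b)) i ≤ ε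
  error-small q b i ε 16≤εQ Q≤k = ℚ.*-cancelʳ-≤-pos Q {{Q⁺}} (linear _
    (diff 16≤εQ ⊕ ℚ.nonNegative⁻¹ 8ℚ ⊛ reciprocal≥0 b ⊛ (diff (log-sublinear q (suc b) i) ⊕ diff Q≤κ))
    (trans (cong (λ x → ε * Q - x) (e₁ r Q l))
      (trans (e₂ ε Q r l κ) (cong (λ x → (ε * Q - (8ℚ + 8ℚ) * x) + 8ℚ * r * (((Q * Q + κ) - Q * l) + (κ - (Q + Q * Q)))) (reciprocal-inverse b)))))
    where
    Q = ι (suc q)
    κ = ι (suc b)
    r = reciprocal b
    l = logApprox (suc b) i
    Q⁺ : ℚ.Positive Q
    Q⁺ = ℚ.positive (ℚ.<-≤-trans (ℚ.positive⁻¹ 1ℚ) (subst (_≤ Q) (ι-def 1) (ι-mono {1} {suc q} (s≤s z≤n))))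
    Q≤κ : Q + Q * Q ≤ κ
    Q≤κ = subst (_≤ κ) (trans (ι-+ (suc q) (suc q ℕ.* suc q)) (cong (λ x → Q + x) (ι-* (suc q) (suc q)))) (ι-mono Q≤k)
    e₁ : ∀ r Q l → 8ℚ * r * (1ℚ + l) * Q ≡ 8ℚ * r * (Q + Q * l)
    e₁ = ℚ-solve-∀ ring
    e₂ : ∀ ε Q r l κ → ε * Q - 8ℚ * r * (Q + Q * l)
      ≡ (ε * Q - (8ℚ + 8ℚ) * (r * κ)) + 8ℚ * r * (((Q * Q + κ) - Q * l) + (κ - (Q + Q * Q)))
    e₂ = ℚ-solve-∀ ring

  error-eventually : ∀ ε → 0ℚ < ε → ∃[ K ] (∀ k → K ℕ.≤ k → ∀ i → approx (error k) i ≤ ε)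
  error-eventually ε 0<ε with archimedean ε 0<ε
  ... | d , 1≤εd = suc q ℕ.+ suc q ℕ.* suc q , bound
    where
    -- This makes q + 1 equal to 16(d + 1).
    q = d ℕ.+ 15 ℕ.* suc d
    16≤ : 16ℚ ≤ ε * ι (suc q)
    16≤ = linear _ (ℚ.nonNegative⁻¹ 16ℚ ⊛ diff 1≤εd)
      (trans (cong (λ x → ε * x - 16ℚ) (trans (ι-* 16 (suc d)) (cong (_* ι (suc d)) (ι-def 16)))) (e ε (ι (suc d))))
      where
      e : ∀ ε D → ε * (16ℚ * D) - 16ℚ ≡ 16ℚ * (ε * D - 1ℚ)
      e = ℚ-solve-∀ ring
    bound : ∀ k → suc q ℕ.+ suc q ℕ.* suc q ℕ.≤ k → ∀ i → approx (error k) i ≤ ε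
    bound (suc b) le i = error-small q b i ε 16≤ le

  ≲⇒≤ᴿ : ∀ {x y} → approx x ≲ approx y → x ≤ᴿ y
  ≲⇒≤ᴿ = within

  error→0 : TendsToZero error
  error→0 ε 0<ε = let K , h = error-eventually ε 0<ε in K , λ k le →
      ≲⇒≤ᴿ {fromℚ (- ε)} {error k} (≤⇒≲ λ i → ℚ.≤-trans (ℚ.neg-antimono-≤ (ℚ.<⇒≤ 0<ε)) (error≥0 k i))
    , ≲⇒≤ᴿ {error k} {fromℚ ε} (≤⇒≲ λ i → h k le i)

  -error→0 : TendsToZero (λ k → -ᴿ error k)
  -error→0 ε 0<ε = let K , h = error-eventually ε 0<ε in K , λ k le →
      ≲⇒≤ᴿ {fromℚ (- ε)} { -ᴿ error k} (≤⇒≲ λ i → linear _ (diff (h k le i)) (e₁ ε (approx (error k) i)))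
    , ≲⇒≤ᴿ { -ᴿ error k} {fromℚ ε} (≤⇒≲ λ i → linear _ (ℚ.<⇒≤ 0<ε ⊕ error≥0 k i) (e₂ ε (approx (error k) i)))
    where
    e₁ : ∀ ε x → - 1ℚ * x - - ε ≡ ε - x
    e₁ = ℚ-solve-∀ ring
    e₂ : ∀ ε x → ε - - 1ℚ * x ≡ ε + x
    e₂ = ℚ-solve-∀ ring

  1/n*n : ∀ n .{{_ : ℕ.NonZero n}} → (+ 1 / n) * ι n ≡ 1ℚ
  1/n*n (suc x) = reciprocal-inverse x

  -- Division by n

  module _ (b : ℕ) where
    private
      k n : ℕ
      k = suc b
      n = size (υ k)
      instance
        n≢0 : ℕ.NonZero n
        n≢0 = size-υ-nonZero k
      r κ : ℚ
      r = + 1 / n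
      κ = ι b + 1ℚ

      inverse : r * ι n ≡ 1ℚ
      inverse = 1/n*n n

      r≥0 : 0ℚ ≤ r
      r≥0 = ℚ.nonNegative⁻¹ r {{ℚ.normalize-nonNeg 1 n}}

      rκ≤1/k : r * κ ≤ reciprocal b
      rκ≤1/k = reciprocal-≥ {b} (subst (r * κ * ι k ≤_) inverse (subst (_≤ r * ι n) (e r κ (ι k) (ι-suc b))
          (*-monoˡ r≥0 (subst (_≤ ι n) (ι-* k k) (ι-mono (ℕ.≤-trans (ℕ.m≤m+n (k ℕ.* k) (boxes b)) (ℕ.≤-reflexive (sym (size-υ-boxes b)))))))))
        where
        e : ∀ r κ x → x ≡ κ → r * (x * x) ≡ r * κ * x
        e r κ x refl = sym (ℚ.*-assoc r x x)

      quotient : ℝ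
      quotient = r · (log (#SYT (υ k)) -ᴿ (+ 1 / 2) · (+ n / 1) · log n)

      slack≥0 : ∀ i → 0ℚ ≤ (8ℚ * (reciprocal b - r * κ)) * (1ℚ + logApprox k i)
      slack≥0 i = ℚ.nonNegative⁻¹ 8ℚ ⊛ diff rκ≤1/k ⊛ (ℚ.nonNegative⁻¹ 1ℚ ⊕ log≥0 k i)

      ν≡ : + n / 1 ≡ ½ * (κ * (3ℚ * ι b + 2ℚ)) × r * (½ * (κ * (3ℚ * ι b + 2ℚ))) ≡ 1ℚ
      ν≡ = trans (sym (ι-def n)) (ι-size b) , trans (cong (r *_) (sym (ι-size b))) inverse

      unit : ∀ {x} s y → x ≡ 1ℚ → s + (x - 1ℚ) * y ≡ s
      unit s y refl = e s y
        where
        e : ∀ s y → s + (1ℚ - 1ℚ) * y ≡ s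
        e = ℚ-solve-∀ ring

    #SYT-lower : fromℚ (+ 1 / 6) -ᴿ (+ 3 / 2) · log 2 +ᴿ (+ 1 / 2) · log 3 +ᴿ -ᴿ error k ≤ᴿ quotient
    #SYT-lower = ≲⇒≤ᴿ {fromℚ (+ 1 / 6) -ᴿ (+ 3 / 2) · log 2 +ᴿ (+ 1 / 2) · log 3 +ᴿ -ᴿ error k} {quotient}
      (≲-linear (≲-scale r≥0 (log-#SYT-≥ b)) λ i → linear _ (slack≥0 i)
        (e r κ (reciprocal b) ν≡ (logApprox k i) (logApprox 2 i) (logApprox 3 i) (logApprox n i) (logApprox (#SYT (υ k)) i)))
      where
      e : ∀ r κ ρ {ν ν′} → ν′ ≡ ν × r * ν ≡ 1ℚ → ∀ a t l3 ln lf →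
        (r * (lf + - 1ℚ * (½ * (ν′ * ln))) + r * (½ * (ν * ln) + ν * (+ 1 / 6 - + 3 / 2 * t + ½ * l3) - 8ℚ * κ * (1ℚ + a)))
          - (+ 1 / 6 + - 1ℚ * (+ 3 / 2 * t) + ½ * l3 + - 1ℚ * (8ℚ * ρ * (1ℚ + a)) + r * lf)
        ≡ 8ℚ * (ρ - r * κ) * (1ℚ + a)
      e r κ ρ {ν} (refl , rν≡1) a t l3 ln lf = trans (e′ r κ ρ ν a t l3 ln lf) (unit _ _ rν≡1)
        where
        e′ : ∀ r κ ρ ν a t l3 ln lf →
          (r * (lf + - 1ℚ * (½ * (ν * ln))) + r * (½ * (ν * ln) + ν * (+ 1 / 6 - + 3 / 2 * t + ½ * l3) - 8ℚ * κ * (1ℚ + a)))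
            - (+ 1 / 6 + - 1ℚ * (+ 3 / 2 * t) + ½ * l3 + - 1ℚ * (8ℚ * ρ * (1ℚ + a)) + r * lf)
          -- The ring identity cannot use rν = 1, so its defect is kept as a multiple of rν - 1,
          -- which `unit` removes.
          ≡ 8ℚ * (ρ - r * κ) * (1ℚ + a) + (r * ν - 1ℚ) * (+ 1 / 6 - + 3 / 2 * t + ½ * l3)
        e′ = ℚ-solve-∀ ring

    #SYT-upper : quotient ≤ᴿ fromℚ (+ 1 / 6) -ᴿ (+ 7 / 2) · log 2 +ᴿ (+ 2 / 1) · log 3 +ᴿ error k
    #SYT-upper = ≲⇒≤ᴿ {quotient} {fromℚ (+ 1 / 6) -ᴿ (+ 7 / 2) · log 2 +ᴿ (+ 2 / 1) · log 3 +ᴿ error k}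
      (≲-linear (≲-scale r≥0 (log-#SYT-≤ b)) λ i → linear _ (slack≥0 i)
        (e r κ (reciprocal b) ν≡ (logApprox k i) (logApprox 2 i) (logApprox 3 i) (logApprox n i) (logApprox (#SYT (υ k)) i)))
      where
      e : ∀ r κ ρ {ν ν′} → ν′ ≡ ν × r * ν ≡ 1ℚ → ∀ a t l3 ln lf →
        (+ 1 / 6 + - 1ℚ * (+ 7 / 2 * t) + 2ℚ * l3 + 8ℚ * ρ * (1ℚ + a) + r * lf)
          - (r * (lf + - 1ℚ * (½ * (ν′ * ln))) + r * (½ * (ν * ln) + ν * (+ 1 / 6 - + 7 / 2 * t + 2ℚ * l3) + 8ℚ * κ * (1ℚ + a)))
        ≡ 8ℚ * (ρ - r * κ) * (1ℚ + a)
      -- The defect now has the factor 1 - rν, written (2 - rν) - 1 to fit `unit`.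
      e r κ ρ {ν} (refl , rν≡1) a t l3 ln lf = trans (e′ r κ ρ ν a t l3 ln lf) (unit _ _ (cong (λ x → 2ℚ - x) rν≡1))
        where
        e′ : ∀ r κ ρ ν a t l3 ln lf →
          (+ 1 / 6 + - 1ℚ * (+ 7 / 2 * t) + 2ℚ * l3 + 8ℚ * ρ * (1ℚ + a) + r * lf)
            - (r * (lf + - 1ℚ * (½ * (ν * ln))) + r * (½ * (ν * ln) + ν * (+ 1 / 6 - + 7 / 2 * t + 2ℚ * l3) + 8ℚ * κ * (1ℚ + a)))
          ≡ 8ℚ * (ρ - r * κ) * (1ℚ + a) + ((2ℚ - r * ν) - 1ℚ) * (+ 1 / 6 - + 7 / 2 * t + 2ℚ * l3)
        e′ = ℚ-solve-∀ ring

theorem1p1 :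
    ∃[ o₁ ] ∃[ o₂ ] TendsToZero o₁ × TendsToZero o₂ ×
      ((k : ℕ) → .{{_ : NonZero k}} →
        let n = size (υ k)
            quotient = (+ 1 / n) {{size-υ-nonZero k}} · (log (#SYT (υ k)) -ᴿ (+ 1 / 2) · (+ n / 1) · log n)
        in (fromℚ (+ 1 / 6) -ᴿ (+ 3 / 2) · log 2 +ᴿ (+ 1 / 2) · log 3 +ᴿ o₁ k ≤ᴿ quotient)
           × (quotient ≤ᴿ fromℚ (+ 1 / 6) -ᴿ (+ 7 / 2) · log 2 +ᴿ (+ 2 / 1) · log 3 +ᴿ o₂ k))
theorem1p1 = (λ k → -ᴿ error k) , error , -error→0 , error→0 , λ { (suc b) → #SYT-lower b , #SYT-upper b }
  where open Asymptotics
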